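{- Let $E/k$ be a separable field extension of degree $d$, and let $\widehat E/k$ be its Galois closure. Let $\mathscr L$ be the set of overfields $L$ of $k$ such that $E/k$ is potentially Galois over $L$, let $\mathscr G$ be the set of complements of $\mathrm{Gal}(\widehat E/E)$ in $\mathrm{Gal}(\widehat E/k)$, and let $\mathbb G:\mathscr L\to\mathscr G$ be the map $L\mapsto \mathbb G(L)=\mathrm{res}(\mathrm{Gal}(EL/L))$, where $\mathrm{res}:\mathrm{Gal}(EL/L)\to\mathrm{Gal}(\widehat E/k)$ is restriction. Let $\mathscr L_{\mathrm m}\subset\mathscr L$ be the subset of minimal fields $L$ in $\mathscr L$ (for inclusion). (a) The restriction $\mathbb G:\mathscr L_{\mathrm m}\to\mathscr G$ of $\mathbb G$ to $\mathscr L_{\mathrm m}$ is a bijection whose inverse is the map $\mathbb L:\mathscr G\to\mathscr L_{\mathrm m}$ defined by $\mathbb L(G)=\widehat E^G$. (b) For each $L\in\mathscr L_{\mathrm m}$, we have $L\subset\widehat E$, $EL=\widehat E$, and the extension $E/k$ is potentially Galois over $L$ with group $\mathbb G(L)=\mathrm{Gal}(\widehat E/L)$. (c) For every $L\in\mathscr L$, there is a unique $L_0\in\mathscr L_{\mathrm m}$ such that $L_0\subset L$; and $L_0=\mathbb L(\mathbb G(L))$. The extension $EL/L$ is obtained from $EL_0/L_0$ by base change. Furthermore, $\mathbb G(L)=\mathbb G(L_0)$. Finally, if $L/k$ is Galois, so is $L_0/k$, and $\mathbb G(L)$ is normal in $\mathrm{Gal}(\widehat E/k)$.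
   Context: All fields are taken inside a fixed field $\Omega$ containing $\widehat E$ (overfields $L$ of $k$ are subfields of $\Omega$, not necessarily algebraic over $k$), so that composita $EL$ make sense. $E/k$ is potentially Galois over $L$ with group $G$ if $E\otimes_kL$ is a Galois field extension of $L$ with Galois group $G$; equivalently, $EL/L$ is Galois of degree $[E:k]$ with group $G$. In that case $\widehat E\subset EL$, and the restriction map $\mathrm{res}$ is injective with image a complement of $\mathrm{Gal}(\widehat E/E)$, so the map $\mathbb G$ is well defined. A subgroup $U$ is a complement of a subgroup $V$ in a group $\Gamma$ if every element of $\Gamma$ can be uniquely written as $uv$ with $u\in U$, $v\in V$. $\widehat E^G$ is the fixed field of $G$ in $\widehat E$. The sets $\mathscr L$, $\mathscr G$ may be empty. -}

module Defs where

open import Level using () renaming (suc to lsuc)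
open import Algebra.Bundles using (CommutativeRing; Group; AbelianGroup; RawRing)
open import Algebra.Definitions.RawMonoid using (sum)
open import Algebra.Morphism.Structures using (IsRingHomomorphism; IsRingIsomorphism; IsGroupIsomorphism)
import Algebra.Morphism.Construct.Composition as Composition
import Algebra.Morphism.Construct.Identity as Identity
import Algebra.Properties.AbelianGroup as AbelianGroupProperties
import Algebra.Properties.CommutativeSemigroup as CommutativeSemigroupProperties
open import Data.Fin.Base using (Fin)
open import Data.List.Base using (List; []; _∷_; _∷ʳ_; foldr; length; map)
open import Data.Nat.Base using (ℕ; zero; suc; _≤_)
open import Data.Product.Base using (Σ; Σ-syntax; ∃; ∃-syntax; _×_; _,_; proj₁; proj₂)
open import Function.Base using (_∘_)
open import Relation.Binary.Core using (Rel)
import Relation.Binary.Reasoning.Setoid as SetoidReasoning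
open import Relation.Nullary.Negation using (¬_)
open import Relation.Unary using (Pred; _≐_)

record IsField {a} (R : CommutativeRing a a) : Set a where
  open CommutativeRing R
  field
    nontrivial : ¬ 1# ≈ 0#
    invertible : ∀ {x} → ¬ x ≈ 0# → ∃[ y ] x * y ≈ 1#

-- Between fields a homomorphism is automatically injective, hence a field
-- extension.
record Hom {a} (K M : CommutativeRing a a) : Set a where
  private
    module K = CommutativeRing K
    module M = CommutativeRing M
  field
    ⟦_⟧                : K.Carrier → M.Carrier
    isRingHomomorphism : IsRingHomomorphism K.rawRing M.rawRing ⟦_⟧
  open IsRingHomomorphism isRingHomomorphism public

mkIsRingHomomorphism : ∀ {a} {A B : RawRing a a} →
  let module A = RawRing A
      module B = RawRing B in
  (f : A.Carrier → B.Carrier) →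
  (∀ {x y} → x A.≈ y → f x B.≈ f y) →
  (∀ x y → f (x A.+ y) B.≈ f x B.+ f y) →
  (∀ x y → f (x A.* y) B.≈ f x B.* f y) →
  f A.0# B.≈ B.0# →
  f A.1# B.≈ B.1# →
  (∀ x → f (A.- x) B.≈ B.- f x) →
  IsRingHomomorphism A B f
mkIsRingHomomorphism f cong + * 0# 1# - = record
  { isSemiringHomomorphism = record
    { isNearSemiringHomomorphism = record
      { +-isMonoidHomomorphism = record
        { isMagmaHomomorphism = record
          { isRelHomomorphism = record { cong = cong }
          ; homo = +
          }
        ; ε-homo = 0#
        }
      ; *-homo = *
      }
    ; 1#-homo = 1#
    }
  ; -‿homo = -
  }

-- A polynomial is the list of its coefficients, constant term first;
-- trailing zeros are allowed.

module Polynomial {a} (R : CommutativeRing a a) where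
  open CommutativeRing R

  Poly : Set a
  Poly = List Carrier

  coeff : Poly → ℕ → Carrier
  coeff []      n       = 0#
  coeff (c ∷ f) zero    = c
  coeff (c ∷ f) (suc n) = coeff f n

  infix 4 _≈ₚ_
  _≈ₚ_ : Rel Poly a
  f ≈ₚ g = ∀ n → coeff f n ≈ coeff g n

  infixl 6 _+ₚ_
  _+ₚ_ : Poly → Poly → Poly
  []      +ₚ g       = g
  (c ∷ f) +ₚ []      = c ∷ f
  (c ∷ f) +ₚ (d ∷ g) = c + d ∷ f +ₚ g

  infixl 7 _*ₚ_
  _*ₚ_ : Poly → Poly → Poly
  []      *ₚ g = []
  (c ∷ f) *ₚ g = map (c *_) g +ₚ (0# ∷ f *ₚ g)

  1ₚ : Poly
  1ₚ = 1# ∷ []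

  -- (c + X f)′ = f + X f′
  derivative : Poly → Poly
  derivative []      = []
  derivative (c ∷ f) = f +ₚ (0# ∷ derivative f)

  eval : Poly → Carrier → Carrier
  eval f x = foldr (λ c r → c + x * r) 0# f

  -- The monic polynomial of degree  length cs  with lower coefficients cs.
  monic : List Carrier → Poly
  monic cs = cs ∷ʳ 1#

  X-_ : Carrier → Poly
  X- r = - r ∷ 1# ∷ []

  -- f is coprime to its derivative, that is, f has no multiple root in
  -- any extension.
  Separable : Poly → Set a
  Separable f = ∃[ u ] ∃[ v ] u *ₚ f +ₚ v *ₚ derivative f ≈ₚ 1ₚ

module Extension {a} {K M : CommutativeRing a a} (φ : Hom K M) where
  private
    module K = CommutativeRing K
    module M = CommutativeRing M
    module K[X] = Polynomial K
    module M[X] = Polynomial M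
  open Hom φ using (⟦_⟧)

  HasDegree : ℕ → Set a
  HasDegree d = Σ[ b ∈ (Fin d → M.Carrier) ]
    let combination : (Fin d → K.Carrier) → M.Carrier
        combination c = sum M.+-rawMonoid (λ i → ⟦ c i ⟧ M.* b i)
    in (∀ x → ∃[ c ] combination c M.≈ x)
     × (∀ c → combination c M.≈ M.0# → ∀ i → c i K.≈ K.0#)

  _IsRootOf_ : M.Carrier → K[X].Poly → Set a
  x IsRootOf f = M[X].eval (map ⟦_⟧ f) x M.≈ M.0#

  -- monic cs  is the minimal polynomial of x over K.
  IsMinimalPolynomial : M.Carrier → List K.Carrier → Set a
  IsMinimalPolynomial x cs =
      x IsRootOf K[X].monic cs
    × (∀ ds → x IsRootOf K[X].monic ds → length cs ≤ length ds)

  SplitsInto : K[X].Poly → List M.Carrier → Set a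
  SplitsInto f rs = map ⟦_⟧ f M[X].≈ₚ foldr (λ r g → (M[X].X- r) M[X].*ₚ g) M[X].1ₚ rs

  IsSeparable : Set a
  IsSeparable = ∀ x → ∃[ cs ] IsMinimalPolynomial x cs × K[X].Separable (K[X].monic cs)

  IsNormal : Set a
  IsNormal = ∀ x → ∃[ cs ] IsMinimalPolynomial x cs × ∃[ rs ] SplitsInto (K[X].monic cs) rs

  -- The extension is not required to be finite.
  IsGalois : Set a
  IsGalois = IsSeparable × IsNormal

  record Automorphism : Set a where
    field
      fun               : M.Carrier → M.Carrier
      isRingIsomorphism : IsRingIsomorphism M.rawRing M.rawRing fun
      fixes             : ∀ c → fun ⟦ c ⟧ M.≈ ⟦ c ⟧
    open IsRingIsomorphism isRingIsomorphism public

  open Automorphism using (fun; fixes)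

  private
    inverse : Automorphism → Automorphism
    inverse σ = record
      { fun = inv
      ; isRingIsomorphism = record
        { isRingMonomorphism = record
          { isRingHomomorphism = mkIsRingHomomorphism inv inv-cong
              (λ x y → σ.injective (M.trans (right (x M.+ y)) (M.sym
                (M.trans (σ.+-homo (inv x) (inv y)) (M.+-cong (right x) (right y))))))
              (λ x y → σ.injective (M.trans (right (x M.* y)) (M.sym
                (M.trans (σ.*-homo (inv x) (inv y)) (M.*-cong (right x) (right y))))))
              (σ.injective (M.trans (right M.0#) (M.sym σ.0#-homo)))
              (σ.injective (M.trans (right M.1#) (M.sym σ.1#-homo)))
              (λ x → σ.injective (M.trans (right (M.- x)) (M.sym
                (M.trans (σ.-‿homo (inv x)) (M.-‿cong (right x))))))
          ; injective = λ {x} {y} e →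
              M.trans (M.sym (right x)) (M.trans (σ.⟦⟧-cong e) (right y))
          }
        ; surjective = λ y → fun σ y , λ {z} e →
            σ.injective (M.trans (right z) e)
        }
      ; fixes = λ c → σ.injective (M.trans (right ⟦ c ⟧) (M.sym (fixes σ c)))
      }
      where
      module σ = Automorphism σ
      inv : M.Carrier → M.Carrier
      inv y = proj₁ (σ.surjective y)
      right : ∀ y → fun σ (inv y) M.≈ y
      right y = proj₂ (σ.surjective y) M.refl
      inv-cong : ∀ {x y} → x M.≈ y → inv x M.≈ inv y
      inv-cong {x} {y} e = σ.injective (M.trans (right x) (M.trans e (M.sym (right y))))

  Gal : Group a a
  Gal = record
    { Carrier = Automorphism
    ; _≈_     = λ σ τ → ∀ x → fun σ x M.≈ fun τ x
    ; _∙_     = λ σ τ → record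
        { fun               = fun σ ∘ fun τ
        ; isRingIsomorphism = Composition.isRingIsomorphism M.trans
            (Automorphism.isRingIsomorphism τ) (Automorphism.isRingIsomorphism σ)
        ; fixes             = λ c →
            M.trans (Automorphism.⟦⟧-cong σ (fixes τ c)) (fixes σ c)
        }
    ; ε       = record
        { fun               = λ x → x
        ; isRingIsomorphism = Identity.isRingIsomorphism M.rawRing M.refl
        ; fixes             = λ c → M.refl
        }
    ; _⁻¹     = inverse
    ; isGroup = record
      { isMonoid = record
        { isSemigroup = record
          { isMagma = record
            { isEquivalence = record
              { refl  = λ x → M.refl
              ; sym   = λ e x → M.sym (e x)
              ; trans = λ e f x → M.trans (e x) (f x)
              }
            ; ∙-cong = λ {σ} {σ₁} {τ} {τ₁} e f x →
                M.trans (Automorphism.⟦⟧-cong σ (f x)) (e (fun τ₁ x))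
            }
          ; assoc = λ σ τ ρ x → M.refl
          }
        ; identity = (λ σ x → M.refl) , (λ σ x → M.refl)
        }
      ; inverse =
          (λ σ x → Automorphism.injective σ
            (proj₂ (Automorphism.surjective σ (fun σ x)) M.refl))
        , (λ σ x → proj₂ (Automorphism.surjective σ x) M.refl)
      ; ⁻¹-cong = λ {σ} {τ} e x → Automorphism.injective σ (M.trans
          (proj₂ (Automorphism.surjective σ x) M.refl)
          (M.sym (M.trans (e _) (proj₂ (Automorphism.surjective τ x) M.refl))))
      }
    }

module Subset {a} (Γ : Group a a) where
  open Group Γ

  record IsSubgroup (U : Pred Carrier a) : Set a where
    field
      resp      : ∀ {x y} → x ≈ y → U x → U y
      ε-closed  : U ε
      ∙-closed  : ∀ {x y} → U x → U y → U (x ∙ y)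
      ⁻¹-closed : ∀ {x} → U x → U (x ⁻¹)

  IsComplement : Pred Carrier a → Pred Carrier a → Set a
  IsComplement V U = IsSubgroup U ×
    (∀ g → ∃[ u ] ∃[ v ] U u × V v × g ≈ u ∙ v ×
      (∀ {u₁ v₁} → U u₁ → V v₁ → g ≈ u₁ ∙ v₁ → u ≈ u₁ × v ≈ v₁))

  IsNormalSubset : Pred Carrier a → Set a
  IsNormalSubset U = ∀ g {u} → U u → U (g ∙ u ∙ g ⁻¹)

  subgroup : {U : Pred Carrier a} → IsSubgroup U → Group a a
  subgroup {U} s = record
    { Carrier = Σ Carrier U
    ; _≈_     = λ x y → proj₁ x ≈ proj₁ y
    ; _∙_     = λ (x , p) (y , q) → x ∙ y , ∙-closed p q
    ; ε       = ε , ε-closed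
    ; _⁻¹     = λ (x , p) → x ⁻¹ , ⁻¹-closed p
    ; isGroup = record
      { isMonoid = record
        { isSemigroup = record
          { isMagma = record
            { isEquivalence = record { refl = refl ; sym = sym ; trans = trans }
            ; ∙-cong = ∙-cong
            }
          ; assoc = λ (x , _) (y , _) (z , _) → assoc x y z
          }
        ; identity = (λ (x , _) → identityˡ x) , (λ (x , _) → identityʳ x)
        }
      ; inverse = (λ (x , _) → inverseˡ x) , (λ (x , _) → inverseʳ x)
      ; ⁻¹-cong = ⁻¹-cong
      }
    }
    where open IsSubgroup s

infix 4 _≅_
_≅_ : ∀ {a} → Group a a → Group a a → Set a
G ≅ H = ∃[ f ] IsGroupIsomorphism (Group.rawGroup G) (Group.rawGroup H) f

-- Tensor product of two commutative K-algebras: the free abelian group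
-- on the symbols x ⊗ y modulo bilinearity and K-balancedness, with the
-- multiplication (x ⊗ y) · (z ⊗ w) = xz ⊗ yw

module Tensor {a} {K A B : CommutativeRing a a} (φ : Hom K A) (ψ : Hom K B) where
  private
    module K = CommutativeRing K
    module A = CommutativeRing A
    module B = CommutativeRing B
    module φ = Hom φ
    module ψ = Hom ψ

  infix  8 _⊗_
  infixl 6 _⊕_
  infix  4 _~_

  data T : Set a where
    𝟘   : T
    _⊕_ : T → T → T
    ⊖_  : T → T
    _⊗_ : A.Carrier → B.Carrier → T

  data _~_ : Rel T a where
    ~refl     : ∀ {x} → x ~ x
    ~sym      : ∀ {x y} → x ~ y → y ~ x
    ~trans    : ∀ {x y z} → x ~ y → y ~ z → x ~ z
    ⊕-cong    : ∀ {x x₁ y y₁} → x ~ x₁ → y ~ y₁ → x ⊕ y ~ x₁ ⊕ y₁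
    ⊖-cong    : ∀ {x x₁} → x ~ x₁ → ⊖ x ~ ⊖ x₁
    ⊕-assoc   : ∀ x y z → (x ⊕ y) ⊕ z ~ x ⊕ (y ⊕ z)
    ⊕-comm    : ∀ x y → x ⊕ y ~ y ⊕ x
    ⊕-idˡ     : ∀ x → 𝟘 ⊕ x ~ x
    ⊕-invˡ    : ∀ x → ⊖ x ⊕ x ~ 𝟘
    ⊗-cong    : ∀ {x x₁ y y₁} → x A.≈ x₁ → y B.≈ y₁ → x ⊗ y ~ x₁ ⊗ y₁
    ⊗-distˡ   : ∀ x y z → x ⊗ (y B.+ z) ~ x ⊗ y ⊕ x ⊗ z
    ⊗-distʳ   : ∀ x y z → (x A.+ y) ⊗ z ~ x ⊗ z ⊕ y ⊗ z
    ⊗-balance : ∀ x c y → (x A.* φ.⟦ c ⟧) ⊗ y ~ x ⊗ (ψ.⟦ c ⟧ B.* y)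

  -- left multiplication by x ⊗ y
  scale : A.Carrier → B.Carrier → T → T
  scale x y 𝟘       = 𝟘
  scale x y (s ⊕ t) = scale x y s ⊕ scale x y t
  scale x y (⊖ t)   = ⊖ scale x y t
  scale x y (z ⊗ w) = (x A.* z) ⊗ (y B.* w)

  infixl 7 _⊙_
  _⊙_ : T → T → T
  𝟘       ⊙ u = 𝟘
  (s ⊕ t) ⊙ u = s ⊙ u ⊕ t ⊙ u
  (⊖ t)   ⊙ u = ⊖ (t ⊙ u)
  (x ⊗ y) ⊙ u = scale x y u

  private
    T-abelianGroup : AbelianGroup a a
    T-abelianGroup = record
      { Carrier = T ; _≈_ = _~_ ; _∙_ = _⊕_ ; ε = 𝟘 ; _⁻¹ = ⊖_
      ; isAbelianGroup = record
        { isGroup = record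
          { isMonoid = record
            { isSemigroup = record
              { isMagma = record
                { isEquivalence = record { refl = ~refl ; sym = ~sym ; trans = ~trans }
                ; ∙-cong = ⊕-cong
                }
              ; assoc = ⊕-assoc
              }
            ; identity = ⊕-idˡ , λ x → ~trans (⊕-comm x 𝟘) (⊕-idˡ x)
            }
          ; inverse = ⊕-invˡ , λ x → ~trans (⊕-comm x (⊖ x)) (⊕-invˡ x)
          ; ⁻¹-cong = ⊖-cong
          }
        ; comm = ⊕-comm
        }
      }

    module ⊕ = AbelianGroup T-abelianGroup
    open AbelianGroupProperties T-abelianGroup
      using (ε⁻¹≈ε; ⁻¹-∙-comm; identityˡ-unique; inverseˡ-unique)
    open CommutativeSemigroupProperties ⊕.commutativeSemigroup using (interchange)

    neg-⊕ : ∀ s t → ⊖ (s ⊕ t) ~ ⊖ s ⊕ ⊖ t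
    neg-⊕ s t = ~sym (⁻¹-∙-comm s t)

    scale-+ˡ : ∀ x x₁ y u → scale (x A.+ x₁) y u ~ scale x y u ⊕ scale x₁ y u
    scale-+ˡ x x₁ y 𝟘       = ~sym (⊕-idˡ 𝟘)
    scale-+ˡ x x₁ y (u ⊕ v) = ~trans (⊕-cong (scale-+ˡ x x₁ y u) (scale-+ˡ x x₁ y v)) (interchange _ _ _ _)
    scale-+ˡ x x₁ y (⊖ u)   = ~trans (⊖-cong (scale-+ˡ x x₁ y u)) (neg-⊕ _ _)
    scale-+ˡ x x₁ y (z ⊗ w) = ~trans (⊗-cong (A.distribʳ z x x₁) B.refl) (⊗-distʳ _ _ _)

    scale-+ʳ : ∀ x y y₁ u → scale x (y B.+ y₁) u ~ scale x y u ⊕ scale x y₁ u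
    scale-+ʳ x y y₁ 𝟘       = ~sym (⊕-idˡ 𝟘)
    scale-+ʳ x y y₁ (u ⊕ v) = ~trans (⊕-cong (scale-+ʳ x y y₁ u) (scale-+ʳ x y y₁ v)) (interchange _ _ _ _)
    scale-+ʳ x y y₁ (⊖ u)   = ~trans (⊖-cong (scale-+ʳ x y y₁ u)) (neg-⊕ _ _)
    scale-+ʳ x y y₁ (z ⊗ w) = ~trans (⊗-cong A.refl (B.distribʳ w y y₁)) (⊗-distˡ _ _ _)

    scale-cong : ∀ {x x₁ y y₁} → x A.≈ x₁ → y B.≈ y₁ → ∀ u → scale x y u ~ scale x₁ y₁ u
    scale-cong p q 𝟘       = ~refl
    scale-cong p q (u ⊕ v) = ⊕-cong (scale-cong p q u) (scale-cong p q v)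
    scale-cong p q (⊖ u)   = ⊖-cong (scale-cong p q u)
    scale-cong p q (z ⊗ w) = ⊗-cong (A.*-congʳ p) (B.*-congʳ q)

    scale-balance : ∀ x c y u → scale (x A.* φ.⟦ c ⟧) y u ~ scale x (ψ.⟦ c ⟧ B.* y) u
    scale-balance x c y 𝟘       = ~refl
    scale-balance x c y (u ⊕ v) = ⊕-cong (scale-balance x c y u) (scale-balance x c y v)
    scale-balance x c y (⊖ u)   = ⊖-cong (scale-balance x c y u)
    scale-balance x c y (z ⊗ w) =
      ~trans (⊗-cong (A.trans (A.*-assoc _ _ _) (A.trans (A.*-congˡ (A.*-comm _ _)) (A.sym (A.*-assoc _ _ _)))) B.refl)
      (~trans (⊗-balance _ c _) (⊗-cong A.refl (B.sym (B.*-assoc _ _ _))))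

    scale-resp : ∀ x y {u v} → u ~ v → scale x y u ~ scale x y v
    scale-resp x y ~refl             = ~refl
    scale-resp x y (~sym e)          = ~sym (scale-resp x y e)
    scale-resp x y (~trans e f)      = ~trans (scale-resp x y e) (scale-resp x y f)
    scale-resp x y (⊕-cong e f)      = ⊕-cong (scale-resp x y e) (scale-resp x y f)
    scale-resp x y (⊖-cong e)        = ⊖-cong (scale-resp x y e)
    scale-resp x y (⊕-assoc u v w)   = ⊕-assoc _ _ _
    scale-resp x y (⊕-comm u v)      = ⊕-comm _ _
    scale-resp x y (⊕-idˡ u)         = ⊕-idˡ _
    scale-resp x y (⊕-invˡ u)        = ⊕-invˡ _
    scale-resp x y (⊗-cong p q)      = ⊗-cong (A.*-congˡ p) (B.*-congˡ q)
    scale-resp x y (⊗-distˡ z w w₁)  = ~trans (⊗-cong A.refl (B.distribˡ y w w₁)) (⊗-distˡ _ _ _)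
    scale-resp x y (⊗-distʳ z z₁ w)  = ~trans (⊗-cong (A.distribˡ x z z₁) B.refl) (⊗-distʳ _ _ _)
    scale-resp x y (⊗-balance z c w) =
      ~trans (⊗-cong (A.sym (A.*-assoc _ _ _)) B.refl)
      (~trans (⊗-balance _ c _)
      (⊗-cong A.refl (B.trans (B.sym (B.*-assoc _ _ _)) (B.trans (B.*-congʳ (B.*-comm _ _)) (B.*-assoc _ _ _)))))

    ⊙-congˡ : ∀ s {u v} → u ~ v → s ⊙ u ~ s ⊙ v
    ⊙-congˡ 𝟘       e = ~refl
    ⊙-congˡ (s ⊕ t) e = ⊕-cong (⊙-congˡ s e) (⊙-congˡ t e)
    ⊙-congˡ (⊖ s)   e = ⊖-cong (⊙-congˡ s e)
    ⊙-congˡ (x ⊗ y) e = scale-resp x y e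

    ⊙-congʳ : ∀ {s t} u → s ~ t → s ⊙ u ~ t ⊙ u
    ⊙-congʳ u ~refl             = ~refl
    ⊙-congʳ u (~sym e)          = ~sym (⊙-congʳ u e)
    ⊙-congʳ u (~trans e f)      = ~trans (⊙-congʳ u e) (⊙-congʳ u f)
    ⊙-congʳ u (⊕-cong e f)      = ⊕-cong (⊙-congʳ u e) (⊙-congʳ u f)
    ⊙-congʳ u (⊖-cong e)        = ⊖-cong (⊙-congʳ u e)
    ⊙-congʳ u (⊕-assoc x y z)   = ⊕-assoc _ _ _
    ⊙-congʳ u (⊕-comm x y)      = ⊕-comm _ _
    ⊙-congʳ u (⊕-idˡ x)         = ⊕-idˡ _
    ⊙-congʳ u (⊕-invˡ x)        = ⊕-invˡ _
    ⊙-congʳ u (⊗-cong p q)      = scale-cong p q u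
    ⊙-congʳ u (⊗-distˡ x y z)   = scale-+ʳ x y z u
    ⊙-congʳ u (⊗-distʳ x y z)   = scale-+ˡ x y z u
    ⊙-congʳ u (⊗-balance x c y) = scale-balance x c y u

    ⊙-zeroʳ : ∀ s → s ⊙ 𝟘 ~ 𝟘
    ⊙-zeroʳ 𝟘       = ~refl
    ⊙-zeroʳ (s ⊕ t) = ~trans (⊕-cong (⊙-zeroʳ s) (⊙-zeroʳ t)) (⊕-idˡ 𝟘)
    ⊙-zeroʳ (⊖ s)   = ~trans (⊖-cong (⊙-zeroʳ s)) ε⁻¹≈ε
    ⊙-zeroʳ (x ⊗ y) = ~refl

    ⊙-distribˡ : ∀ s u v → s ⊙ (u ⊕ v) ~ s ⊙ u ⊕ s ⊙ v
    ⊙-distribˡ 𝟘       u v = ~sym (⊕-idˡ 𝟘)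
    ⊙-distribˡ (s ⊕ t) u v = ~trans (⊕-cong (⊙-distribˡ s u v) (⊙-distribˡ t u v)) (interchange _ _ _ _)
    ⊙-distribˡ (⊖ s)   u v = ~trans (⊖-cong (⊙-distribˡ s u v)) (neg-⊕ _ _)
    ⊙-distribˡ (x ⊗ y) u v = ~refl

    ⊙-negʳ : ∀ s u → s ⊙ (⊖ u) ~ ⊖ (s ⊙ u)
    ⊙-negʳ 𝟘       u = ~sym ε⁻¹≈ε
    ⊙-negʳ (s ⊕ t) u = ~trans (⊕-cong (⊙-negʳ s u) (⊙-negʳ t u)) (⁻¹-∙-comm _ _)
    ⊙-negʳ (⊖ s)   u = ⊖-cong (⊙-negʳ s u)
    ⊙-negʳ (x ⊗ y) u = ~refl

    scale-comm : ∀ x y u → scale x y u ~ u ⊙ (x ⊗ y)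
    scale-comm x y 𝟘       = ~refl
    scale-comm x y (u ⊕ v) = ⊕-cong (scale-comm x y u) (scale-comm x y v)
    scale-comm x y (⊖ u)   = ⊖-cong (scale-comm x y u)
    scale-comm x y (z ⊗ w) = ⊗-cong (A.*-comm x z) (B.*-comm y w)

    ⊙-comm : ∀ s u → s ⊙ u ~ u ⊙ s
    ⊙-comm 𝟘       u = ~sym (⊙-zeroʳ u)
    ⊙-comm (s ⊕ t) u = ~trans (⊕-cong (⊙-comm s u) (⊙-comm t u)) (~sym (⊙-distribˡ u s t))
    ⊙-comm (⊖ s)   u = ~trans (⊖-cong (⊙-comm s u)) (~sym (⊙-negʳ u s))
    ⊙-comm (x ⊗ y) u = scale-comm x y u

    scale-scale : ∀ x y z w u → scale (x A.* z) (y B.* w) u ~ scale x y (scale z w u)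
    scale-scale x y z w 𝟘       = ~refl
    scale-scale x y z w (u ⊕ v) = ⊕-cong (scale-scale x y z w u) (scale-scale x y z w v)
    scale-scale x y z w (⊖ u)   = ⊖-cong (scale-scale x y z w u)
    scale-scale x y z w (p ⊗ q) = ⊗-cong (A.*-assoc x z p) (B.*-assoc y w q)

    scale-assoc : ∀ x y t u → scale x y t ⊙ u ~ scale x y (t ⊙ u)
    scale-assoc x y 𝟘       u = ~refl
    scale-assoc x y (s ⊕ t) u = ⊕-cong (scale-assoc x y s u) (scale-assoc x y t u)
    scale-assoc x y (⊖ t)   u = ⊖-cong (scale-assoc x y t u)
    scale-assoc x y (z ⊗ w) u = scale-scale x y z w u

    ⊙-assoc : ∀ s t u → (s ⊙ t) ⊙ u ~ s ⊙ (t ⊙ u)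
    ⊙-assoc 𝟘       t u = ~refl
    ⊙-assoc (r ⊕ s) t u = ⊕-cong (⊙-assoc r t u) (⊙-assoc s t u)
    ⊙-assoc (⊖ s)   t u = ⊖-cong (⊙-assoc s t u)
    ⊙-assoc (x ⊗ y) t u = scale-assoc x y t u

    ⊙-idˡ : ∀ u → scale A.1# B.1# u ~ u
    ⊙-idˡ 𝟘       = ~refl
    ⊙-idˡ (u ⊕ v) = ⊕-cong (⊙-idˡ u) (⊙-idˡ v)
    ⊙-idˡ (⊖ u)   = ⊖-cong (⊙-idˡ u)
    ⊙-idˡ (z ⊗ w) = ⊗-cong (A.*-identityˡ z) (B.*-identityˡ w)

  ring : CommutativeRing a a
  ring = record
    { Carrier = T ; _≈_ = _~_ ; _+_ = _⊕_ ; _*_ = _⊙_ ; -_ = ⊖_ ; 0# = 𝟘 ; 1# = A.1# ⊗ B.1#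
    ; isCommutativeRing = record
      { isRing = record
        { +-isAbelianGroup = ⊕.isAbelianGroup
        ; *-cong = λ {s} {t} {u} {v} e f → ~trans (⊙-congʳ u e) (⊙-congˡ t f)
        ; *-assoc = ⊙-assoc
        ; *-identity = ⊙-idˡ , λ u → ~trans (⊙-comm u _) (⊙-idˡ u)
        ; distrib = ⊙-distribˡ , λ u s t → ~refl
        }
      ; *-comm = ⊙-comm
      }
    }

  private
    ⊗-zeroʳ : ∀ x → x ⊗ B.0# ~ 𝟘
    ⊗-zeroʳ x = identityˡ-unique (x ⊗ B.0#) (x ⊗ B.0#)
      (~trans (~sym (⊗-distˡ x _ _)) (⊗-cong A.refl (B.+-identityˡ _)))

  -- y ↦ 1 ⊗ y, making A ⊗ B an extension of B
  inr : Hom B ring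
  inr = record
    { ⟦_⟧ = A.1# ⊗_
    ; isRingHomomorphism = mkIsRingHomomorphism (A.1# ⊗_) (⊗-cong A.refl)
        (⊗-distˡ A.1#)
        (λ y z → ⊗-cong (A.sym (A.*-identityˡ A.1#)) B.refl)
        (⊗-zeroʳ A.1#)
        ~refl
        (λ y → inverseˡ-unique _ _ (~trans (~sym (⊗-distˡ A.1# _ _))
          (~trans (⊗-cong A.refl (B.-‿inverseˡ y)) (⊗-zeroʳ A.1#))))
    }

  -- C is obtained from A by base change along K → B if the canonical map
  -- x ⊗ y ↦ f x * g y is an isomorphism of A ⊗ B onto C.
  module _ {C : CommutativeRing a a} (f : Hom A C) (g : Hom B C) where
    private
      module C = CommutativeRing C
      module f = Hom f
      module g = Hom g

    canonical : T → C.Carrier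
    canonical 𝟘       = C.0#
    canonical (s ⊕ t) = canonical s C.+ canonical t
    canonical (⊖ t)   = C.- canonical t
    canonical (x ⊗ y) = f.⟦ x ⟧ C.* g.⟦ y ⟧

    IsBaseChange : Set a
    IsBaseChange = IsRingIsomorphism (CommutativeRing.rawRing ring) C.rawRing canonical

module Subfields {a} (Ω : CommutativeRing a a) where
  open CommutativeRing Ω

  record Subfield : Set (lsuc a) where
    field
      Mem        : Pred Carrier a
      resp       : ∀ {x y} → x ≈ y → Mem x → Mem y
      0-closed   : Mem 0#
      1-closed   : Mem 1#
      +-closed   : ∀ {x y} → Mem x → Mem y → Mem (x + y)
      *-closed   : ∀ {x y} → Mem x → Mem y → Mem (x * y)
      neg-closed : ∀ {x} → Mem x → Mem (- x)
      inv-closed : ∀ {x y} → x * y ≈ 1# → Mem x → Mem y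

  open Subfield

  infix 4 _⊑_ _≋_
  record _⊑_ (K L : Subfield) : Set a where
    constructor mk⊑
    field
      mem : ∀ {x} → Mem K x → Mem L x

  open _⊑_ public

  _≋_ : Rel Subfield a
  K ≋ L = K ⊑ L × L ⊑ K

  ⊑-trans : ∀ {K L M} → K ⊑ L → L ⊑ M → K ⊑ M
  ⊑-trans p q = mk⊑ (mem q ∘ mem p)

  ⌊_⌋ : Subfield → CommutativeRing a a
  ⌊ K ⌋ = record
    { Carrier = Σ Carrier (Mem K)
    ; _≈_     = λ x y → proj₁ x ≈ proj₁ y
    ; _+_     = λ (x , p) (y , q) → x + y , +-closed K p q
    ; _*_     = λ (x , p) (y , q) → x * y , *-closed K p q
    ; -_      = λ (x , p) → - x , neg-closed K p
    ; 0#      = 0# , 0-closed K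
    ; 1#      = 1# , 1-closed K
    ; isCommutativeRing = record
      { isRing = record
        { +-isAbelianGroup = record
          { isGroup = record
            { isMonoid = record
              { isSemigroup = record
                { isMagma = record
                  { isEquivalence = record { refl = refl ; sym = sym ; trans = trans }
                  ; ∙-cong = +-cong
                  }
                ; assoc = λ (x , _) (y , _) (z , _) → +-assoc x y z
                }
              ; identity = (λ (x , _) → +-identityˡ x) , (λ (x , _) → +-identityʳ x)
              }
            ; inverse = (λ (x , _) → -‿inverseˡ x) , (λ (x , _) → -‿inverseʳ x)
            ; ⁻¹-cong = -‿cong
            }
          ; comm = λ (x , _) (y , _) → +-comm x y
          }
        ; *-cong = *-cong
        ; *-assoc = λ (x , _) (y , _) (z , _) → *-assoc x y z
        ; *-identity = (λ (x , _) → *-identityˡ x) , (λ (x , _) → *-identityʳ x)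
        ; distrib = (λ (x , _) (y , _) (z , _) → distribˡ x y z)
                  , (λ (x , _) (y , _) (z , _) → distribʳ x y z)
        }
      ; *-comm = λ (x , _) (y , _) → *-comm x y
      }
    }

  incl : ∀ {K L} → K ⊑ L → Hom ⌊ K ⌋ ⌊ L ⌋
  incl K⊑L = record
    { ⟦_⟧ = λ (x , p) → x , mem K⊑L p
    ; isRingHomomorphism = mkIsRingHomomorphism (λ (x , p) → x , mem K⊑L p)
        (λ e → e) (λ _ _ → refl) (λ _ _ → refl) refl refl (λ _ → refl)
    }

  -- the elements of the compositum KL
  data Generated (K L : Subfield) : Pred Carrier a where
    left  : ∀ {x} → Mem K x → Generated K L x
    right : ∀ {x} → Mem L x → Generated K L x
    equal : ∀ {x y} → x ≈ y → Generated K L x → Generated K L y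
    plus  : ∀ {x y} → Generated K L x → Generated K L y → Generated K L (x + y)
    times : ∀ {x y} → Generated K L x → Generated K L y → Generated K L (x * y)
    minus : ∀ {x} → Generated K L x → Generated K L (- x)
    inv   : ∀ {x y} → x * y ≈ 1# → Generated K L x → Generated K L y

  infixl 7 _∨_
  _∨_ : Subfield → Subfield → Subfield
  K ∨ L = record
    { Mem        = Generated K L
    ; resp       = equal
    ; 0-closed   = left (0-closed K)
    ; 1-closed   = left (1-closed K)
    ; +-closed   = plus
    ; *-closed   = times
    ; neg-closed = minus
    ; inv-closed = inv
    }

  ⊑∨ʳ : ∀ K L → L ⊑ K ∨ L
  ⊑∨ʳ K L = mk⊑ right

  ∨-monoʳ : ∀ K {L M} → L ⊑ M → K ∨ L ⊑ K ∨ M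
  ∨-monoʳ K {L} {M} L⊑M = mk⊑ go
    where
    go : ∀ {x} → Generated K L x → Generated K M x
    go (left p)    = left p
    go (right p)   = right (mem L⊑M p)
    go (equal e p) = equal e (go p)
    go (plus p q)  = plus (go p) (go q)
    go (times p q) = times (go p) (go q)
    go (minus p)   = minus (go p)
    go (inv e p)   = inv e (go p)

  HasDegree : ∀ {K M} → K ⊑ M → ℕ → Set a
  HasDegree K⊑M = Extension.HasDegree (incl K⊑M)

  IsSeparable IsGalois : ∀ {K M} → K ⊑ M → Set a
  IsSeparable K⊑M = Extension.IsSeparable (incl K⊑M)
  IsGalois    K⊑M = Extension.IsGalois (incl K⊑M)

  Gal : ∀ {K M} → K ⊑ M → Group a a
  Gal K⊑M = Extension.Gal (incl K⊑M)

  -- F is a Galois closure of E/K: a minimal Galois extension of K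
  -- containing E.
  IsGaloisClosure : ∀ {K E F} → K ⊑ E → E ⊑ F → Set (lsuc a)
  IsGaloisClosure {K} {E} {F} K⊑E E⊑F =
      IsGalois (⊑-trans K⊑E E⊑F)
    × (∀ M (E⊑M : E ⊑ M) → M ⊑ F → IsGalois (⊑-trans K⊑E E⊑M) → F ⊑ M)

  -- The fixed field of an arbitrary set G of automorphisms of M/K.
  fixedField : ∀ {K M} (K⊑M : K ⊑ M) → Pred (Group.Carrier (Gal K⊑M)) a → Subfield
  fixedField {K} {M} K⊑M G = record
    { Mem        = λ x → Σ[ p ∈ Mem M x ] (∀ {σ} → G σ → proj₁ (fun σ (x , p)) ≈ x)
    ; resp       = λ e (p , h) → resp M e p ,
        λ {σ} s → trans (Aut.⟦⟧-cong σ (sym e)) (trans (h s) e)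
    ; 0-closed   = 0-closed M , λ {σ} _ → Aut.0#-homo σ
    ; 1-closed   = 1-closed M , λ {σ} _ → Aut.1#-homo σ
    ; +-closed   = λ (p , h) (q , k) → +-closed M p q ,
        λ {σ} s → trans (Aut.+-homo σ _ _) (+-cong (h s) (k s))
    ; *-closed   = λ (p , h) (q , k) → *-closed M p q ,
        λ {σ} s → trans (Aut.*-homo σ _ _) (*-cong (h s) (k s))
    ; neg-closed = λ (p , h) → neg-closed M p ,
        λ {σ} s → trans (Aut.-‿homo σ _) (-‿cong (h s))
    ; inv-closed = λ {x} {y} e (p , h) → inv-closed M e p ,
        λ {σ} s → inverse-unique e (begin
          x * proj₁ (fun σ (y , inv-closed M e p))                      ≈⟨ *-congʳ (sym (h s)) ⟩
          proj₁ (fun σ (x , p)) * proj₁ (fun σ (y , inv-closed M e p))  ≈⟨ sym (Aut.*-homo σ _ _) ⟩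
          proj₁ (fun σ (x * y , _))                                     ≈⟨ Aut.⟦⟧-cong σ e ⟩
          proj₁ (fun σ (1# , 1-closed M))                               ≈⟨ Aut.1#-homo σ ⟩
          1#                                                            ∎)
    }
    where
    module Aut = Extension.Automorphism {φ = incl K⊑M}
    open Aut using (fun)
    open SetoidReasoning setoid
    inverse-unique : ∀ {x y z} → x * y ≈ 1# → x * z ≈ 1# → z ≈ y
    inverse-unique {x} {y} {z} e f = begin
      z            ≈⟨ *-identityˡ z ⟨
      1# * z       ≈⟨ *-congʳ e ⟨
      (x * y) * z  ≈⟨ *-congʳ (*-comm x y) ⟩
      (y * x) * z  ≈⟨ *-assoc y x z ⟩
      y * (x * z)  ≈⟨ *-congˡ f ⟩
      y * 1#       ≈⟨ *-identityʳ y ⟩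
      y            ∎

-- That Ê is a Galois closure of E/k, and that Ω is a field, is not needed
-- for the definitions below; both are hypotheses of the theorem.
module Setting {a} (Ω : CommutativeRing a a) (k E Ê : Subfields.Subfield Ω)
  (k⊑E : Subfields._⊑_ Ω k E) (E⊑Ê : Subfields._⊑_ Ω E Ê) where

  open Subfields Ω
  open CommutativeRing Ω using (_≈_)
  open Subfield

  k⊑Ê : k ⊑ Ê
  k⊑Ê = ⊑-trans k⊑E E⊑Ê

  Γ : Group a a
  Γ = Gal k⊑Ê

  open Group Γ using () renaming (Carrier to |Γ|)

  module E⊗ (L : Subfield) (k⊑L : k ⊑ L) =
    Tensor (incl k⊑E) (incl k⊑L)

  -- the set of overfields L of k in Ω such that E ⊗ₖ L is a Galois field
  -- extension of L
  𝓛 : Pred Subfield a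
  𝓛 L = Σ[ k⊑L ∈ k ⊑ L ]
    IsField (E⊗.ring L k⊑L) × Extension.IsGalois (E⊗.inr L k⊑L)

  𝓛ₘ : Pred Subfield (lsuc a)
  𝓛ₘ L = 𝓛 L × (∀ M → 𝓛 M → M ⊑ L → L ⊑ M)

  PotentiallyGaloisWithGroup : Subfield → Group a a → Set a
  PotentiallyGaloisWithGroup L G =
    Σ[ (k⊑L , _) ∈ 𝓛 L ] Extension.Gal (E⊗.inr L k⊑L) ≅ G

  -- Gal(Ê/L) as a subset of Gal(Ê/k), for L ⊆ Ê
  Gal[Ê/_] : Subfield → Pred |Γ| a
  Gal[Ê/ L ] τ = ∀ {x} (p : Mem Ê x) → Mem L x → proj₁ (fun τ (x , p)) ≈ x
    where open Extension.Automorphism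

  𝓖 : Pred (Pred |Γ| a) a
  𝓖 = Subset.IsComplement Γ Gal[Ê/ E ]

  Gal[EL/_] : Subfield → Group a a
  Gal[EL/ L ] = Gal (⊑∨ʳ E L)

  -- res σ = τ; this includes the requirement Ê ⊆ EL, without which res is
  -- not defined
  Restricts : ∀ L → Group.Carrier Gal[EL/ L ] → |Γ| → Set a
  Restricts L σ τ = Σ[ Ê⊑EL ∈ Ê ⊑ E ∨ L ]
    (∀ {x} (p : Mem Ê x) → proj₁ (fun σ (x , mem Ê⊑EL p)) ≈ proj₁ (fun τ (x , p)))
    where open Extension.Automorphism

  -- res(Gal(EL/L))
  𝔾 : Subfield → Pred |Γ| a
  𝔾 L τ = ∃[ σ ] Restricts L σ τ

  𝕃 : Pred |Γ| a → Subfield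
  𝕃 = fixedField k⊑Ê

{-# OPTIONS --safe #-}

-- Write T = E ⊗ₖ L, Γ = Gal(Ê/k) and H = Gal(Ê/E).
--
-- If T is a Galois field extension of L, it is isomorphic to EL.  For γ ∈ Γ
-- and e ∈ E the map γ ⊗ id sends e ⊗ 1 to γ(e), so γ(e) is a root of the minimal
-- polynomial of e ⊗ 1 over L, which splits in T ≅ EL; hence Ê ⊆ EL.  Then γ ⊗ id
-- is an L-endomorphism of EL, and it is bijective because it permutes the roots
-- of each polynomial.  So every γ agrees on E with exactly one element of 𝔾(L),
-- which makes 𝔾(L) a complement of H.
--
-- Conversely, let G be a complement of H.  The map E ⊗ Ê^G → Ê is injective
-- since Ê^Γ = k: a shortest relation between conjugates of a basis of E descends
-- to k.  It is surjective since the elements of G are distinct on E: writing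
-- g(x) as an Ê-combination of the g(eᵢ), uniformly in g ∈ G, and descending the
-- coefficients to Ê^G expresses x in terms of the eᵢ.
--
-- The equalities Ê^Γ = k and (EL)^Gal(EL/L) = L come from extending embeddings
-- one generator at a time; this requires a finite set of generators of Ê, and by
-- minimality of Ê the conjugates of a basis of E form one.  Everything else
-- follows because two comparable complements of H are equal.

module Submission where

open import Level using (Lift; lift) renaming (suc to lsuc)
open import Algebra.Bundles using (CommutativeRing; Group; AbelianGroup)
open import Algebra.Definitions.RawMonoid using (sum)
import Algebra.Morphism.Construct.Composition as Composition
import Algebra.Properties.CommutativeSemigroup as CommutativeSemigroupProperties
import Algebra.Properties.Group as GroupProperties
import Algebra.Properties.Ring as RingProperties
import Algebra.Properties.Semiring.Sum as SemiringSum
import Algebra.Solver.Ring.NaturalCoefficients.Default as SemiringSolver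
open import Axiom.ExcludedMiddle using (ExcludedMiddle)
open import Data.Empty using (⊥-elim)
open import Data.Fin.Base using (Fin; zero; suc; toℕ)
open import Data.Fin.Properties using (pigeonhole)
open import Data.List.Base as List using (List; []; _∷_; _++_; _∷ʳ_; foldr; length)
import Data.List.Properties as List
open import Data.List.Relation.Unary.All as All using (All; []; _∷_)
import Data.List.Relation.Unary.All.Properties as All
open import Data.List.Relation.Unary.Any as Any using (Any; here; there)
import Data.List.Relation.Unary.Any.Properties as Any
open import Data.Nat.Base using (ℕ; zero; suc; _≤_; _<_; z≤n; s≤s)
import Data.Nat.Base as ℕ
import Data.Nat.Properties as ℕ
open import Data.Product.Base using (Σ-syntax; ∃; ∃-syntax; _×_; _,_; proj₁; proj₂; map; swap)
open import Data.Product using (∃!)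
open import Data.Sum.Base using (_⊎_; inj₁; inj₂)
open import Data.Unit.Polymorphic.Base using (⊤; tt)
open import Function.Base using (_on_; _∘_; id)
open import Function.Structures using (IsInverse)
open import Relation.Binary.PropositionalEquality.Core as ≡ using (_≡_)
import Relation.Binary.Reasoning.Setoid as SetoidReasoning
open import Relation.Nullary using (¬_; yes; no)
open import Relation.Unary using (Pred; _≐_)
open import Defs

-- Field degrees and group orders are never compared. Ê comes without a finite degree, being only a
-- minimal Galois extension of k containing E, and EL lies in an Ω that may be transcendental over
-- k; so `d` enters through a basis of E/k, and each bijection is built from an injection and a
-- surjection. Why Ê^G is minimal: a field M of 𝓛 inside Ê^G lies in Ê, so each element of G, fixing
-- M, belongs to 𝔾(M). Both are complements of H, hence 𝔾(M) = G. An element of Ê fixed by 𝔾(M) is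
-- fixed by Gal(EM/M), so it lies in M; thus Ê^G ⊆ M. The case M = Ê^G of the same argument gives
-- 𝔾(Ê^G) = G. If L₀ ⊆ L with L₀ minimal, then 𝔾(L) fixes L₀, so 𝔾(L) ⊆ Gal(Ê/L₀) = 𝔾(L₀), again an
-- equality. Consequently L₀ = L ∩ Ê, which is what makes L₀/k Galois as soon as L/k is.

-- Fields, finite sums and ring homomorphisms

module FieldProperties {a} {R : CommutativeRing a a} (isField : IsField R) where
  open CommutativeRing R hiding (zero)
  open IsField isField
  open SetoidReasoning setoid

  cancelˡ : ∀ {x y z} → ¬ x ≈ 0# → x * y ≈ x * z → y ≈ z
  cancelˡ {x} {y} {z} x≉0 e with x⁻¹ , xx⁻¹≈1 ← invertible x≉0 = begin
    y               ≈⟨ *-identityˡ y ⟨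
    1# * y          ≈⟨ *-congʳ x⁻¹x≈1 ⟨
    x⁻¹ * x * y     ≈⟨ *-assoc x⁻¹ x y ⟩
    x⁻¹ * (x * y)   ≈⟨ *-congˡ e ⟩
    x⁻¹ * (x * z)   ≈⟨ *-assoc x⁻¹ x z ⟨
    x⁻¹ * x * z     ≈⟨ *-congʳ x⁻¹x≈1 ⟩
    1# * z          ≈⟨ *-identityˡ z ⟩
    z               ∎
    where
    x⁻¹x≈1 : x⁻¹ * x ≈ 1#
    x⁻¹x≈1 = trans (*-comm x⁻¹ x) xx⁻¹≈1

  cancel-zero : ∀ {x y} → ¬ x ≈ 0# → x * y ≈ 0# → y ≈ 0#
  cancel-zero {x} x≉0 e = cancelˡ x≉0 (trans e (sym (zeroʳ x)))

  unit≉0 : ∀ {x y} → x * y ≈ 1# → ¬ x ≈ 0#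
  unit≉0 {x} {y} e x≈0 = nontrivial (trans (sym e) (trans (*-congʳ x≈0) (zeroˡ y)))

module Sums {a} (R : CommutativeRing a a) where
  open CommutativeRing R
  private module S = SemiringSum semiring

  ∑ : ∀ {n} → (Fin n → Carrier) → Carrier
  ∑ = sum +-rawMonoid

  ∑-cong : ∀ {n} (f g : Fin n → Carrier) → (∀ i → f i ≈ g i) → ∑ f ≈ ∑ g
  ∑-cong f g e = S.sum-cong-≋ {x = f} {y = g} e

  ∑-+ : ∀ {n} (f g : Fin n → Carrier) → ∑ (λ i → f i + g i) ≈ ∑ f + ∑ g
  ∑-+ = S.∑-distrib-+

  ∑-*ˡ : ∀ {n} x (f : Fin n → Carrier) → x * ∑ f ≈ ∑ (λ i → x * f i)
  ∑-*ˡ = S.*-distribˡ-sum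

  ∑-*ʳ : ∀ {n} x (f : Fin n → Carrier) → ∑ f * x ≈ ∑ (λ i → f i * x)
  ∑-*ʳ = S.*-distribʳ-sum

  ∑-comm : ∀ {m n} (f : Fin m → Fin n → Carrier) →
    ∑ (λ i → ∑ (λ j → f i j)) ≈ ∑ (λ j → ∑ (λ i → f i j))
  ∑-comm = S.∑-comm

  ∑-zero : ∀ {n} (f : Fin n → Carrier) → (∀ i → f i ≈ 0#) → ∑ f ≈ 0#
  ∑-zero {n} f e = trans (∑-cong f (λ _ → 0#) e) (S.sum-replicate-zero n)

module HomProperties {a} {K M : CommutativeRing a a} (φ : Hom K M) where
  private
    module K = CommutativeRing K
    module M = CommutativeRing M
    open Hom φ

  -‿-homo : ∀ x y → ⟦ x K.- y ⟧ M.≈ ⟦ x ⟧ M.- ⟦ y ⟧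
  -‿-homo x y = M.trans (+-homo x (K.- y)) (M.+-congˡ (-‿homo y))

  sum-homo : ∀ {n} (f : Fin n → K.Carrier) →
    ⟦ sum K.+-rawMonoid f ⟧ M.≈ sum M.+-rawMonoid (λ i → ⟦ f i ⟧)
  sum-homo {zero}  f = 0#-homo
  sum-homo {suc n} f = M.trans (+-homo _ _) (M.+-congˡ (sum-homo (f ∘ suc)))

  combination-homo : ∀ {n} (c b : Fin n → K.Carrier) →
    ⟦ sum K.+-rawMonoid (λ i → c i K.* b i) ⟧ M.≈ sum M.+-rawMonoid (λ i → ⟦ c i ⟧ M.* ⟦ b i ⟧)
  combination-homo {n} c b = M.trans (sum-homo (λ i → c i K.* b i))
    (∑-cong {n} (λ i → ⟦ c i K.* b i ⟧) (λ i → ⟦ c i ⟧ M.* ⟦ b i ⟧) (λ i → *-homo (c i) (b i)))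
    where open Sums M

  injective-from-kernel : (∀ {x} → ⟦ x ⟧ M.≈ M.0# → x K.≈ K.0#) →
    ∀ {x y} → ⟦ x ⟧ M.≈ ⟦ y ⟧ → x K.≈ y
  injective-from-kernel ker {x} {y} e =
    GroupProperties.x∙y⁻¹≈ε⇒x≈y K.+-group x y (ker (M.trans (-‿-homo x y)
      (GroupProperties.x≈y⇒x∙y⁻¹≈ε M.+-group e)))

  module _ (isField : IsField K) (1≉0 : ¬ M.1# M.≈ M.0#) (dec : ExcludedMiddle a) where

    kernel-trivial : ∀ {x} → ⟦ x ⟧ M.≈ M.0# → x K.≈ K.0#
    kernel-trivial {x} φx≈0 with dec {x K.≈ K.0#}
    ... | yes x≈0 = x≈0
    ... | no  x≉0 with y , xy≈1 ← IsField.invertible isField x≉0 =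
      ⊥-elim (1≉0 (M.trans (M.sym 1#-homo) (M.trans (⟦⟧-cong (K.sym xy≈1))
        (M.trans (*-homo x y) (M.trans (M.*-congʳ φx≈0) (M.zeroˡ _))))))

    field-hom-injective : ∀ {x y} → ⟦ x ⟧ M.≈ ⟦ y ⟧ → x K.≈ y
    field-hom-injective = injective-from-kernel kernel-trivial

infixr 9 _∘ʰ_
_∘ʰ_ : ∀ {a} {K L M : CommutativeRing a a} → Hom L M → Hom K L → Hom K M
_∘ʰ_ {M = M} ψ φ = record
  { ⟦_⟧ = Hom.⟦_⟧ ψ ∘ Hom.⟦_⟧ φ
  ; isRingHomomorphism = Composition.isRingHomomorphism (CommutativeRing.trans M)
      (Hom.isRingHomomorphism φ) (Hom.isRingHomomorphism ψ)
  }

-- Polynomial rings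

module PolynomialRing {a} (R : CommutativeRing a a) where
  open CommutativeRing R hiding (zero)
  open Polynomial R
  open RingProperties ring using (-0#≈0#)

  scale : Carrier → Poly → Poly
  scale c = List.map (c *_)

  infix 8 -ₚ_
  -ₚ_ : Poly → Poly
  -ₚ_ = List.map (-_)

  infix 10 X·_
  X·_ : Poly → Poly
  X· f = 0# ∷ f

  coeff-+ : ∀ f g n → coeff (f +ₚ g) n ≈ coeff f n + coeff g n
  coeff-+ []      g       n       = sym (+-identityˡ _)
  coeff-+ (c ∷ f) []      n       = sym (+-identityʳ _)
  coeff-+ (c ∷ f) (d ∷ g) zero    = refl
  coeff-+ (c ∷ f) (d ∷ g) (suc n) = coeff-+ f g n

  coeff-scale : ∀ c f n → coeff (scale c f) n ≈ c * coeff f n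
  coeff-scale c []      n       = sym (zeroʳ c)
  coeff-scale c (d ∷ f) zero    = refl
  coeff-scale c (d ∷ f) (suc n) = coeff-scale c f n

  coeff-neg : ∀ f n → coeff (-ₚ f) n ≈ - coeff f n
  coeff-neg []      n       = sym -0#≈0#
  coeff-neg (d ∷ f) zero    = refl
  coeff-neg (d ∷ f) (suc n) = coeff-neg f n

  -- A record around _≈ₚ_, from which Agda can infer the two polynomials.
  infix 4 _≋ₚ_
  record _≋ₚ_ (f g : Poly) : Set a where
    constructor pointwise
    field at : f ≈ₚ g
  open _≋ₚ_ public

  additiveGroup : AbelianGroup a a
  additiveGroup = record
    { Carrier = Poly ; _≈_ = _≋ₚ_ ; _∙_ = _+ₚ_ ; ε = [] ; _⁻¹ = -ₚ_
    ; isAbelianGroup = record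
      { isGroup = record
        { isMonoid = record
          { isSemigroup = record
            { isMagma = record
              { isEquivalence = record
                { refl  = pointwise λ n → refl
                ; sym   = λ e → pointwise λ n → sym (at e n)
                ; trans = λ d e → pointwise λ n → trans (at d n) (at e n)
                }
              ; ∙-cong = λ {f} {f′} {g} {g′} d e → pointwise λ n →
                  trans (coeff-+ f g n) (trans (+-cong (at d n) (at e n)) (sym (coeff-+ f′ g′ n)))
              }
            ; assoc = λ f g h → pointwise λ n → trans (coeff-+ (f +ₚ g) h n) (trans (+-congʳ (coeff-+ f g n))
                (trans (+-assoc _ _ _) (sym (trans (coeff-+ f (g +ₚ h) n) (+-congˡ (coeff-+ g h n))))))
            }
          ; identity = (λ f → pointwise λ n → refl)
                     , (λ f → pointwise λ n → trans (coeff-+ f [] n) (+-identityʳ _))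
          }
        ; inverse = (λ f → pointwise λ n → trans (coeff-+ (-ₚ f) f n) (trans (+-congʳ (coeff-neg f n)) (-‿inverseˡ _)))
                  , (λ f → pointwise λ n → trans (coeff-+ f (-ₚ f) n) (trans (+-congˡ (coeff-neg f n)) (-‿inverseʳ _)))
        ; ⁻¹-cong = λ {f} {g} e → pointwise λ n → trans (coeff-neg f n) (trans (-‿cong (at e n)) (sym (coeff-neg g n)))
        }
      ; comm = λ f g → pointwise λ n → trans (coeff-+ f g n) (trans (+-comm _ _) (sym (coeff-+ g f n)))
      }
    }

  private
    module P = AbelianGroup additiveGroup
    open CommutativeSemigroupProperties P.commutativeSemigroup using (interchange; x∙yz≈y∙xz)
    open SetoidReasoning P.setoid

  ∷-cong : ∀ {c d f g} → c ≈ d → f ≋ₚ g → c ∷ f ≋ₚ d ∷ g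
  ∷-cong e p = pointwise λ { zero → e ; (suc n) → at p n }

  tail-cong : ∀ {c d f g} → c ∷ f ≋ₚ d ∷ g → f ≋ₚ g
  tail-cong p = pointwise (at p ∘ suc)

  X·[] : X· [] ≋ₚ []
  X·[] = pointwise λ { zero → refl ; (suc n) → refl }

  X·-+ : ∀ f g → X· (f +ₚ g) ≋ₚ X· f +ₚ X· g
  X·-+ f g = ∷-cong (sym (+-identityˡ 0#)) P.refl

  scale-cong : ∀ {c d f g} → c ≈ d → f ≋ₚ g → scale c f ≋ₚ scale d g
  scale-cong {c} {d} {f} {g} e p = pointwise λ n →
    trans (coeff-scale c f n) (trans (*-cong e (at p n)) (sym (coeff-scale d g n)))

  scale-+ : ∀ c f g → scale c (f +ₚ g) ≋ₚ scale c f +ₚ scale c g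
  scale-+ c f g = pointwise λ n → trans (coeff-scale c (f +ₚ g) n) (trans (*-congˡ (coeff-+ f g n))
    (trans (distribˡ _ _ _) (sym (trans (coeff-+ (scale c f) (scale c g) n)
      (+-cong (coeff-scale c f n) (coeff-scale c g n))))))

  +-scale : ∀ c d f → scale (c + d) f ≋ₚ scale c f +ₚ scale d f
  +-scale c d f = pointwise λ n → trans (coeff-scale (c + d) f n)
    (trans (distribʳ _ _ _) (sym (trans (coeff-+ (scale c f) (scale d f) n)
      (+-cong (coeff-scale c f n) (coeff-scale d f n)))))

  scale-scale : ∀ c d f → scale (c * d) f ≋ₚ scale c (scale d f)
  scale-scale c d f = pointwise λ n → trans (coeff-scale (c * d) f n) (trans (*-assoc _ _ _)
    (sym (trans (coeff-scale c (scale d f) n) (*-congˡ (coeff-scale d f n)))))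

  scale-zero : ∀ {c} → c ≈ 0# → ∀ f → scale c f ≋ₚ []
  scale-zero {c} c≈0 f = pointwise λ n → trans (coeff-scale c f n) (trans (*-congʳ c≈0) (zeroˡ _))

  scale-one : ∀ f → scale 1# f ≋ₚ f
  scale-one f = pointwise λ n → trans (coeff-scale 1# f n) (*-identityˡ _)

  scale-X· : ∀ c f → scale c (X· f) ≋ₚ X· scale c f
  scale-X· c f = ∷-cong (zeroʳ c) P.refl

  *-zeroʳ : ∀ f → f *ₚ [] ≋ₚ []
  *-zeroʳ []      = P.refl
  *-zeroʳ (c ∷ f) = P.trans (∷-cong refl (*-zeroʳ f)) X·[]

  -- The zero polynomial may be a nonempty list of zeros, so this is not the defining clause for
  -- `[]`; it is what lets `*ₚ-congʳ` compare lists of different lengths.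
  *-zeroˡ : ∀ f g → f ≋ₚ [] → f *ₚ g ≋ₚ []
  *-zeroˡ []      g e = P.refl
  *-zeroˡ (c ∷ f) g e = begin
    scale c g +ₚ X· (f *ₚ g)  ≈⟨ P.∙-cong (scale-zero (at e zero) g)
                                   (∷-cong refl (*-zeroˡ f g (pointwise (at e ∘ suc)))) ⟩
    X· []                     ≈⟨ X·[] ⟩
    []                        ∎

  *ₚ-congʳ : ∀ {f f′} g → f ≋ₚ f′ → f *ₚ g ≋ₚ f′ *ₚ g
  *ₚ-congʳ {[]}    {f′}     g e = P.sym (*-zeroˡ f′ g (P.sym e))
  *ₚ-congʳ {c ∷ f} {[]}     g e = *-zeroˡ (c ∷ f) g e
  *ₚ-congʳ {c ∷ f} {d ∷ f′} g e =
    P.∙-cong (scale-cong (at e zero) (P.refl {g})) (∷-cong refl (*ₚ-congʳ g (tail-cong e)))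

  *ₚ-congˡ : ∀ f {g g′} → g ≋ₚ g′ → f *ₚ g ≋ₚ f *ₚ g′
  *ₚ-congˡ []      e = P.refl
  *ₚ-congˡ (c ∷ f) e = P.∙-cong (scale-cong refl e) (∷-cong refl (*ₚ-congˡ f e))

  *ₚ-distribʳ : ∀ g f h → (f +ₚ h) *ₚ g ≋ₚ f *ₚ g +ₚ h *ₚ g
  *ₚ-distribʳ g []      h       = P.refl
  *ₚ-distribʳ g (c ∷ f) []      = P.sym (P.identityʳ _)
  *ₚ-distribʳ g (c ∷ f) (d ∷ h) = begin
    scale (c + d) g +ₚ X· ((f +ₚ h) *ₚ g)
      ≈⟨ P.∙-cong (+-scale c d g) (P.trans (∷-cong refl (*ₚ-distribʳ g f h)) (X·-+ (f *ₚ g) (h *ₚ g))) ⟩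
    (scale c g +ₚ scale d g) +ₚ (X· (f *ₚ g) +ₚ X· (h *ₚ g))
      ≈⟨ interchange (scale c g) (scale d g) (X· (f *ₚ g)) (X· (h *ₚ g)) ⟩
    (scale c g +ₚ X· (f *ₚ g)) +ₚ (scale d g +ₚ X· (h *ₚ g)) ∎

  -- The recursion of the product on its right factor, mirroring the definition on the left;
  -- commutativity is then a plain induction.
  *ₚ-∷ : ∀ f d g → f *ₚ (d ∷ g) ≋ₚ scale d f +ₚ X· (f *ₚ g)
  *ₚ-∷ []      d g = P.sym X·[]
  *ₚ-∷ (c ∷ f) d g = ∷-cong (+-congʳ (*-comm c d)) (begin
    scale c g +ₚ f *ₚ (d ∷ g)                 ≈⟨ P.∙-congˡ (*ₚ-∷ f d g) ⟩
    scale c g +ₚ (scale d f +ₚ X· (f *ₚ g))   ≈⟨ x∙yz≈y∙xz (scale c g) (scale d f) (X· (f *ₚ g)) ⟩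
    scale d f +ₚ (scale c g +ₚ X· (f *ₚ g))   ∎)

  *ₚ-comm : ∀ f g → f *ₚ g ≋ₚ g *ₚ f
  *ₚ-comm []      g = P.sym (*-zeroʳ g)
  *ₚ-comm (c ∷ f) g = begin
    scale c g +ₚ X· (f *ₚ g)  ≈⟨ P.∙-congˡ (∷-cong refl (*ₚ-comm f g)) ⟩
    scale c g +ₚ X· (g *ₚ f)  ≈⟨ *ₚ-∷ g c f ⟨
    g *ₚ (c ∷ f)              ∎

  scale-*ₚ : ∀ c f g → scale c f *ₚ g ≋ₚ scale c (f *ₚ g)
  scale-*ₚ c []      g = P.refl
  scale-*ₚ c (d ∷ f) g = begin
    scale (c * d) g +ₚ X· (scale c f *ₚ g)
      ≈⟨ P.∙-cong (scale-scale c d g) (P.trans (∷-cong refl (scale-*ₚ c f g)) (P.sym (scale-X· c (f *ₚ g)))) ⟩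
    scale c (scale d g) +ₚ scale c (X· (f *ₚ g))
      ≈⟨ scale-+ c (scale d g) (X· (f *ₚ g)) ⟨
    scale c (scale d g +ₚ X· (f *ₚ g))  ∎

  X·-*ₚ : ∀ f g → X· f *ₚ g ≋ₚ X· (f *ₚ g)
  X·-*ₚ f g = P.∙-congʳ {X· (f *ₚ g)} (scale-zero refl g)

  *ₚ-assoc : ∀ f g h → (f *ₚ g) *ₚ h ≋ₚ f *ₚ (g *ₚ h)
  *ₚ-assoc []      g h = P.refl
  *ₚ-assoc (c ∷ f) g h = begin
    (scale c g +ₚ X· (f *ₚ g)) *ₚ h           ≈⟨ *ₚ-distribʳ h (scale c g) (X· (f *ₚ g)) ⟩
    scale c g *ₚ h +ₚ X· (f *ₚ g) *ₚ h        ≈⟨ P.∙-cong (scale-*ₚ c g h) (X·-*ₚ (f *ₚ g) h) ⟩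
    scale c (g *ₚ h) +ₚ X· ((f *ₚ g) *ₚ h)    ≈⟨ P.∙-congˡ (∷-cong refl (*ₚ-assoc f g h)) ⟩
    scale c (g *ₚ h) +ₚ X· (f *ₚ (g *ₚ h))    ∎

  *ₚ-identityˡ : ∀ f → 1ₚ *ₚ f ≋ₚ f
  *ₚ-identityˡ f = begin
    scale 1# f +ₚ X· []  ≈⟨ P.∙-cong (scale-one f) X·[] ⟩
    f +ₚ []              ≈⟨ P.identityʳ f ⟩
    f                    ∎

  polynomialRing : CommutativeRing a a
  polynomialRing = record
    { Carrier = Poly ; _≈_ = _≋ₚ_ ; _+_ = _+ₚ_ ; _*_ = _*ₚ_ ; -_ = -ₚ_ ; 0# = [] ; 1# = 1ₚ
    ; isCommutativeRing = record
      { isRing = record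
        { +-isAbelianGroup = P.isAbelianGroup
        ; *-cong = λ {f} {f′} {g} {g′} d e → P.trans (*ₚ-congʳ g d) (*ₚ-congˡ f′ e)
        ; *-assoc = *ₚ-assoc
        ; *-identity = *ₚ-identityˡ , λ f → P.trans (*ₚ-comm f 1ₚ) (*ₚ-identityˡ f)
        ; distrib = (λ f g h → P.trans (*ₚ-comm f (g +ₚ h)) (P.trans (*ₚ-distribʳ f g h)
                      (P.∙-cong (*ₚ-comm g f) (*ₚ-comm h f))))
                  , *ₚ-distribʳ
        }
      ; *-comm = *ₚ-comm
      }
    }

  linearFactors : List Carrier → Poly
  linearFactors = foldr (λ r g → X- r *ₚ g) 1ₚ

module PolynomialsOver {a} (R : CommutativeRing a a) where
  open Polynomial R public
  open PolynomialRing R public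
  open CommutativeRing polynomialRing public

-- Evaluation and change of coefficients

module Evaluation {a} (R : CommutativeRing a a) where
  open CommutativeRing R hiding (zero)
  open Polynomial R
  open PolynomialRing R
  private module P = CommutativeRing polynomialRing
  open SetoidReasoning setoid
  open SemiringSolver commutativeSemiring using (solve; _:=_; _:+_; _:*_)

  eval-zero : ∀ f x → f ≋ₚ [] → eval f x ≈ 0#
  eval-zero []      x e = refl
  eval-zero (c ∷ f) x e =
    trans (+-cong (at e zero) (trans (*-congˡ (eval-zero f x (pointwise (at e ∘ suc)))) (zeroʳ x)))
      (+-identityˡ 0#)

  eval-cong : ∀ {f g} x → f ≋ₚ g → eval f x ≈ eval g x
  eval-cong {[]}    {g}     x e = sym (eval-zero g x (P.sym e))
  eval-cong {c ∷ f} {[]}    x e = eval-zero (c ∷ f) x e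
  eval-cong {c ∷ f} {d ∷ g} x e = +-cong (at e zero) (*-congˡ (eval-cong x (tail-cong e)))

  eval-congʳ : ∀ f {x y} → x ≈ y → eval f x ≈ eval f y
  eval-congʳ []      e = refl
  eval-congʳ (c ∷ f) e = +-congˡ (*-cong e (eval-congʳ f e))

  eval-+ : ∀ x f g → eval (f +ₚ g) x ≈ eval f x + eval g x
  eval-+ x []      g       = sym (+-identityˡ _)
  eval-+ x (c ∷ f) []      = sym (+-identityʳ _)
  eval-+ x (c ∷ f) (d ∷ g) = trans (+-congˡ (*-congˡ (eval-+ x f g)))
    (solve 5 (λ c d x u v → c :+ d :+ x :* (u :+ v) := c :+ x :* u :+ (d :+ x :* v)) refl
      c d x (eval f x) (eval g x))

  eval-scale : ∀ x c f → eval (scale c f) x ≈ c * eval f x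
  eval-scale x c []      = sym (zeroʳ c)
  eval-scale x c (d ∷ f) = trans (+-congˡ (*-congˡ (eval-scale x c f)))
    (solve 4 (λ c d x u → c :* d :+ x :* (c :* u) := c :* (d :+ x :* u)) refl c d x (eval f x))

  eval-X· : ∀ x f → eval (X· f) x ≈ x * eval f x
  eval-X· x f = +-identityˡ _

  eval-* : ∀ x f g → eval (f *ₚ g) x ≈ eval f x * eval g x
  eval-* x []      g = sym (zeroˡ _)
  eval-* x (c ∷ f) g = begin
    eval (scale c g +ₚ X· (f *ₚ g)) x           ≈⟨ eval-+ x (scale c g) (X· (f *ₚ g)) ⟩
    eval (scale c g) x + eval (X· (f *ₚ g)) x   ≈⟨ +-cong (eval-scale x c g) (trans (eval-X· x (f *ₚ g)) (*-congˡ (eval-* x f g))) ⟩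
    c * eval g x + x * (eval f x * eval g x)    ≈⟨ solve 4 (λ c x u v → c :* v :+ x :* (u :* v) := (c :+ x :* u) :* v) refl
                                                     c x (eval f x) (eval g x) ⟩
    (c + x * eval f x) * eval g x               ∎

  eval-const : ∀ x c → eval (c ∷ []) x ≈ c
  eval-const x c = trans (+-congˡ (zeroʳ x)) (+-identityʳ c)

  evalʰ : Carrier → Hom polynomialRing R
  evalʰ x = record
    { ⟦_⟧ = λ f → eval f x
    ; isRingHomomorphism = mkIsRingHomomorphism (λ f → eval f x) (eval-cong x) (eval-+ x) (eval-* x)
        refl (eval-const x 1#)
        (λ f → GroupProperties.inverseˡ-unique +-group (eval (-ₚ f) x) (eval f x)
          (trans (sym (eval-+ x (-ₚ f) f)) (eval-cong x (P.-‿inverseˡ f))))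
    }

  eval-X- : ∀ r x → eval (X- r) x ≈ x - r
  eval-X- r x = trans (+-congˡ (trans (*-congˡ (eval-const x 1#)) (*-identityʳ x))) (+-comm (- r) x)

  eval-X-≈0 : ∀ r → eval (X- r) r ≈ 0#
  eval-X-≈0 r = trans (eval-X- r r) (-‿inverseʳ r)

module MapPolynomial {a} {K M : CommutativeRing a a} (φ : Hom K M) where
  private
    module K = CommutativeRing K
    module M = CommutativeRing M
    module K[X] = PolynomialsOver K
    module M[X] = PolynomialsOver M
    open Hom φ

  mapₚ : K[X].Poly → M[X].Poly
  mapₚ = List.map ⟦_⟧

  coeff-map : ∀ f n → M[X].coeff (mapₚ f) n M.≈ ⟦ K[X].coeff f n ⟧
  coeff-map []      n       = M.sym 0#-homo
  coeff-map (c ∷ f) zero    = M.refl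
  coeff-map (c ∷ f) (suc n) = coeff-map f n

  map-cong : ∀ {f g} → f K[X].≋ₚ g → mapₚ f M[X].≋ₚ mapₚ g
  map-cong {f} {g} e = M[X].pointwise λ n →
    M.trans (coeff-map f n) (M.trans (⟦⟧-cong (K[X].at e n)) (M.sym (coeff-map g n)))

  map-+ : ∀ f g → mapₚ (f K[X].+ₚ g) M[X].≋ₚ mapₚ f M[X].+ₚ mapₚ g
  map-+ []      g       = M[X].refl
  map-+ (c ∷ f) []      = M[X].refl
  map-+ (c ∷ f) (d ∷ g) = M[X].∷-cong (+-homo c d) (map-+ f g)

  map-scale : ∀ c f → mapₚ (K[X].scale c f) M[X].≋ₚ M[X].scale ⟦ c ⟧ (mapₚ f)
  map-scale c []      = M[X].refl
  map-scale c (d ∷ f) = M[X].∷-cong (*-homo c d) (map-scale c f)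

  map-* : ∀ f g → mapₚ (f K[X].*ₚ g) M[X].≋ₚ mapₚ f M[X].*ₚ mapₚ g
  map-* []      g = M[X].refl
  map-* (c ∷ f) g = M[X].trans (map-+ (K[X].scale c g) (K[X].X· (f K[X].*ₚ g)))
    (M[X].+-cong (map-scale c g) (M[X].∷-cong 0#-homo (map-* f g)))

  map-neg : ∀ f → mapₚ (K[X].-ₚ f) M[X].≋ₚ M[X].-ₚ mapₚ f
  map-neg []      = M[X].refl
  map-neg (c ∷ f) = M[X].∷-cong (-‿homo c) (map-neg f)

  mapʰ : Hom K[X].polynomialRing M[X].polynomialRing
  mapʰ = record
    { ⟦_⟧ = mapₚ
    ; isRingHomomorphism = mkIsRingHomomorphism mapₚ map-cong map-+ map-* M[X].refl
        (M[X].∷-cong 1#-homo M[X].refl) map-neg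
    }

  map-monic : ∀ cs → mapₚ (K[X].monic cs) M[X].≋ₚ M[X].monic (mapₚ cs)
  map-monic []       = M[X].∷-cong 1#-homo M[X].refl
  map-monic (c ∷ cs) = M[X].∷-cong M.refl (map-monic cs)

  map-linearFactors : ∀ rs →
    mapₚ (K[X].linearFactors rs) M[X].≋ₚ M[X].linearFactors (List.map ⟦_⟧ rs)
  map-linearFactors []       = M[X].∷-cong 1#-homo (M[X].refl {[]})
  map-linearFactors (r ∷ rs) = M[X].trans (map-* (K[X].X- r) (K[X].linearFactors rs))
    (M[X].*-cong (M[X].∷-cong (-‿homo r) (M[X].∷-cong 1#-homo (M[X].refl {[]}))) (map-linearFactors rs))

  evalAt : M.Carrier → Hom K[X].polynomialRing M
  evalAt x = Evaluation.evalʰ M x ∘ʰ mapʰ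

  evalAt-cong : ∀ f {x y} → x M.≈ y → Hom.⟦_⟧ (evalAt x) f M.≈ Hom.⟦_⟧ (evalAt y) f
  evalAt-cong f = Evaluation.eval-congʳ M (mapₚ f)

  evalAt-const : ∀ c x → Hom.⟦_⟧ (evalAt x) (c ∷ []) M.≈ ⟦ c ⟧
  evalAt-const c x = Evaluation.eval-const M x ⟦ c ⟧

  evalAt-X : ∀ x → Hom.⟦_⟧ (evalAt x) (K.0# ∷ K.1# ∷ []) M.≈ x
  evalAt-X x = M.trans (M.+-cong 0#-homo (M.*-congˡ (M.trans (evalAt-const K.1# x) 1#-homo)))
    (M.trans (M.+-identityˡ _) (M.*-identityʳ x))

open MapPolynomial using (evalAt)

-- The map `χ` is a parameter that agrees pointwise with the composite: in the applications it is an
-- inclusion or a structure map given beforehand.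
evalAt-∘ : ∀ {a} {K M N : CommutativeRing a a} (ψ : Hom M N) (φ : Hom K M) (χ : Hom K N) →
  let open CommutativeRing N using (_≈_) in
  (∀ c → Hom.⟦_⟧ ψ (Hom.⟦_⟧ φ c) ≈ Hom.⟦_⟧ χ c) → ∀ x f →
  Hom.⟦_⟧ ψ (Hom.⟦_⟧ (evalAt φ x) f) ≈ Hom.⟦_⟧ (evalAt χ (Hom.⟦_⟧ ψ x)) f
evalAt-∘ {N = N} ψ φ χ e x []      = Hom.0#-homo ψ
evalAt-∘ {N = N} ψ φ χ e x (c ∷ f) = trans (Hom.+-homo ψ _ _)
  (+-cong (e c) (trans (Hom.*-homo ψ _ _) (*-congˡ (evalAt-∘ ψ φ χ e x f))))
  where open CommutativeRing N

-- Division by monic polynomials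

module Monic {a} (R : CommutativeRing a a) where
  open CommutativeRing R hiding (zero)
  open Polynomial R
  open PolynomialRing R
  open Evaluation R
  private module P = CommutativeRing polynomialRing
  open RingProperties ring using (-‿distribʳ-*)

  coeff-monic-top : ∀ cs → coeff (monic cs) (length cs) ≈ 1#
  coeff-monic-top []       = refl
  coeff-monic-top (c ∷ cs) = coeff-monic-top cs

  coeff-monic-above : ∀ cs m → coeff (monic cs) (suc (length cs ℕ.+ m)) ≈ 0#
  coeff-monic-above []       m = refl
  coeff-monic-above (c ∷ cs) m = coeff-monic-above cs m

  coeff-monic-* : ∀ cs c q n → coeff (monic cs *ₚ (c ∷ q)) n
    ≈ c * coeff (monic cs) n + coeff (X· (monic cs *ₚ q)) n
  coeff-monic-* cs c q n = trans (at (*ₚ-∷ (monic cs) c q) n)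
    (trans (coeff-+ (scale c (monic cs)) (X· (monic cs *ₚ q)) n) (+-congʳ (coeff-scale c (monic cs) n)))

  -- Let n be the degree of the monic factor. In degrees above n the constant term `c` of the
  -- cofactor contributes nothing, so the hypothesis passes to its tail, which vanishes by
  -- induction; the coefficient in degree n is then `c` itself.
  monic-*-low⇒zero : ∀ cs q → (∀ m → coeff (monic cs *ₚ q) (length cs ℕ.+ m) ≈ 0#) → q ≋ₚ []
  monic-*-low⇒zero cs []      low = P.refl
  monic-*-low⇒zero cs (c ∷ q) low = pointwise λ { zero → c≈0 ; (suc n) → at q≋[] n }
    where
    q≋[] : q ≋ₚ []
    q≋[] = monic-*-low⇒zero cs q λ m → begin
      coeff (monic cs *ₚ q) (length cs ℕ.+ m)
        ≈⟨ trans (+-congʳ (trans (*-congˡ (coeff-monic-above cs m)) (zeroʳ c))) (+-identityˡ _) ⟨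
      c * coeff (monic cs) (suc (length cs ℕ.+ m)) + coeff (monic cs *ₚ q) (length cs ℕ.+ m)
        ≈⟨ coeff-monic-* cs c q (suc (length cs ℕ.+ m)) ⟨
      coeff (monic cs *ₚ (c ∷ q)) (suc (length cs ℕ.+ m))
        ≡⟨ ≡.cong (coeff (monic cs *ₚ (c ∷ q))) (ℕ.+-suc (length cs) m) ⟨
      coeff (monic cs *ₚ (c ∷ q)) (length cs ℕ.+ suc m)
        ≈⟨ low (suc m) ⟩
      0# ∎
      where open SetoidReasoning setoid
    X·≋[] : X· (monic cs *ₚ q) ≋ₚ []
    X·≋[] = P.trans (∷-cong refl (P.trans (*ₚ-congˡ (monic cs) q≋[]) (*-zeroʳ (monic cs)))) X·[]
    c≈0 : c ≈ 0#
    c≈0 = begin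
      c                                                                    ≈⟨ *-identityʳ c ⟨
      c * 1#                                                               ≈⟨ *-congˡ (coeff-monic-top cs) ⟨
      c * coeff (monic cs) (length cs)                                     ≈⟨ +-identityʳ _ ⟨
      c * coeff (monic cs) (length cs) + 0#                                ≈⟨ +-congˡ (at X·≋[] (length cs)) ⟨
      c * coeff (monic cs) (length cs) + coeff (X· (monic cs *ₚ q)) (length cs)
                                                                           ≈⟨ coeff-monic-* cs c q (length cs) ⟨
      coeff (monic cs *ₚ (c ∷ q)) (length cs)                              ≡⟨ ≡.cong (coeff (monic cs *ₚ (c ∷ q))) (ℕ.+-identityʳ (length cs)) ⟨
      coeff (monic cs *ₚ (c ∷ q)) (length cs ℕ.+ 0)                        ≈⟨ low 0 ⟩
      0#                                                                   ∎
      where open SetoidReasoning setoid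

  -- The constant 1 has no coefficient in positive degree, so the cofactor would be zero.
  monic-nonunit : ¬ 1# ≈ 0# → ∀ c cs q → ¬ monic (c ∷ cs) *ₚ q ≋ₚ 1ₚ
  monic-nonunit 1≉0 c cs q e = 1≉0 (trans (sym (at e 0)) (at (P.trans (*ₚ-congˡ (monic (c ∷ cs))
    (monic-*-low⇒zero (c ∷ cs) q λ m → at e (suc (length cs ℕ.+ m)))) (*-zeroʳ (monic (c ∷ cs)))) 0))

  -- `X- r` unfolds to `monic (- r ∷ [])`, so the vanishing criterion for monic factors gives
  -- cancellation over any commutative ring, domain or not.
  X-cancel : ∀ r {f g} → X- r *ₚ f ≋ₚ X- r *ₚ g → f ≋ₚ g
  X-cancel r = cancel (monic-*-low⇒zero (- r ∷ []))
    where
    open GroupProperties P.+-group using (x∙y⁻¹≈ε⇒x≈y; x≈y⇒x∙y⁻¹≈ε)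
    open RingProperties P.ring using (x[y-z]≈xy-xz)
    cancel : (∀ q → (∀ m → coeff (X- r *ₚ q) (suc m) ≈ 0#) → q ≋ₚ []) →
      ∀ {f g} → X- r *ₚ f ≋ₚ X- r *ₚ g → f ≋ₚ g
    cancel zero? {f} {g} e = x∙y⁻¹≈ε⇒x≈y f g (zero? (f +ₚ -ₚ g) λ m →
      at (P.trans (x[y-z]≈xy-xz (X- r) f g) (x≈y⇒x∙y⁻¹≈ε e)) (suc m))

  -- Horner's scheme: if p = (X - r) q + p(r), then c + X p = (X - r)(p(r) + X q) + (c + r p(r)).
  quotientₚ : Carrier → Poly → Poly
  quotientₚ r []      = []
  quotientₚ r (c ∷ p) = eval p r ∷ quotientₚ r p

  private
    synthetic-head : ∀ e r c → e * - r + 0# + (c + r * e) ≈ c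
    synthetic-head e r c = begin
      e * - r + 0# + (c + r * e)  ≈⟨ +-cong (+-identityʳ _) (+-comm c _) ⟩
      e * - r + (r * e + c)       ≈⟨ +-assoc _ _ _ ⟨
      e * - r + r * e + c         ≈⟨ +-congʳ (+-cong (sym (-‿distribʳ-* e r)) (*-comm r e)) ⟩
      - (e * r) + e * r + c       ≈⟨ +-congʳ (-‿inverseˡ (e * r)) ⟩
      0# + c                      ≈⟨ +-identityˡ c ⟩
      c                           ∎
      where open SetoidReasoning setoid

    synthetic-step : ∀ r c p q → p ≋ₚ X- r *ₚ q +ₚ (eval p r ∷ []) →
      c ∷ p ≋ₚ X- r *ₚ (eval p r ∷ q) +ₚ (eval (c ∷ p) r ∷ [])
    synthetic-step r c p q ih = P.sym (begin
      X- r *ₚ (e ∷ q) +ₚ (c + r * e ∷ [])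
        ≈⟨ P.+-congʳ {c + r * e ∷ []} (*ₚ-∷ (X- r) e q) ⟩
      (e * - r + 0# + (c + r * e)) ∷ ((e * 1# ∷ []) +ₚ X- r *ₚ q) +ₚ []
        ≈⟨ ∷-cong (synthetic-head e r c) (begin
          ((e * 1# ∷ []) +ₚ X- r *ₚ q) +ₚ []  ≈⟨ P.+-identityʳ _ ⟩
          (e * 1# ∷ []) +ₚ X- r *ₚ q          ≈⟨ P.+-comm (e * 1# ∷ []) (X- r *ₚ q) ⟩
          X- r *ₚ q +ₚ (e * 1# ∷ [])          ≈⟨ P.+-congˡ {X- r *ₚ q} (∷-cong (*-identityʳ e) P.refl) ⟩
          X- r *ₚ q +ₚ (e ∷ [])               ≈⟨ ih ⟨
          p                                   ∎) ⟩
      c ∷ p ∎)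
      where
      e = eval p r
      open SetoidReasoning P.setoid

  synthetic-division : ∀ r p → p ≋ₚ X- r *ₚ quotientₚ r p +ₚ (eval p r ∷ [])
  synthetic-division r []      = P.sym (P.trans (P.+-congʳ (*-zeroʳ (X- r))) X·[])
  synthetic-division r (c ∷ p) = synthetic-step r c p (quotientₚ r p) (synthetic-division r p)

  -- Lower coefficients of the quotient of `monic (c ∷ cs)` by `X- r`. The constant coefficient `c`
  -- is left out because the quotient does not depend on it. Unlike `quotientₚ`, which ends in a
  -- spurious zero, this keeps the quotient literally of the form `monic`.
  monic-quotient : Carrier → List Carrier → List Carrier
  monic-quotient r []       = []
  monic-quotient r (c ∷ cs) = eval (monic (c ∷ cs)) r ∷ monic-quotient r cs

  monic-synthetic-division : ∀ r c cs →
    monic (c ∷ cs) ≋ₚ X- r *ₚ monic (monic-quotient r cs) +ₚ (eval (monic (c ∷ cs)) r ∷ [])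
  monic-synthetic-division r c []       = P.trans
    (synthetic-step r c 1ₚ [] (∷-cong (sym (trans (+-identityˡ _) (eval-const r 1#))) (P.sym X·[])))
    (P.+-congʳ {eval (monic (c ∷ [])) r ∷ []} (*ₚ-congˡ (X- r) {eval 1ₚ r ∷ []} {1ₚ} (∷-cong (eval-const r 1#) P.refl)))
  monic-synthetic-division r c (d ∷ cs) =
    synthetic-step r c (monic (d ∷ cs)) (monic (monic-quotient r cs)) (monic-synthetic-division r d cs)

  factor-root : ∀ r p → eval p r ≈ 0# → p ≋ₚ X- r *ₚ quotientₚ r p
  factor-root r p e = P.trans (synthetic-division r p)
    (P.trans (P.+-congˡ {X- r *ₚ quotientₚ r p} (P.trans (∷-cong e P.refl) X·[])) (P.+-identityʳ _))

  monic-factor-root : ∀ r c cs → eval (monic (c ∷ cs)) r ≈ 0# →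
    monic (c ∷ cs) ≋ₚ X- r *ₚ monic (monic-quotient r cs)
  monic-factor-root r c cs e = P.trans (monic-synthetic-division r c cs)
    (P.trans (P.+-congˡ {X- r *ₚ monic (monic-quotient r cs)} (P.trans (∷-cong e P.refl) X·[])) (P.+-identityʳ _))

  monomial : ℕ → Carrier → Poly
  monomial zero    c = c ∷ []
  monomial (suc n) c = X· monomial n c

  snoc-≋ : ∀ cs c → cs ∷ʳ c ≋ₚ cs +ₚ monomial (length cs) c
  snoc-≋ []       c = P.refl
  snoc-≋ (d ∷ cs) c = ∷-cong (sym (+-identityʳ d)) (snoc-≋ cs c)

  monomial-scale : ∀ n c d → scale c (monomial n d) ≋ₚ monomial n (c * d)
  monomial-scale zero    c d = P.refl
  monomial-scale (suc n) c d = ∷-cong (zeroʳ c) (monomial-scale n c d)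

  monomial-cong : ∀ n {c d} → c ≈ d → monomial n c ≋ₚ monomial n d
  monomial-cong zero    e = ∷-cong e P.refl
  monomial-cong (suc n) e = ∷-cong refl (monomial-cong n e)

  length-+ₚ : ∀ f g → length f ≡ length g → length (f +ₚ g) ≡ length f
  length-+ₚ []      g       e = ≡.sym e
  length-+ₚ (c ∷ f) (d ∷ g) e = ≡.cong suc (length-+ₚ f g (ℕ.suc-injective e))

  split-last : ∀ (c : Carrier) (r : List Carrier) → ∃[ s ] ∃[ t ] c ∷ r ≡ s ∷ʳ t × length s ≡ length r
  split-last c []      = [] , c , ≡.refl , ≡.refl
  split-last c (d ∷ r) with s , t , e , e′ ← split-last d r =
    c ∷ s , t , ≡.cong (c ∷_) e , ≡.cong suc e′

  -- The remainder is padded to exactly `length cs` entries, which turns the degree bound into an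
  -- equation. Given p = m q + r, the list `c ∷ r` represents c + X r and is one entry too long; its
  -- top coefficient `t` is removed by subtracting t m, so `t` becomes the constant term of the new
  -- quotient.
  division : ∀ cs p → ∃[ q ] ∃[ r ] length r ≡ length cs × p ≋ₚ monic cs *ₚ q +ₚ r
  division cs [] = [] , List.replicate (length cs) 0# , List.length-replicate (length cs) ,
    P.sym (P.trans (P.+-congʳ (*-zeroʳ (monic cs))) (zeros (length cs)))
    where
    zeros : ∀ n → List.replicate n 0# ≋ₚ []
    zeros zero    = P.refl
    zeros (suc n) = P.trans (∷-cong refl (zeros n)) X·[]
  division cs (c ∷ p) with q , r , ∣r∣≡n , e ← division cs p with s , t , c∷r≡s∷ʳt , ∣s∣≡∣r∣ ← split-last c r =
    t ∷ q , s +ₚ scale (- t) cs , ≡.trans (length-+ₚ s (scale (- t) cs) ∣s∣≡∣scale∣) ∣s∣≡n , (begin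
      c ∷ p                                          ≈⟨ ∷-cong (sym (+-identityˡ c)) e ⟩
      X· (monic cs *ₚ q) +ₚ (c ∷ r)                  ≡⟨ ≡.cong (X· (monic cs *ₚ q) +ₚ_) c∷r≡s∷ʳt ⟩
      X· (monic cs *ₚ q) +ₚ (s ∷ʳ t)                 ≈⟨ P.+-congˡ {X· (monic cs *ₚ q)} top ⟩
      X· (monic cs *ₚ q) +ₚ (scale t (monic cs) +ₚ (s +ₚ scale (- t) cs))
        ≈⟨ x∙yz≈yx∙z (X· (monic cs *ₚ q)) (scale t (monic cs)) (s +ₚ scale (- t) cs) ⟩
      (scale t (monic cs) +ₚ X· (monic cs *ₚ q)) +ₚ (s +ₚ scale (- t) cs)
        ≈⟨ P.+-congʳ {s +ₚ scale (- t) cs} (*ₚ-∷ (monic cs) t q) ⟨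
      monic cs *ₚ (t ∷ q) +ₚ (s +ₚ scale (- t) cs)   ∎)
    where
    open SetoidReasoning P.setoid
    open CommutativeSemigroupProperties (AbelianGroup.commutativeSemigroup additiveGroup)
      using (x∙yz≈yx∙z; interchange)
    ∣s∣≡n : length s ≡ length cs
    ∣s∣≡n = ≡.trans ∣s∣≡∣r∣ ∣r∣≡n
    ∣s∣≡∣scale∣ : length s ≡ length (scale (- t) cs)
    ∣s∣≡∣scale∣ = ≡.trans ∣s∣≡n (≡.sym (List.length-map (- t *_) cs))
    xᵗ = monomial (length cs) t
    top : s ∷ʳ t ≋ₚ scale t (monic cs) +ₚ (s +ₚ scale (- t) cs)
    top = begin
      s ∷ʳ t                                              ≈⟨ snoc-≋ s t ⟩
      s +ₚ monomial (length s) t                          ≡⟨ ≡.cong (λ n → s +ₚ monomial n t) ∣s∣≡n ⟩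
      s +ₚ xᵗ                                             ≈⟨ P.+-comm s xᵗ ⟩
      xᵗ +ₚ s                                             ≈⟨ P.+-congʳ {xᵗ +ₚ s} (P.trans (P.sym (+-scale t (- t) cs)) (scale-zero (-‿inverseʳ t) cs)) ⟨
      (scale t cs +ₚ scale (- t) cs) +ₚ (xᵗ +ₚ s)         ≈⟨ interchange (scale t cs) (scale (- t) cs) xᵗ s ⟩
      (scale t cs +ₚ xᵗ) +ₚ (scale (- t) cs +ₚ s)         ≈⟨ P.+-cong scale-monic (P.+-comm s (scale (- t) cs)) ⟨
      scale t (monic cs) +ₚ (s +ₚ scale (- t) cs)         ∎
      where
      scale-monic : scale t (monic cs) ≋ₚ scale t cs +ₚ xᵗ
      scale-monic = begin
        scale t (monic cs)                              ≈⟨ scale-cong refl (snoc-≋ cs 1#) ⟩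
        scale t (cs +ₚ monomial (length cs) 1#)         ≈⟨ scale-+ t cs (monomial (length cs) 1#) ⟩
        scale t cs +ₚ scale t (monomial (length cs) 1#) ≈⟨ P.+-congˡ {scale t cs} (P.trans (monomial-scale (length cs) t 1#)
                                                             (monomial-cong (length cs) (*-identityʳ t))) ⟩
        scale t cs +ₚ xᵗ                                ∎

-- Derivatives and separable polynomials

module Derivative {a} (R : CommutativeRing a a) where
  open CommutativeRing R hiding (zero)
  open Polynomial R
  open PolynomialRing R
  open Evaluation R
  private
    module P = CommutativeRing polynomialRing
    open CommutativeSemigroupProperties (AbelianGroup.commutativeSemigroup additiveGroup)
      using (interchange; x∙yz≈y∙xz)

  derivative-zero : ∀ f → f ≋ₚ [] → derivative f ≋ₚ []
  derivative-zero []      e = P.refl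
  derivative-zero (c ∷ f) e = P.trans (P.+-cong f≋[] (∷-cong refl (derivative-zero f f≋[]))) X·[]
    where
    f≋[] : f ≋ₚ []
    f≋[] = pointwise (at e ∘ suc)

  derivative-cong : ∀ {f g} → f ≋ₚ g → derivative f ≋ₚ derivative g
  derivative-cong {[]}    {g}     e = P.sym (derivative-zero g (P.sym e))
  derivative-cong {c ∷ f} {[]}    e = derivative-zero (c ∷ f) e
  derivative-cong {c ∷ f} {d ∷ g} e =
    P.+-cong (tail-cong e) (∷-cong refl (derivative-cong {f} {g} (tail-cong e)))

  derivative-+ : ∀ f g → derivative (f +ₚ g) ≋ₚ derivative f +ₚ derivative g
  derivative-+ []      g       = P.refl
  derivative-+ (c ∷ f) []      = P.sym (P.+-identityʳ _)
  derivative-+ (c ∷ f) (d ∷ g) = P.trans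
    (P.+-congˡ {f +ₚ g} (P.trans (∷-cong refl (derivative-+ f g)) (X·-+ (derivative f) (derivative g))))
    (interchange f g (X· derivative f) (X· derivative g))

  derivative-scale : ∀ c f → derivative (scale c f) ≋ₚ scale c (derivative f)
  derivative-scale c []      = P.refl
  derivative-scale c (d ∷ f) = P.trans
    (P.+-congˡ {scale c f} (P.trans (∷-cong refl (derivative-scale c f)) (P.sym (scale-X· c (derivative f)))))
    (P.sym (scale-+ c f (X· derivative f)))

  derivative-* : ∀ f g → derivative (f *ₚ g) ≋ₚ derivative f *ₚ g +ₚ f *ₚ derivative g
  derivative-* []      g = P.refl
  derivative-* (c ∷ f) g = begin
    derivative (scale c g +ₚ X· (f *ₚ g))
      ≈⟨ derivative-+ (scale c g) (X· (f *ₚ g)) ⟩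
    derivative (scale c g) +ₚ (f *ₚ g +ₚ X· derivative (f *ₚ g))
      ≈⟨ P.+-cong (derivative-scale c g) (P.+-congˡ {f *ₚ g} (P.trans (∷-cong refl (derivative-* f g))
           (X·-+ (derivative f *ₚ g) (f *ₚ derivative g)))) ⟩
    scale c g′ +ₚ (f *ₚ g +ₚ (X· (f′ *ₚ g) +ₚ X· (f *ₚ g′)))
      ≈⟨ P.+-congˡ {scale c g′} (P.+-assoc (f *ₚ g) (X· (f′ *ₚ g)) (X· (f *ₚ g′))) ⟨
    scale c g′ +ₚ ((f *ₚ g +ₚ X· (f′ *ₚ g)) +ₚ X· (f *ₚ g′))
      ≈⟨ x∙yz≈y∙xz (scale c g′) (f *ₚ g +ₚ X· (f′ *ₚ g)) (X· (f *ₚ g′)) ⟩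
    (f *ₚ g +ₚ X· (f′ *ₚ g)) +ₚ (scale c g′ +ₚ X· (f *ₚ g′))
      ≈⟨ P.+-congʳ {scale c g′ +ₚ X· (f *ₚ g′)} (P.trans (*ₚ-distribʳ g f (X· f′))
           (P.+-congˡ {f *ₚ g} (X·-*ₚ f′ g))) ⟨
    (f +ₚ X· f′) *ₚ g +ₚ (scale c g′ +ₚ X· (f *ₚ g′))  ∎
    where
    open SetoidReasoning P.setoid
    f′ = derivative f
    g′ = derivative g

  -- By the product rule, u f + v f′ = (u q + v q′) g + (v q) g′ when f = g q, so a Bezout identity
  -- for f regroups into one for g.
  separable-divisor : ∀ f g q → f ≋ₚ g *ₚ q → Separable f → Separable g
  separable-divisor f g q e (u , v , bezout) = u *ₚ q +ₚ v *ₚ derivative q , v *ₚ q , at (begin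
    (u *ₚ q +ₚ v *ₚ derivative q) *ₚ g +ₚ (v *ₚ q) *ₚ derivative g
      ≈⟨ solve 6 (λ u q v q′ g g′ → (u :* q :+ v :* q′) :* g :+ v :* q :* g′ := u :* (g :* q) :+ v :* (g′ :* q :+ g :* q′))
           P.refl u q v (derivative q) g (derivative g) ⟩
    u *ₚ (g *ₚ q) +ₚ v *ₚ (derivative g *ₚ q +ₚ g *ₚ derivative q)
      ≈⟨ P.+-cong (*ₚ-congˡ u e) (*ₚ-congˡ v (P.trans (derivative-cong e) (derivative-* g q))) ⟨
    u *ₚ f +ₚ v *ₚ derivative f
      ≈⟨ pointwise bezout ⟩
    1ₚ ∎)
    where
    open SetoidReasoning P.setoid
    open SemiringSolver P.commutativeSemiring using (solve; _:=_; _:+_; _:*_)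

  -- At a multiple root both f and f′ vanish, and evaluating the Bezout identity there gives 1 = 0.
  separable-simple-root : ¬ 1# ≈ 0# → ∀ f x h → f ≋ₚ X- x *ₚ h → Separable f → ¬ eval h x ≈ 0#
  separable-simple-root 1≉0 f x h e (u , v , bezout) h[x]≈0 = 1≉0 (begin
    1#                                                          ≈⟨ eval-const x 1# ⟨
    eval 1ₚ x                                                   ≈⟨ eval-cong x (pointwise {u *ₚ f +ₚ v *ₚ derivative f} {1ₚ} bezout) ⟨
    eval (u *ₚ f +ₚ v *ₚ derivative f) x                        ≈⟨ +-homo (u *ₚ f) (v *ₚ derivative f) ⟩
    eval (u *ₚ f) x + eval (v *ₚ derivative f) x                ≈⟨ +-cong (*-homo u f) (*-homo v (derivative f)) ⟩
    eval u x * eval f x + eval v x * eval (derivative f) x      ≈⟨ +-cong (*-congˡ f[x]≈0) (*-congˡ f′[x]≈0) ⟩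
    eval u x * 0# + eval v x * 0#                               ≈⟨ +-cong (zeroʳ _) (zeroʳ _) ⟩
    0# + 0#                                                     ≈⟨ +-identityˡ 0# ⟩
    0#                                                          ∎)
    where
    open SetoidReasoning setoid
    open Hom (evalʰ x) using (+-homo; *-homo)
    f[x]≈0 : eval f x ≈ 0#
    f[x]≈0 = trans (eval-cong x e) (trans (*-homo (X- x) h) (trans (*-congˡ h[x]≈0) (zeroʳ _)))
    f′[x]≈0 : eval (derivative f) x ≈ 0#
    f′[x]≈0 = begin
      eval (derivative f) x
        ≈⟨ eval-cong x (P.trans (derivative-cong e) (derivative-* (X- x) h)) ⟩
      eval (derivative (X- x) *ₚ h +ₚ X- x *ₚ derivative h) x
        ≈⟨ +-homo (derivative (X- x) *ₚ h) (X- x *ₚ derivative h) ⟩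
      eval (derivative (X- x) *ₚ h) x + eval (X- x *ₚ derivative h) x
        ≈⟨ +-cong (trans (*-homo (derivative (X- x)) h) (trans (*-congˡ h[x]≈0) (zeroʳ _)))
                  (trans (*-homo (X- x) (derivative h)) (trans (*-congʳ (eval-X-≈0 x)) (zeroˡ _))) ⟩
      0# + 0#  ≈⟨ +-identityˡ 0# ⟩
      0#       ∎

module _ {a} {K M : CommutativeRing a a} (φ : Hom K M) where
  private
    module K[X] = PolynomialsOver K
    module M[X] = PolynomialsOver M
    open Hom φ
    open MapPolynomial φ hiding (evalAt)

  map-derivative : ∀ f → mapₚ (K[X].derivative f) M[X].≋ₚ M[X].derivative (mapₚ f)
  map-derivative []      = M[X].refl
  map-derivative (c ∷ f) = M[X].trans (map-+ f (K[X].X· K[X].derivative f))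
    (M[X].+-congˡ {mapₚ f} (M[X].∷-cong 0#-homo (map-derivative f)))

  map-separable : ∀ f → K[X].Separable f → M[X].Separable (mapₚ f)
  map-separable f (u , v , bezout) = mapₚ u , mapₚ v , M[X].at (begin
    mapₚ u M[X].*ₚ mapₚ f M[X].+ₚ mapₚ v M[X].*ₚ M[X].derivative (mapₚ f)
      ≈⟨ M[X].+-cong (map-* u f) (M[X].trans (map-* v (K[X].derivative f)) (M[X].*ₚ-congˡ (mapₚ v) (map-derivative f))) ⟨
    mapₚ (u K[X].*ₚ f) M[X].+ₚ mapₚ (v K[X].*ₚ K[X].derivative f)
      ≈⟨ map-+ (u K[X].*ₚ f) (v K[X].*ₚ K[X].derivative f) ⟨
    mapₚ (u K[X].*ₚ f K[X].+ₚ v K[X].*ₚ K[X].derivative f)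
      ≈⟨ map-cong (K[X].pointwise bezout) ⟩
    mapₚ K[X].1ₚ
      ≈⟨ M[X].∷-cong 1#-homo (M[X].refl {[]}) ⟩
    M[X].1ₚ ∎)
    where open SetoidReasoning M[X].setoid

evalAt-map : ∀ {a} {K L M : CommutativeRing a a} (φ : Hom K L) (ψ : Hom L M) (χ : Hom K M) →
  let open CommutativeRing M using (_≈_) in
  (∀ c → Hom.⟦_⟧ ψ (Hom.⟦_⟧ φ c) ≈ Hom.⟦_⟧ χ c) → ∀ x f →
  Hom.⟦_⟧ (evalAt ψ x) (List.map (Hom.⟦_⟧ φ) f) ≈ Hom.⟦_⟧ (evalAt χ x) f
evalAt-map {M = M} φ ψ χ e x []      = CommutativeRing.refl M
evalAt-map {M = M} φ ψ χ e x (c ∷ f) = CommutativeRing.+-cong M (e c)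
  (CommutativeRing.*-congˡ M (evalAt-map φ ψ χ e x f))

map-map-≋ : ∀ {a} {K L M : CommutativeRing a a} (φ : Hom K L) (ψ : Hom L M) (χ : Hom K M) →
  let open CommutativeRing M using (_≈_)
      open PolynomialRing M using (_≋ₚ_) in
  (∀ c → Hom.⟦_⟧ ψ (Hom.⟦_⟧ φ c) ≈ Hom.⟦_⟧ χ c) → ∀ f →
  List.map (Hom.⟦_⟧ ψ) (List.map (Hom.⟦_⟧ φ) f) ≋ₚ List.map (Hom.⟦_⟧ χ) f
map-map-≋ {M = M} φ ψ χ e []      = CommutativeRing.refl (PolynomialRing.polynomialRing M)
map-map-≋ {M = M} φ ψ χ e (c ∷ f) = PolynomialRing.∷-cong M (e c) (map-map-≋ φ ψ χ e f)

-- Roots and linear factors over a field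

module FieldPolynomials {a} {R : CommutativeRing a a} (isField : IsField R) (dec : ExcludedMiddle a) where
  open CommutativeRing R hiding (zero)
  open Polynomial R
  open PolynomialRing R
  open Evaluation R
  open Monic R
  open IsField isField
  open FieldProperties isField
  private module P = CommutativeRing polynomialRing

  -- Strips trailing zeros and the leading coefficient. The strict length bound is what makes a
  -- nonzero remainder contradict minimality in `minimal-divides`.
  normalise : ∀ f → f ≋ₚ [] ⊎
    (∃[ c ] ∃[ cs ] ¬ c ≈ 0# × f ≋ₚ scale c (monic cs) × length cs < length f)
  normalise [] = inj₁ P.refl
  normalise (c ∷ f) with normalise f
  normalise (c ∷ f) | inj₁ f≋[] with dec {c ≈ 0#}
  ... | yes c≈0 = inj₁ (P.trans (∷-cong c≈0 f≋[]) X·[])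
  ... | no  c≉0 = inj₂ (c , [] , c≉0 , ∷-cong (sym (*-identityʳ c)) f≋[] , s≤s z≤n)
  normalise (c ∷ f) | inj₂ (d , cs , d≉0 , e , <) with d⁻¹ , dd⁻¹≈1 ← invertible d≉0 =
    inj₂ (d , d⁻¹ * c ∷ cs , d≉0 ,
      ∷-cong (sym (trans (sym (*-assoc d d⁻¹ c)) (trans (*-congʳ dd⁻¹≈1) (*-identityˡ c)))) e , s≤s <)

  split-root : ∀ rs x → eval (linearFactors rs) x ≈ 0# → Any (x ≈_) rs
  split-root [] x e = ⊥-elim (nontrivial (trans (sym (eval-const x 1#)) e))
  split-root (r ∷ rs) x e with dec {x ≈ r}
  ... | yes x≈r = here x≈r
  ... | no  x≉r = there (split-root rs x (cancel-zero
        (x≉r ∘ GroupProperties.x∙y⁻¹≈ε⇒x≈y +-group x r ∘ trans (sym (eval-X- r x)))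
        (trans (sym (eval-* x (X- r) (linearFactors rs))) e)))

  root-split : ∀ rs → All (λ r → eval (linearFactors rs) r ≈ 0#) rs
  root-split [] = []
  root-split (r ∷ rs) =
    trans (eval-* r (X- r) (linearFactors rs)) (trans (*-congʳ (eval-X-≈0 r)) (zeroˡ _)) ∷
    All.map (λ {s} e → trans (eval-* s (X- r) (linearFactors rs)) (trans (*-congˡ e) (zeroʳ _))) (root-split rs)

  -- Induction on the linear factors on the right: each `r` is a root of the divisor or of the
  -- cofactor, and `X- r` is cancelled from whichever it divides. This avoids unique factorisation.
  split-divisor : ∀ cs q rs → monic cs *ₚ q ≋ₚ linearFactors rs → ∃[ ss ] monic cs ≋ₚ linearFactors ss
  split-divisor []       q rs       e = [] , P.refl
  split-divisor (c ∷ cs) q []       e = ⊥-elim (monic-nonunit nontrivial c cs q e)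
  split-divisor (c ∷ cs) q (r ∷ rs) e with dec {eval (monic (c ∷ cs)) r ≈ 0#}
  ... | yes root =
        let ss , e′ = split-divisor (monic-quotient r cs) q rs (X-cancel r (begin
              X- r *ₚ (monic (monic-quotient r cs) *ₚ q)  ≈⟨ *ₚ-assoc (X- r) (monic (monic-quotient r cs)) q ⟨
              (X- r *ₚ monic (monic-quotient r cs)) *ₚ q  ≈⟨ *ₚ-congʳ q (monic-factor-root r c cs root) ⟨
              monic (c ∷ cs) *ₚ q                         ≈⟨ e ⟩
              X- r *ₚ linearFactors rs                    ∎))
        in r ∷ ss , P.trans (monic-factor-root r c cs root) (*ₚ-congˡ (X- r) e′)
    where open SetoidReasoning P.setoid
  ... | no ¬root = split-divisor (c ∷ cs) (quotientₚ r q) rs (X-cancel r (begin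
              X- r *ₚ (monic (c ∷ cs) *ₚ quotientₚ r q)  ≈⟨ x∙yz≈y∙xz (X- r) (monic (c ∷ cs)) (quotientₚ r q) ⟩
              monic (c ∷ cs) *ₚ (X- r *ₚ quotientₚ r q)  ≈⟨ *ₚ-congˡ (monic (c ∷ cs)) (factor-root r q q[r]≈0) ⟨
              monic (c ∷ cs) *ₚ q                        ≈⟨ e ⟩
              X- r *ₚ linearFactors rs                   ∎))
    where
    open SetoidReasoning P.setoid
    open CommutativeSemigroupProperties P.*-commutativeSemigroup using (x∙yz≈y∙xz)
    q[r]≈0 : eval q r ≈ 0#
    q[r]≈0 = cancel-zero ¬root (trans (sym (eval-* r (monic (c ∷ cs)) q)) (trans (eval-cong r e)
      (All.head (root-split (r ∷ rs)))))

  monic-divisor-root : ∀ c cs q rs → monic (c ∷ cs) *ₚ q ≋ₚ linearFactors rs →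
    ∃[ s ] eval (monic (c ∷ cs)) s ≈ 0#
  monic-divisor-root c cs q rs e with split-divisor (c ∷ cs) q rs e
  ... | []     , e′ = ⊥-elim (monic-nonunit nontrivial c cs 1ₚ (P.trans (P.*-identityʳ (monic (c ∷ cs))) e′))
  ... | s ∷ ss , e′ = s , trans (eval-cong s e′) (All.head (root-split (s ∷ ss)))

-- The bound `n` is fuel for the recursion: as long as a strictly shorter witness exists, it
-- replaces the current one.
least-length : ∀ {a} {A : Set a} → ExcludedMiddle a → (P : List A → Set a) →
  ∀ n xs → length xs ≤ n → P xs → ∃[ ys ] P ys × (∀ zs → P zs → length ys ≤ length zs)
least-length dec P n xs ∣xs∣≤n Pxs with dec {∃[ zs ] P zs × length zs < length xs}
... | no ¬shorter = xs , Pxs , λ zs Pzs → ℕ.≮⇒≥ λ zs< → ¬shorter (zs , Pzs , zs<)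
least-length dec P zero    xs ∣xs∣≤n Pxs | yes (zs , Pzs , zs<) = ⊥-elim (ℕ.n≮0 (ℕ.<-≤-trans zs< ∣xs∣≤n))
least-length dec P (suc n) xs ∣xs∣≤n Pxs | yes (zs , Pzs , zs<) =
  least-length dec P n zs (ℕ.≤-pred (ℕ.≤-trans zs< ∣xs∣≤n)) Pzs

-- Minimal polynomials

module MinimalPolynomial {a} {K M : CommutativeRing a a} (φ : Hom K M)
  (K-isField : IsField K) (M-isField : IsField M) (dec : ExcludedMiddle a) where
  private
    module K = CommutativeRing K
    module M = CommutativeRing M
    module K[X] = PolynomialsOver K
    open Hom φ
    open MapPolynomial φ using (evalAt-const)
  open Extension φ

  -- The remainder of `f` also vanishes at `x`. Were it nonzero, dividing it by its leading
  -- coefficient would give a monic polynomial with root `x` and shorter than `cs`.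
  minimal-divides : ∀ {x cs} → IsMinimalPolynomial x cs →
    ∀ f → x IsRootOf f → ∃[ q ] f K[X].≋ₚ K[X].monic cs K[X].*ₚ q
  minimal-divides {x} {cs} (root , minimal) f f[x]≈0
    with q , r , ∣r∣≡n , e ← Monic.division K cs f
    with FieldPolynomials.normalise K-isField dec r
  ... | inj₁ r≋[] = q , K[X].trans e (K[X].trans (K[X].+-congˡ {K[X].monic cs K[X].*ₚ q} r≋[]) (K[X].+-identityʳ _))
  ... | inj₂ (c , ds , c≉0 , r≋ , ∣ds∣<∣r∣) = ⊥-elim (ℕ.<⇒≱ (≡.subst (length ds <_) ∣r∣≡n ∣ds∣<∣r∣) (minimal ds ds-root))
    where
    module ev = Hom (evalAt φ x)
    r[x]≈0 : ev.⟦ r ⟧ M.≈ M.0#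
    r[x]≈0 = begin
      ev.⟦ r ⟧                                          ≈⟨ M.+-identityˡ _ ⟨
      M.0# M.+ ev.⟦ r ⟧                                 ≈⟨ M.+-congʳ (M.trans (ev.*-homo (K[X].monic cs) q) (M.trans (M.*-congʳ root) (M.zeroˡ _))) ⟨
      ev.⟦ K[X].monic cs K[X].*ₚ q ⟧ M.+ ev.⟦ r ⟧       ≈⟨ ev.+-homo (K[X].monic cs K[X].*ₚ q) r ⟨
      ev.⟦ K[X].monic cs K[X].*ₚ q K[X].+ₚ r ⟧          ≈⟨ ev.⟦⟧-cong e ⟨
      ev.⟦ f ⟧                                          ≈⟨ f[x]≈0 ⟩
      M.0#                                              ∎
      where open SetoidReasoning M.setoid
    ds-root : x IsRootOf K[X].monic ds
    ds-root = FieldProperties.cancel-zero M-isField {⟦ c ⟧}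
      (c≉0 ∘ HomProperties.kernel-trivial φ K-isField (IsField.nontrivial M-isField) dec)
      (begin
        ⟦ c ⟧ M.* ev.⟦ K[X].monic ds ⟧                      ≈⟨ M.*-congʳ (evalAt-const c x) ⟨
        ev.⟦ c ∷ [] ⟧ M.* ev.⟦ K[X].monic ds ⟧              ≈⟨ ev.*-homo (c ∷ []) (K[X].monic ds) ⟨
        ev.⟦ (c ∷ []) K[X].*ₚ K[X].monic ds ⟧               ≈⟨ ev.⟦⟧-cong (K[X].trans (K[X].+-congˡ {K[X].scale c (K[X].monic ds)} K[X].X·[]) (K[X].+-identityʳ _)) ⟩
        ev.⟦ K[X].scale c (K[X].monic ds) ⟧                 ≈⟨ ev.⟦⟧-cong r≋ ⟨
        ev.⟦ r ⟧                                            ≈⟨ r[x]≈0 ⟩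
        M.0#                                                ∎)
      where open SetoidReasoning M.setoid

  minimal-exists : ∀ {x} cs → x IsRootOf K[X].monic cs → ∃[ ds ] IsMinimalPolynomial x ds
  minimal-exists {x} cs = least-length dec (λ cs → x IsRootOf K[X].monic cs) (length cs) cs ℕ.≤-refl

  minimal-nonconstant : ∀ {x} → ¬ IsMinimalPolynomial x []
  minimal-nonconstant {x} (root , _) =
    IsField.nontrivial M-isField (M.trans (M.sym 1#-homo) (M.trans (M.sym (evalAt-const K.1# x)) root))

-- Galois extensions

constʰ : ∀ {a} (R : CommutativeRing a a) → Hom R (PolynomialRing.polynomialRing R)
constʰ R = record
  { ⟦_⟧ = _∷ []
  ; isRingHomomorphism = mkIsRingHomomorphism (_∷ [])
      (λ e → ∷-cong e P.refl) (λ c d → P.refl)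
      (λ c d → ∷-cong (sym (+-identityʳ (c * d))) P.refl)
      X·[] P.refl (λ c → P.refl)
  }
  where
  open CommutativeRing R
  open PolynomialRing R
  module P = CommutativeRing polynomialRing

map-injective : ∀ {a} {K M : CommutativeRing a a} (φ : Hom K M) →
  let module K = CommutativeRing K
      module M = CommutativeRing M
      module K[X] = PolynomialRing K
      module M[X] = PolynomialRing M
      open Hom φ in
  (∀ {x y} → ⟦ x ⟧ M.≈ ⟦ y ⟧ → x K.≈ y) →
  ∀ f g → List.map ⟦_⟧ f M[X].≋ₚ List.map ⟦_⟧ g → f K[X].≋ₚ g
map-injective {K = K} {M} φ injective f g e = K[X].pointwise λ n →
  injective (M.trans (M.sym (coeff-map f n)) (M.trans (M[X].at e n) (coeff-map g n)))
  where
  module M = CommutativeRing M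
  module K[X] = PolynomialRing K
  module M[X] = PolynomialRing M
  open MapPolynomial φ using (coeff-map)

module _ {a} {K L M : CommutativeRing a a} (φ : Hom K L) (ψ : Hom L M) (χ : Hom K M)
  (ψφ≈χ : ∀ c → CommutativeRing._≈_ M (Hom.⟦_⟧ ψ (Hom.⟦_⟧ φ c)) (Hom.⟦_⟧ χ c))
  (L-isField : IsField L) (M-isField : IsField M) (dec : ExcludedMiddle a) where
  private
    module M = CommutativeRing M
    module K[X] = PolynomialsOver K
    module L[X] = PolynomialsOver L
    module M[X] = PolynomialsOver M
    module φ = MapPolynomial φ
    module ψ = MapPolynomial ψ
    module χ = MapPolynomial χ

  -- Read over L, the polynomial from K still kills `x`, so a minimal polynomial over L exists and
  -- divides it. The cofactor is returned because separability and splitting both pass to divisors.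
  minimal-over-intermediate : ∀ {x} cs → Extension._IsRootOf_ χ x (K[X].monic cs) →
    ∃[ ds ] ∃[ q ] Extension.IsMinimalPolynomial ψ x ds × φ.mapₚ (K[X].monic cs) L[X].≋ₚ L[X].monic ds L[X].*ₚ q
  minimal-over-intermediate {x} cs root =
    let ds , minimal = minimal-exists (φ.mapₚ cs)
          (M.trans (Hom.⟦⟧-cong (evalAt ψ x) (L[X].sym (φ.map-monic cs))) root′)
        q , e = minimal-divides {x} {ds} minimal (φ.mapₚ (K[X].monic cs)) root′
    in ds , q , minimal , e
    where
    open MinimalPolynomial ψ L-isField M-isField dec
    root′ : Extension._IsRootOf_ ψ x (φ.mapₚ (K[X].monic cs))
    root′ = M.trans (evalAt-map φ ψ χ ψφ≈χ x (K[X].monic cs)) root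

  galois-over-intermediate : Extension.IsGalois χ → Extension.IsGalois ψ
  galois-over-intermediate (separable , normal) = separable′ , normal′
    where
    separable′ : Extension.IsSeparable ψ
    separable′ x with cs , (root , _) , sep ← separable x
      with ds , q , minimal , e ← minimal-over-intermediate {x} cs root =
      ds , minimal , Derivative.separable-divisor L (φ.mapₚ (K[X].monic cs)) (L[X].monic ds) q e
        (map-separable φ (K[X].monic cs) sep)
    normal′ : Extension.IsNormal ψ
    normal′ x with cs , (root , _) , rs , splits ← normal x
      with ds , q , minimal , e ← minimal-over-intermediate {x} cs root =
      let ss , e′ = FieldPolynomials.split-divisor M-isField dec (ψ.mapₚ ds) (ψ.mapₚ q) rs (begin
            M[X].monic (ψ.mapₚ ds) M[X].*ₚ ψ.mapₚ q    ≈⟨ M[X].*ₚ-congʳ (ψ.mapₚ q) (ψ.map-monic ds) ⟨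
            ψ.mapₚ (L[X].monic ds) M[X].*ₚ ψ.mapₚ q    ≈⟨ ψ.map-* (L[X].monic ds) q ⟨
            ψ.mapₚ (L[X].monic ds L[X].*ₚ q)           ≈⟨ ψ.map-cong e ⟨
            ψ.mapₚ (φ.mapₚ (K[X].monic cs))            ≈⟨ map-map-≋ φ ψ χ ψφ≈χ (K[X].monic cs) ⟩
            χ.mapₚ (K[X].monic cs)                     ≈⟨ M[X].pointwise splits ⟩
            M[X].linearFactors rs                      ∎)
      in ds , minimal , ss , M[X].at (M[X].trans (ψ.map-monic ds) e′)
      where open SetoidReasoning M[X].setoid

module _ {a} {K M M′ : CommutativeRing a a} (φ : Hom K M) (ι : Hom M M′) (φ′ : Hom K M′) where
  private
    module M = CommutativeRing M
    module M′ = CommutativeRing M′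
    module K[X] = Polynomial K
    module M[X] = PolynomialsOver M
    module M′[X] = PolynomialsOver M′
    module E = Extension φ
    module E′ = Extension φ′
    module ι = Hom ι

  minimal-reflect : (∀ c → ι.⟦ Hom.⟦_⟧ φ c ⟧ M′.≈ Hom.⟦_⟧ φ′ c) →
    (∀ {x y} → ι.⟦ x ⟧ M′.≈ ι.⟦ y ⟧ → x M.≈ y) →
    ∀ {x cs} → E′.IsMinimalPolynomial ι.⟦ x ⟧ cs → E.IsMinimalPolynomial x cs
  minimal-reflect ιφ≈φ′ injective {x} {cs} (root , minimal) =
      injective (M′.trans (evalAt-∘ ι φ φ′ ιφ≈φ′ x (K[X].monic cs)) (M′.trans root (M′.sym ι.0#-homo)))
    , λ ds ds-root → minimal ds (M′.trans (M′.sym (evalAt-∘ ι φ φ′ ιφ≈φ′ x (K[X].monic ds)))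
        (M′.trans (ι.⟦⟧-cong ds-root) ι.0#-homo))

  -- Minimal polynomials are unchanged by an injection over K, so only the roots have to be found
  -- again in M. This serves two purposes: transport along an isomorphism, where surjectivity
  -- supplies the roots, and descent to a subextension stable under conjugation.
  galois-reflect : (∀ c → ι.⟦ Hom.⟦_⟧ φ c ⟧ M′.≈ Hom.⟦_⟧ φ′ c) →
    (∀ {x y} → ι.⟦ x ⟧ M′.≈ ι.⟦ y ⟧ → x M.≈ y) →
    (∀ x cs rs → E′.IsMinimalPolynomial ι.⟦ x ⟧ cs → E′.SplitsInto (K[X].monic cs) rs →
      All (λ r → ∃[ t ] ι.⟦ t ⟧ M′.≈ r) rs) →
    E′.IsGalois → E.IsGalois
  galois-reflect ιφ≈φ′ injective roots-in-M (separable , normal) = separable′ , normal′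
    where
    reflect : ∀ {x cs} → E′.IsMinimalPolynomial ι.⟦ x ⟧ cs → E.IsMinimalPolynomial x cs
    reflect {x} {cs} = minimal-reflect ιφ≈φ′ injective {x} {cs}
    separable′ : E.IsSeparable
    separable′ x with cs , minimal , sep ← separable ι.⟦ x ⟧ = cs , reflect {x} {cs} minimal , sep
    lift-roots : ∀ {rs} → All (λ r → ∃[ t ] ι.⟦ t ⟧ M′.≈ r) rs →
      ∃[ ts ] M′[X].linearFactors (List.map ι.⟦_⟧ ts) M′[X].≋ₚ M′[X].linearFactors rs
    lift-roots [] = [] , M′[X].refl
    lift-roots {r ∷ rs} ((t , e) ∷ es) with ts , e′ ← lift-roots es =
      t ∷ ts , M′[X].*-cong (M′[X].∷-cong (M′.-‿cong e) (M′[X].refl {M′.1# ∷ []})) e′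
    normal′ : E.IsNormal
    normal′ x with cs , minimal , rs , splits ← normal ι.⟦ x ⟧
      with ts , e ← lift-roots (roots-in-M x cs rs minimal splits) =
      cs , reflect {x} {cs} minimal , ts ,
      M[X].at (map-injective ι injective (List.map (Hom.⟦_⟧ φ) (K[X].monic cs)) (M[X].linearFactors ts)
        (M′[X].trans (map-map-≋ φ ι φ′ ιφ≈φ′ (K[X].monic cs))
        (M′[X].trans (M′[X].pointwise splits)
        (M′[X].trans (M′[X].sym e) (M′[X].sym (MapPolynomial.map-linearFactors ι ts))))))

module FieldExtension {a} {K F : CommutativeRing a a} (φ : Hom K F)
  (K-isField : IsField K) (F-isField : IsField F) (dec : ExcludedMiddle a) where
  private
    module K = CommutativeRing K
    module F = CommutativeRing F
    module K[X] = PolynomialsOver K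
    module F[X] = PolynomialsOver F
    module φ = Hom φ
  open Extension φ
  open MinimalPolynomial φ K-isField F-isField dec

  eval-split : ∀ cs rs → SplitsInto (K[X].monic cs) rs →
    ∀ x → Hom.⟦_⟧ (evalAt φ x) (K[X].monic cs) F.≈ F[X].eval (F[X].linearFactors rs) x
  eval-split cs rs splits x = Evaluation.eval-cong F {List.map φ.⟦_⟧ (K[X].monic cs)} {F[X].linearFactors rs} x (F[X].pointwise splits)

  root-among : ∀ {x} cs rs → SplitsInto (K[X].monic cs) rs → x IsRootOf K[X].monic cs → Any (x F.≈_) rs
  root-among {x} cs rs splits root = FieldPolynomials.split-root F-isField dec rs x
    (F.trans (F.sym (eval-split cs rs splits x)) root)

  among-roots : ∀ cs rs → SplitsInto (K[X].monic cs) rs → All (_IsRootOf K[X].monic cs) rs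
  among-roots cs rs splits = All.map (λ {r} e → F.trans (eval-split cs rs splits r) e)
    (FieldPolynomials.root-split F-isField dec rs)

  hom-root : ∀ {N} (ψ : Hom N F) (κ : Hom K N) → (∀ c → Hom.⟦_⟧ ψ (Hom.⟦_⟧ κ c) F.≈ φ.⟦ c ⟧) →
    ∀ {x f} → CommutativeRing._≈_ N (Hom.⟦_⟧ (evalAt κ x) f) (CommutativeRing.0# N) →
    Hom.⟦_⟧ ψ x IsRootOf f
  hom-root ψ κ ψκ≈φ {x} {f} root = F.trans (F.sym (evalAt-∘ ψ κ φ ψκ≈φ x f))
    (F.trans (Hom.⟦⟧-cong ψ root) (Hom.0#-homo ψ))

  -- The orbit y, h y, h² y, … stays among the finitely many roots of the
  -- minimal polynomial of y, so injectivity of h makes it return to y.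
  endomorphism-surjective : IsNormal → (h : Hom F F) → (∀ c → Hom.⟦_⟧ h φ.⟦ c ⟧ F.≈ φ.⟦ c ⟧) →
    ∀ y → ∃[ x ] Hom.⟦_⟧ h x F.≈ y
  endomorphism-surjective normal h fixes y
    with cs , (root , _) , rs , splits ← normal y =
    let i , j , i<j , same-index = pigeonhole (ℕ.n<1+n (length rs)) index
    in returns (toℕ i) (toℕ j) i<j (F.trans (at-index i)
         (F.trans (F.reflexive (≡.cong (List.lookup rs) same-index)) (F.sym (at-index j))))
    where
    iterate : ℕ → F.Carrier
    iterate zero    = y
    iterate (suc n) = Hom.⟦_⟧ h (iterate n)
    iterate-root : ∀ n → iterate n IsRootOf K[X].monic cs
    iterate-root zero    = root
    iterate-root (suc n) = hom-root h φ fixes {iterate n} {K[X].monic cs} (iterate-root n)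
    among : ∀ n → Any (iterate n F.≈_) rs
    among n = root-among {iterate n} cs rs splits (iterate-root n)
    index : Fin (suc (length rs)) → Fin (length rs)
    index i = Any.index (among (toℕ i))
    at-index : ∀ i → iterate (toℕ i) F.≈ List.lookup rs (index i)
    at-index i = lookup-index (among (toℕ i))
      where
      lookup-index : ∀ {x rs} (m : Any (x F.≈_) rs) → x F.≈ List.lookup rs (Any.index m)
      lookup-index (here e)  = e
      lookup-index (there m) = lookup-index m
    returns : ∀ m n → m < n → iterate m F.≈ iterate n → ∃[ x ] Hom.⟦_⟧ h x F.≈ y
    returns zero    (suc n) _       e = iterate n , F.sym e
    returns (suc m) (suc n) (s≤s m<n) e = returns m n m<n
      (HomProperties.field-hom-injective h F-isField (IsField.nontrivial F-isField) dec e)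

  automorphism : IsNormal → (h : Hom F F) → (∀ c → Hom.⟦_⟧ h φ.⟦ c ⟧ F.≈ φ.⟦ c ⟧) → Automorphism
  automorphism normal h fixes = record
    { fun = Hom.⟦_⟧ h
    ; isRingIsomorphism = record
      { isRingMonomorphism = record
        { isRingHomomorphism = Hom.isRingHomomorphism h
        ; injective = HomProperties.field-hom-injective h F-isField (IsField.nontrivial F-isField) dec
        }
      ; surjective = λ y → let x , e = endomorphism-surjective normal h fixes y in
          x , λ z≈x → F.trans (Hom.⟦⟧-cong h z≈x) e
      }
    ; fixes = fixes
    }

  -- A zero constant term allows cancelling `y` from the equation. Once the relation is c + y q(y) =
  -- 0 with c ≠ 0, the inverse of `y` is -c⁻¹ q(y).
  inverse-polynomial : ∀ {y z} cs → y F.* z F.≈ F.1# → y IsRootOf K[X].monic cs →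
    ∃[ f ] Hom.⟦_⟧ (evalAt φ y) f F.≈ z
  inverse-polynomial {y} {z} [] yz≈1 root =
    ⊥-elim (IsField.nontrivial F-isField (F.trans (F.sym (Hom.1#-homo (evalAt φ y))) root))
  inverse-polynomial {y} {z} (c ∷ cs) yz≈1 root with dec {c K.≈ K.0#}
  ... | yes c≈0 = inverse-polynomial {y} {z} cs yz≈1
        (FieldProperties.cancel-zero F-isField (FieldProperties.unit≉0 F-isField yz≈1)
          (F.trans (F.sym (F.trans (F.+-congʳ (F.trans (φ.⟦⟧-cong c≈0) φ.0#-homo)) (F.+-identityˡ _))) root))
  ... | no c≉0 with c⁻¹ , cc⁻¹≈1 ← IsField.invertible K-isField c≉0 =
        (K.- c⁻¹ ∷ []) K[X].*ₚ K[X].monic cs , (begin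
        ev.⟦ (K.- c⁻¹ ∷ []) K[X].*ₚ K[X].monic cs ⟧  ≈⟨ ev.*-homo (K.- c⁻¹ ∷ []) (K[X].monic cs) ⟩
        ev.⟦ K.- c⁻¹ ∷ [] ⟧ F.* q                    ≈⟨ F.*-congʳ (F.trans (MapPolynomial.evalAt-const φ (K.- c⁻¹) y) (φ.-‿homo c⁻¹)) ⟩
        (F.- φ.⟦ c⁻¹ ⟧) F.* q                        ≈⟨ F.*-congˡ (F.trans (F.*-congʳ yz≈1) (F.*-identityˡ q)) ⟨
        (F.- φ.⟦ c⁻¹ ⟧) F.* (y F.* z F.* q)          ≈⟨ -‿distribˡ-* φ.⟦ c⁻¹ ⟧ (y F.* z F.* q) ⟨
        F.- (φ.⟦ c⁻¹ ⟧ F.* (y F.* z F.* q))          ≈⟨ F.-‿cong (solve 4 (λ d y z q → d :* (y :* z :* q) := d :* z :* (y :* q)) F.refl φ.⟦ c⁻¹ ⟧ y z q) ⟩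
        F.- (φ.⟦ c⁻¹ ⟧ F.* z F.* (y F.* q))          ≈⟨ -‿distribʳ-* (φ.⟦ c⁻¹ ⟧ F.* z) (y F.* q) ⟩
        φ.⟦ c⁻¹ ⟧ F.* z F.* (F.- (y F.* q))          ≈⟨ F.*-congˡ (GroupProperties.inverseˡ-unique F.+-group φ.⟦ c ⟧ (y F.* q) root) ⟨
        φ.⟦ c⁻¹ ⟧ F.* z F.* φ.⟦ c ⟧                  ≈⟨ solve 3 (λ d z c → d :* z :* c := c :* d :* z) F.refl φ.⟦ c⁻¹ ⟧ z φ.⟦ c ⟧ ⟩
        φ.⟦ c ⟧ F.* φ.⟦ c⁻¹ ⟧ F.* z                  ≈⟨ F.*-congʳ (F.trans (F.sym (φ.*-homo c c⁻¹)) (F.trans (φ.⟦⟧-cong cc⁻¹≈1) φ.1#-homo)) ⟩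
        F.1# F.* z                                   ≈⟨ F.*-identityˡ z ⟩
        z                                            ∎)
      where
      open SetoidReasoning F.setoid
      open SemiringSolver F.commutativeSemiring using (solve; _:=_; _:*_)
      open RingProperties F.ring using (-‿distribˡ-*; -‿distribʳ-*)
      module ev = Hom (evalAt φ y)
      q : F.Carrier
      q = ev.⟦ K[X].monic cs ⟧

-- Subfields and extension of embeddings

module SubfieldProperties {a} (F : CommutativeRing a a) where
  open CommutativeRing F hiding (zero)
  open Subfields F
  open Subfield

  inclusion : (N : Subfield) → Hom ⌊ N ⌋ F
  inclusion N = record
    { ⟦_⟧ = proj₁
    ; isRingHomomorphism = mkIsRingHomomorphism proj₁ id (λ _ _ → refl) (λ _ _ → refl) refl refl (λ _ → refl)
    }

  subfield-isField : IsField F → (N : Subfield) → IsField ⌊ N ⌋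
  subfield-isField F-isField N = record
    { nontrivial = IsField.nontrivial F-isField
    ; invertible = λ { {x , p} x≉0 → let y , e = IsField.invertible F-isField x≉0 in (y , inv-closed N e p) , e }
    }

  sum-closed : ∀ (N : Subfield) {n} (f : Fin n → Carrier) → (∀ i → Mem N (f i)) → Mem N (sum +-rawMonoid f)
  sum-closed N {zero}  f p = 0-closed N
  sum-closed N {suc n} f p = +-closed N (p zero) (sum-closed N (f ∘ suc) (p ∘ suc))

  data Closure (S : Pred Carrier a) : Pred Carrier a where
    gen   : ∀ {x} → S x → Closure S x
    equal : ∀ {x y} → x ≈ y → Closure S x → Closure S y
    nil   : Closure S 0#
    one   : Closure S 1#
    plus  : ∀ {x y} → Closure S x → Closure S y → Closure S (x + y)
    times : ∀ {x y} → Closure S x → Closure S y → Closure S (x * y)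
    minus : ∀ {x} → Closure S x → Closure S (- x)
    inv   : ∀ {x y} → x * y ≈ 1# → Closure S x → Closure S y

  ⟨_⟩ : Pred Carrier a → Subfield
  ⟨ S ⟩ = record
    { Mem = Closure S ; resp = equal ; 0-closed = nil ; 1-closed = one ; +-closed = plus
    ; *-closed = times ; neg-closed = minus ; inv-closed = inv }

  ⟨⟩-least : ∀ {S} (N : Subfield) → (∀ {x} → S x → Mem N x) → ∀ {x} → Closure S x → Mem N x
  ⟨⟩-least N S⊆N (gen s)     = S⊆N s
  ⟨⟩-least N S⊆N (equal e p) = resp N e (⟨⟩-least N S⊆N p)
  ⟨⟩-least N S⊆N nil         = 0-closed N
  ⟨⟩-least N S⊆N one         = 1-closed N
  ⟨⟩-least N S⊆N (plus p q)  = +-closed N (⟨⟩-least N S⊆N p) (⟨⟩-least N S⊆N q)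
  ⟨⟩-least N S⊆N (times p q) = *-closed N (⟨⟩-least N S⊆N p) (⟨⟩-least N S⊆N q)
  ⟨⟩-least N S⊆N (minus p)   = neg-closed N (⟨⟩-least N S⊆N p)
  ⟨⟩-least N S⊆N (inv e p)   = inv-closed N e (⟨⟩-least N S⊆N p)

  flatten : (N : Subfield) → Subfields.Subfield ⌊ N ⌋ → Subfield
  flatten N M = record
    { Mem        = λ x → Σ[ p ∈ Mem N x ] M.Mem (x , p)
    ; resp       = λ e (p , q) → resp N e p , M.resp e q
    ; 0-closed   = 0-closed N , M.0-closed
    ; 1-closed   = 1-closed N , M.1-closed
    ; +-closed   = λ (p , q) (p′ , q′) → +-closed N p p′ , M.+-closed q q′
    ; *-closed   = λ (p , q) (p′ , q′) → *-closed N p p′ , M.*-closed q q′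
    ; neg-closed = λ (p , q) → neg-closed N p , M.neg-closed q
    ; inv-closed = λ xy≈1 (p , q) → inv-closed N xy≈1 p , M.inv-closed xy≈1 q
    }
    where module M = Subfields.Subfield M

  ∨-least : ∀ {K L N} → K ⊑ N → L ⊑ N → K ∨ L ⊑ N
  ∨-least {K} {L} {N} K⊑N L⊑N = mk⊑ go
    where
    go : ∀ {x} → Generated K L x → Mem N x
    go (left p)    = mem K⊑N p
    go (right p)   = mem L⊑N p
    go (equal e p) = resp N e (go p)
    go (plus p q)  = +-closed N (go p) (go q)
    go (times p q) = *-closed N (go p) (go q)
    go (minus p)   = neg-closed N (go p)
    go (inv e p)   = inv-closed N e (go p)

  -- Packaged as a subfield so that `⟨⟩-least` reduces "h maps a generated field into M" to a check
  -- on generators.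
  preimageSubfield : IsField F → (N M : Subfield) → Hom ⌊ N ⌋ F → Subfield
  preimageSubfield F-isField N M h = record
    { Mem        = λ x → Σ[ p ∈ Mem N x ] Mem M (h.⟦ x , p ⟧)
    ; resp       = λ e (p , q) → resp N e p , resp M (h.⟦⟧-cong e) q
    ; 0-closed   = 0-closed N , resp M (sym h.0#-homo) (0-closed M)
    ; 1-closed   = 1-closed N , resp M (sym h.1#-homo) (1-closed M)
    ; +-closed   = λ (p , q) (p′ , q′) → +-closed N p p′ , resp M (sym (h.+-homo _ _)) (+-closed M q q′)
    ; *-closed   = λ (p , q) (p′ , q′) → *-closed N p p′ , resp M (sym (h.*-homo _ _)) (*-closed M q q′)
    ; neg-closed = λ (p , q) → neg-closed N p , resp M (sym (h.-‿homo _)) (neg-closed M q)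
    ; inv-closed = λ e (p , q) → inv-closed N e p ,
        inv-closed M (trans (sym (h.*-homo _ _)) (trans (h.⟦⟧-cong e) h.1#-homo)) q
    }
    where module h = Hom h

module NormalExtension {a} {K F : CommutativeRing a a} (φ : Hom K F)
  (K-isField : IsField K) (F-isField : IsField F) (dec : ExcludedMiddle a)
  (normal : Extension.IsNormal φ) where
  private
    module K = CommutativeRing K
    module F = CommutativeRing F
    module K[X] = PolynomialsOver K
    module φ = Hom φ
  open Extension φ
  open MinimalPolynomial φ K-isField F-isField dec
  open FieldExtension φ K-isField F-isField dec
  open Subfields F using (Subfield; ⌊_⌋)
  open Subfield
  open SubfieldProperties F
  open SetoidReasoning F.setoid

  -- Replaces quotient rings: if the kernel of `α` lies in that of `β`, then β ∘ α⁻¹ is well defined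
  -- on α(A). With A a polynomial ring and two evaluations this is the familiar isomorphism between
  -- simple extensions.
  module Factor {A : CommutativeRing a a} (α β : Hom A F) (κ : Hom K A)
    (ακ≈φ : ∀ c → Hom.⟦_⟧ α (Hom.⟦_⟧ κ c) F.≈ φ.⟦ c ⟧)
    (kernel : ∀ t → Hom.⟦_⟧ α t F.≈ F.0# → Hom.⟦_⟧ β t F.≈ F.0#) where
    private
      module A = CommutativeRing A
      module α = Hom α
      module β = Hom β

    -- The subring α(A) is closed under inverses because F is algebraic over K.
    image : Subfield
    image = record
      { Mem        = λ x → ∃[ t ] α.⟦ t ⟧ F.≈ x
      ; resp       = λ e (t , p) → t , F.trans p e
      ; 0-closed   = A.0# , α.0#-homo
      ; 1-closed   = A.1# , α.1#-homo
      ; +-closed   = λ (s , p) (t , q) → s A.+ t , F.trans (α.+-homo s t) (F.+-cong p q)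
      ; *-closed   = λ (s , p) (t , q) → s A.* t , F.trans (α.*-homo s t) (F.*-cong p q)
      ; neg-closed = λ (t , p) → A.- t , F.trans (α.-‿homo t) (F.-‿cong p)
      ; inv-closed = λ {x} {y} xy≈1 (t , p) →
          let cs , (root , _) , _ = normal x
              f , e = inverse-polynomial {x} {y} cs xy≈1 root
          in Hom.⟦_⟧ (evalAt κ t) f , F.trans (evalAt-∘ α κ φ ακ≈φ t f)
               (F.trans (MapPolynomial.evalAt-cong φ f p) e)
      }

    well-defined : ∀ s t → α.⟦ s ⟧ F.≈ α.⟦ t ⟧ → β.⟦ s ⟧ F.≈ β.⟦ t ⟧
    well-defined s t e = GroupProperties.x∙y⁻¹≈ε⇒x≈y F.+-group _ _
      (F.trans (F.sym (HomProperties.-‿-homo β s t)) (kernel (s A.- t)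
        (F.trans (HomProperties.-‿-homo α s t) (GroupProperties.x≈y⇒x∙y⁻¹≈ε F.+-group e))))

    -- A preimage under `α` is read off the proof of membership; `well-defined` makes the value
    -- independent of that proof.
    factor : Hom ⌊ image ⌋ F
    factor = record
      { ⟦_⟧ = λ (_ , t , _) → β.⟦ t ⟧
      ; isRingHomomorphism = mkIsRingHomomorphism (λ (_ , t , _) → β.⟦ t ⟧)
          (λ { {_ , s , p} {_ , t , q} e → well-defined s t (F.trans p (F.trans e (F.sym q))) })
          (λ (_ , s , _) (_ , t , _) → β.+-homo s t)
          (λ (_ , s , _) (_ , t , _) → β.*-homo s t)
          β.0#-homo β.1#-homo (λ (_ , t , _) → β.-‿homo t)
      }

    factor-value : ∀ {x} (m : Mem image x) t → α.⟦ t ⟧ F.≈ x → Hom.⟦_⟧ factor (x , m) F.≈ β.⟦ t ⟧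
    factor-value (s , p) t q = well-defined s t (F.trans p (F.sym q))

  record PartialHom : Set (lsuc a) where
    field
      dom   : Subfield
      base  : ∀ c → Mem dom φ.⟦ c ⟧
      hom   : Hom ⌊ dom ⌋ F
      fixes : ∀ c (m : Mem dom φ.⟦ c ⟧) → Hom.⟦_⟧ hom (φ.⟦ c ⟧ , m) F.≈ φ.⟦ c ⟧

    baseʰ : Hom K ⌊ dom ⌋
    baseʰ = record
      { ⟦_⟧ = λ c → φ.⟦ c ⟧ , base c
      ; isRingHomomorphism = mkIsRingHomomorphism (λ c → φ.⟦ c ⟧ , base c)
          φ.⟦⟧-cong φ.+-homo φ.*-homo φ.0#-homo φ.1#-homo φ.-‿homo
      }

  open PartialHom

  infix 4 _⟶[_]_
  _⟶[_]_ : F.Carrier → PartialHom → F.Carrier → Set a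
  x ⟶[ ψ ] y = Σ[ m ∈ Mem (dom ψ) x ] Hom.⟦_⟧ (hom ψ) (x , m) F.≈ y

  factorPartial : ∀ {A} (α β : Hom A F) (κ : Hom K A)
    (ακ≈φ : ∀ c → Hom.⟦_⟧ α (Hom.⟦_⟧ κ c) F.≈ φ.⟦ c ⟧) →
    (∀ c → Hom.⟦_⟧ β (Hom.⟦_⟧ κ c) F.≈ φ.⟦ c ⟧) →
    (∀ t → Hom.⟦_⟧ α t F.≈ F.0# → Hom.⟦_⟧ β t F.≈ F.0#) →
    Σ[ ψ ∈ PartialHom ] (∀ t {x y} → Hom.⟦_⟧ α t F.≈ x → Hom.⟦_⟧ β t F.≈ y → x ⟶[ ψ ] y)
  factorPartial α β κ ακ≈φ βκ≈φ kernel =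
      record { dom = image ; base = λ c → Hom.⟦_⟧ κ c , ακ≈φ c ; hom = factor
             ; fixes = λ c m → F.trans (factor-value m (Hom.⟦_⟧ κ c) (ακ≈φ c)) (βκ≈φ c) }
    , λ t p q → (t , p) , q
    where open Factor α β κ ακ≈φ kernel

  abstract
    -- A polynomial killing `x` is a multiple of the minimal polynomial, hence kills `y`; so
    -- evaluation at `y` factors through evaluation at `x`.
    root-evaluation : ∀ {x y cs} → IsMinimalPolynomial x cs → y IsRootOf K[X].monic cs →
      Σ[ ψ ∈ PartialHom ] x ⟶[ ψ ] y
    root-evaluation {x} {y} {cs} minimal root =
      let ψ , value = factorPartial (evalAt φ x) (evalAt φ y) (constʰ K)
            (λ c → MapPolynomial.evalAt-const φ c x) (λ c → MapPolynomial.evalAt-const φ c y) kernel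
      in ψ , value (K.0# ∷ K.1# ∷ []) (MapPolynomial.evalAt-X φ x) (MapPolynomial.evalAt-X φ y)
      where
      kernel : ∀ f → x IsRootOf f → y IsRootOf f
      kernel f f[x]≈0 with q , e ← minimal-divides {x} {cs} minimal f f[x]≈0 =
        F.trans (ev.⟦⟧-cong e) (F.trans (ev.*-homo (K[X].monic cs) q) (F.trans (F.*-congʳ root) (F.zeroˡ _)))
        where module ev = Hom (evalAt φ y)

  infix 4 _≼_
  _≼_ : PartialHom → PartialHom → Set a
  ψ ≼ ψ′ = ∀ {x y} → x ⟶[ ψ ] y → x ⟶[ ψ′ ] y

  abstract
    -- The minimal polynomial of `r` over the domain of `ψ` divides the one over K. Applying `ψ` to
    -- coefficients leaves the latter unchanged, and it splits in F, so the image of the former has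
    -- a root `s`; then `r` is sent to `s`.
    extend : ∀ ψ r → Σ[ ψ′ ∈ PartialHom ] ψ ≼ ψ′ × Mem (dom ψ′) r
    extend ψ r with cs , (root , _) , rs , splits ← normal r
      with minimal-over-intermediate (baseʰ ψ) (inclusion (dom ψ)) φ (λ c → F.refl)
             (subfield-isField F-isField (dom ψ)) F-isField dec {r} cs root
    ... | ds , q , minimal , e = adjoin ds minimal e
      where
      module D[X] = PolynomialsOver ⌊ dom ψ ⌋
      module F[X] = PolynomialsOver F
      module base = MapPolynomial (baseʰ ψ)
      module ψ = MapPolynomial (hom ψ)
      D-isField : IsField ⌊ dom ψ ⌋
      D-isField = subfield-isField F-isField (dom ψ)
      base-≈ : ∀ c → Hom.⟦_⟧ (hom ψ) (Hom.⟦_⟧ (baseʰ ψ) c) F.≈ φ.⟦ c ⟧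
      base-≈ c = fixes ψ c (base ψ c)
      conjugate-root : ∀ ds → Extension.IsMinimalPolynomial (inclusion (dom ψ)) r ds → base.mapₚ (K[X].monic cs) D[X].≋ₚ D[X].monic ds D[X].*ₚ q →
        ∃[ s ] Extension._IsRootOf_ (hom ψ) s (D[X].monic ds)
      conjugate-root []       minimal e =
        ⊥-elim (MinimalPolynomial.minimal-nonconstant (inclusion (dom ψ)) D-isField F-isField dec {r} minimal)
      conjugate-root (d ∷ ds) minimal e =
        let s , e′ = FieldPolynomials.monic-divisor-root F-isField dec (Hom.⟦_⟧ (hom ψ) d) (ψ.mapₚ ds) (ψ.mapₚ q) rs
              (F[X].trans (F[X].*ₚ-congʳ (ψ.mapₚ q) (F[X].sym (ψ.map-monic (d ∷ ds))))
              (F[X].trans (F[X].sym (ψ.map-* (D[X].monic (d ∷ ds)) q))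
              (F[X].trans (ψ.map-cong (D[X].sym e))
              (F[X].trans (map-map-≋ (baseʰ ψ) (hom ψ) φ base-≈ (K[X].monic cs))
              (F[X].pointwise splits)))))
        in s , F.trans (Evaluation.eval-cong F s (ψ.map-monic (d ∷ ds))) e′
      adjoin : ∀ ds → Extension.IsMinimalPolynomial (inclusion (dom ψ)) r ds → base.mapₚ (K[X].monic cs) D[X].≋ₚ D[X].monic ds D[X].*ₚ q →
        Σ[ ψ′ ∈ PartialHom ] ψ ≼ ψ′ × Mem (dom ψ′) r
      adjoin ds minimal e with s , s-root ← conjugate-root ds minimal e =
        let ψ′ , value = factorPartial (evalAt (inclusion (dom ψ)) r) (evalAt (hom ψ) s) (constʰ ⌊ dom ψ ⌋ ∘ʰ baseʰ ψ)
              (λ c → MapPolynomial.evalAt-const (inclusion (dom ψ)) (Hom.⟦_⟧ (baseʰ ψ) c) r)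
              (λ c → F.trans (MapPolynomial.evalAt-const (hom ψ) (Hom.⟦_⟧ (baseʰ ψ) c) s) (base-≈ c))
              kernel
        in ψ′
         -- Constant polynomials show that the new map extends `ψ`; the polynomial X puts `r` into
         -- its domain.
         , (λ {x} (m , e) → value ((x , m) ∷ []) (MapPolynomial.evalAt-const (inclusion (dom ψ)) (x , m) r)
              (F.trans (MapPolynomial.evalAt-const (hom ψ) (x , m) s) e))
         , proj₁ (value (CommutativeRing.0# ⌊ dom ψ ⌋ ∷ CommutativeRing.1# ⌊ dom ψ ⌋ ∷ []) (MapPolynomial.evalAt-X (inclusion (dom ψ)) r) F.refl)
        where
        kernel : ∀ f → Hom.⟦_⟧ (evalAt (inclusion (dom ψ)) r) f F.≈ F.0# → Hom.⟦_⟧ (evalAt (hom ψ) s) f F.≈ F.0#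
        kernel f f[r]≈0 with p , e ← MinimalPolynomial.minimal-divides (inclusion (dom ψ)) D-isField F-isField dec {r} {ds} minimal f f[r]≈0 =
          F.trans (ev.⟦⟧-cong e) (F.trans (ev.*-homo (D[X].monic ds) p) (F.trans (F.*-congʳ s-root) (F.zeroˡ _)))
          where module ev = Hom (evalAt (hom ψ) s)

    extend-list : ∀ ψ rs → Σ[ ψ′ ∈ PartialHom ] ψ ≼ ψ′ × All (Mem (dom ψ′)) rs
    extend-list ψ []       = ψ , (λ m → m) , []
    extend-list ψ (r ∷ rs) =
      let ψ₁ , ψ≼ψ₁ , m = extend ψ r
          ψ₂ , ψ₁≼ψ₂ , ms = extend-list ψ₁ rs
      in ψ₂ , (λ {x} {y} x↦y → ψ₁≼ψ₂ {x} {y} (ψ≼ψ₁ {x} {y} x↦y)) , proj₁ (ψ₁≼ψ₂ {r} {Hom.⟦_⟧ (hom ψ₁) (r , m)} (m , F.refl)) ∷ ms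

    conjugation : ∀ {x y cs} → IsMinimalPolynomial x cs → y IsRootOf K[X].monic cs →
      ∀ rs → Σ[ ψ ∈ PartialHom ] x ⟶[ ψ ] y × All (Mem (dom ψ)) rs
    conjugation {x} {y} {cs} minimal root rs =
      let ψ , x↦y = root-evaluation {x} {y} {cs} minimal root
          ψ′ , ψ≼ψ′ , ms = extend-list ψ rs
      in ψ′ , ψ≼ψ′ {x} {y} x↦y , ms

  Generator : List F.Carrier → Pred F.Carrier a
  Generator rs x = (∃[ c ] φ.⟦ c ⟧ F.≈ x) ⊎ Any (x F.≈_) rs

  generator-mem : ∀ N {rs} → (∀ c → Mem N φ.⟦ c ⟧) → All (Mem N) rs → ∀ {x} → Generator rs x → Mem N x
  generator-mem N base rs∈ (inj₁ (c , e)) = resp N e (base c)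
  generator-mem N base rs∈ (inj₂ x∈rs)    = mem-any rs∈ x∈rs
    where
    mem-any : ∀ {rs x} → All (Mem N) rs → Any (x F.≈_) rs → Mem N x
    mem-any (p ∷ _) (here e)   = resp N (F.sym e) p
    mem-any (_ ∷ ps) (there m) = mem-any ps m

  Generates : List F.Carrier → Set a
  Generates rs = ∀ x → Mem ⟨ Generator rs ⟩ x

  module _ (rs : List F.Carrier) (generates : Generates rs) where

    -- The map x ↦ y is extended over the finite list of generators, after which its domain is all
    -- of F; normality makes the resulting endomorphism bijective.
    transitive-on-roots : ∀ {x y cs} → IsMinimalPolynomial x cs → y IsRootOf K[X].monic cs →
      Σ[ σ ∈ Automorphism ] Automorphism.fun σ x F.≈ y
    transitive-on-roots {x} {y} {cs} minimal root
      with ψ , (x∈ , ψx≈y) , rs∈ ← conjugation {x} {y} {cs} minimal root rs =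
      automorphism normal h (λ c → fixes ψ c _) , F.trans (Hom.⟦⟧-cong (hom ψ) {x , total x} {x , x∈} F.refl) ψx≈y
      where
      total : ∀ x → Mem (dom ψ) x
      total x = ⟨⟩-least (dom ψ) (generator-mem (dom ψ) (base ψ) rs∈) (generates x)
      h : Hom F F
      h = hom ψ ∘ʰ record
        { ⟦_⟧ = λ x → x , total x
        ; isRingHomomorphism = mkIsRingHomomorphism (λ x → x , total x) id
            (λ _ _ → F.refl) (λ _ _ → F.refl) F.refl F.refl (λ _ → F.refl)
        }

    -- In degree one the minimal polynomial c + X gives x = -c. In higher degree write it as (X - x)
    -- h: the factor h has a root y in F, some automorphism sends x to y, and as x is fixed, h(x) =
    -- 0. So x would be a multiple root of a separable polynomial.
    fixed⇒base : IsSeparable → ∀ x → (∀ σ → Automorphism.fun σ x F.≈ x) → ∃[ c ] φ.⟦ c ⟧ F.≈ x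
    fixed⇒base separable x fixed with cs , minimal , sep ← separable x = go cs minimal sep
      where
      module F[X] = PolynomialsOver F
      module φ[X] = MapPolynomial φ
      go : ∀ cs → IsMinimalPolynomial x cs → K[X].Separable (K[X].monic cs) → ∃[ c ] φ.⟦ c ⟧ F.≈ x
      go [] minimal sep = ⊥-elim (minimal-nonconstant {x} minimal)
      go (c ∷ []) (root , _) sep = K.- c , (begin
        φ.⟦ K.- c ⟧   ≈⟨ φ.-‿homo c ⟩
        F.- φ.⟦ c ⟧   ≈⟨ GroupProperties.inverseʳ-unique F.+-group φ.⟦ c ⟧ x (F.trans (F.+-congˡ x≈) root) ⟨
        x             ∎)
        where
        x≈ : x F.≈ x F.* Hom.⟦_⟧ (evalAt φ x) K[X].1ₚ
        x≈ = F.sym (F.trans (F.*-congˡ (Hom.1#-homo (evalAt φ x))) (F.*-identityʳ x))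
      go (c ∷ d ∷ cs) minimal@(root , _) sep
        -- Separability and normality each supply a minimal polynomial of `x`, as possibly different
        -- lists; divisibility of the second by the first links them.
        with cs₁ , (root₁ , _) , rs₁ , splits ← normal x
        with q , e ← minimal-divides {x} {c ∷ d ∷ cs} minimal (K[X].monic cs₁) root₁ =
        -- h divides the split polynomial with cofactor (X - x) q, because h (X - x) q = f q.
        let y , h[y]≈0 = FieldPolynomials.monic-divisor-root F-isField dec
              (F[X].eval (F[X].monic (φ[X].mapₚ (d ∷ cs))) x) (Monic.monic-quotient F x (φ[X].mapₚ cs)) (F[X].X- x F[X].*ₚ φ[X].mapₚ q) rs₁
              (F[X].trans (xy≈yx-assoc h (F[X].X- x) (φ[X].mapₚ q))
              (F[X].trans (F[X].*ₚ-congʳ (φ[X].mapₚ q) (F[X].sym f≋))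
              (F[X].trans (F[X].sym (φ[X].map-* f q))
              (F[X].trans (φ[X].map-cong (K[X].sym e))
              (F[X].pointwise splits)))))
            σ , σx≈y = transitive-on-roots {x} {y} {c ∷ d ∷ cs} minimal (F.trans (Evaluation.eval-cong F y f≋)
              (F.trans (Evaluation.eval-* F y (F[X].X- x) h) (F.trans (F.*-congˡ h[y]≈0) (F.zeroʳ _))))
        in ⊥-elim (Derivative.separable-simple-root F (IsField.nontrivial F-isField) (φ[X].mapₚ f) x h f≋
             (map-separable φ f sep)
             (F.trans (Evaluation.eval-congʳ F h (F.trans (F.sym (fixed σ)) σx≈y)) h[y]≈0))
        where
        open CommutativeSemigroupProperties F[X].*-commutativeSemigroup using () renaming (x∙yz≈yx∙z to xy≈yx-assoc)
        f = K[X].monic (c ∷ d ∷ cs)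
        hs = Monic.monic-quotient F x (φ[X].mapₚ (d ∷ cs))
        h = F[X].monic hs
        f≋ : φ[X].mapₚ f F[X].≋ₚ F[X].X- x F[X].*ₚ h
        f≋ = F[X].trans (φ[X].map-monic (c ∷ d ∷ cs)) (Monic.monic-factor-root F x φ.⟦ c ⟧ (φ[X].mapₚ (d ∷ cs))
          (F.trans (F.sym (Evaluation.eval-cong F x (φ[X].map-monic (c ∷ d ∷ cs)))) root))

-- Subextensions generated by full sets of conjugates

module GeneratedSubfield {a} {K F : CommutativeRing a a} (φ : Hom K F)
  (K-isField : IsField K) (F-isField : IsField F) (dec : ExcludedMiddle a)
  (galois : Extension.IsGalois φ) where
  private
    module F = CommutativeRing F
    module K[X] = Polynomial K
    module φ = Hom φ
  open Extension φ
  open FieldExtension φ K-isField F-isField dec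
  open Subfields F using (Subfield; ⌊_⌋)
  open Subfield
  open SubfieldProperties F
  open NormalExtension φ K-isField F-isField dec (proj₂ galois)
  open PartialHom

  ConjugateClosed : List F.Carrier → Set a
  ConjugateClosed rs = All (λ r → ∃[ cs ] r IsRootOf K[X].monic cs ×
    (∀ s → s IsRootOf K[X].monic cs → Any (s F.≈_) rs)) rs

  -- Closure under conjugation makes the generated field Galois. The last component records where
  -- each entry comes from, so that it can later be written as γ(eᵢ) with γ in Gal(Ê/k).
  conjugates : ∀ {n} (p : Fin n → F.Carrier) → ∃[ rs ] ConjugateClosed rs × (∀ i → Any (p i F.≈_) rs) ×
    All (λ r → ∃[ i ] ∃[ cs ] IsMinimalPolynomial (p i) cs × r IsRootOf K[X].monic cs) rs
  conjugates {zero}  p = [] , [] , (λ ()) , []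
  conjugates {suc n} p =
    let cs , minimal , rs , splits = proj₂ galois (p zero)
        ss , closed , covers , origin = conjugates (p ∘ suc)
        among = λ s → root-among {s} cs rs splits
        roots = among-roots cs rs splits
    in rs ++ ss
     , All.++⁺ (All.map (λ {r} root → cs , root , λ s root′ → Any.++⁺ˡ (among s root′)) roots)
               (All.map (λ (cs , root , conj) → cs , root , λ s root′ → Any.++⁺ʳ rs (conj s root′)) closed)
     , (λ { zero → Any.++⁺ˡ (among (p zero) (proj₁ minimal)) ; (suc i) → Any.++⁺ʳ rs (covers i) })
     , All.++⁺ (All.map (λ {r} root → zero , cs , minimal , root) roots)
               (All.map (λ (i , rest) → suc i , rest) origin)

  module _ (rs : List F.Carrier) (closed : ConjugateClosed rs) where
    private
      M : Subfield
      M = ⟨ Generator rs ⟩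

    generatedBase : Hom K ⌊ M ⌋
    generatedBase = record
      { ⟦_⟧ = λ c → φ.⟦ c ⟧ , gen (inj₁ (c , F.refl))
      ; isRingHomomorphism = mkIsRingHomomorphism (λ c → φ.⟦ c ⟧ , gen (inj₁ (c , F.refl)))
          φ.⟦⟧-cong φ.+-homo φ.*-homo φ.0#-homo φ.1#-homo φ.-‿homo
      }

    -- A partial embedding sending `x` to `s` and defined on all of `rs` maps each generator to one
    -- of its conjugates, which is again in `rs`; so it maps M into M.
    conjugate∈M : ∀ {x s cs} → Mem M x → IsMinimalPolynomial x cs → s IsRootOf K[X].monic cs → Mem M s
    conjugate∈M {x} {s} {cs} x∈M minimal root = stays (conjugation {x} {s} {cs} minimal root rs)
      where
      stays : Σ[ ψ ∈ PartialHom ] x ⟶[ ψ ] s × All (Mem (dom ψ)) rs → Mem M s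
      stays (ψ , (x∈ , ψx≈s) , rs∈) =
        let x∈′ , ψx∈M = ⟨⟩-least P (generator-mem P base∈P (rs∈P closed rs∈)) x∈M
        in resp M (F.trans (Hom.⟦⟧-cong (hom ψ) {x , x∈′} {x , x∈} F.refl) ψx≈s) ψx∈M
        where
        P : Subfield
        P = preimageSubfield F-isField (dom ψ) M (hom ψ)
        base∈P : ∀ c → Mem P φ.⟦ c ⟧
        base∈P c = base ψ c , resp M (F.sym (fixes ψ c (base ψ c))) (gen (inj₁ (c , F.refl)))
        rs∈P : ∀ {ss} → All (λ r → ∃[ cs ] r IsRootOf K[X].monic cs ×
          (∀ s → s IsRootOf K[X].monic cs → Any (s F.≈_) rs)) ss → All (Mem (dom ψ)) ss → All (Mem P) ss
        rs∈P [] [] = []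
        rs∈P {r ∷ _} ((cs , r-root , conj) ∷ cls) (m ∷ ms) =
          (m , gen (inj₂ (conj (Hom.⟦_⟧ (hom ψ) (r , m))
            (hom-root (hom ψ) (baseʰ ψ) (λ c → fixes ψ c (base ψ c)) {r , m} {K[X].monic cs}
              (F.trans (evalAt-∘ (inclusion (dom ψ)) (baseʰ ψ) φ (λ _ → F.refl) (r , m) (K[X].monic cs)) r-root)))))
          ∷ rs∈P cls ms

    generated-galois : Extension.IsGalois generatedBase
    generated-galois = galois-reflect generatedBase (inclusion M) φ (λ _ → F.refl) id
      (λ (x , x∈M) cs ss minimal splits → All.map (λ {s} root → (s , conjugate∈M {x} {s} {cs} x∈M minimal root) , F.refl)
        (among-roots cs ss splits))
      galois

-- Descent and interpolation

module Descent {a} {K F : CommutativeRing a a} (φ : Hom K F)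
  (F-isField : IsField F) (dec : ExcludedMiddle a)
  {S : Pred (Extension.Automorphism φ) a} (S-isSubgroup : Subset.IsSubgroup (Extension.Gal φ) S) where
  private
    module F = CommutativeRing F
    module Gal = Group (Extension.Gal φ)
  open Extension φ using (Automorphism)
  open Automorphism
  open Subset.IsSubgroup S-isSubgroup
  open Sums F
  open SetoidReasoning F.setoid
  open RingProperties F.ring using (-‿distribˡ-*; -0#≈0#)

  private
    homᵃ : Automorphism → Hom F F
    homᵃ σ = record { ⟦_⟧ = fun σ ; isRingHomomorphism = isRingHomomorphism σ }

    x-y+y : ∀ x y → y F.+ (x F.- y) F.≈ x
    x-y+y x y = F.trans (F.+-comm y _) (F.trans (F.+-assoc x _ y) (F.trans (F.+-congˡ (F.-‿inverseˡ y)) (F.+-identityʳ x)))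

    y+z≈x⇒z≈x-y : ∀ {x y z} → y F.+ z F.≈ x → z F.≈ x F.- y
    y+z≈x⇒z≈x-y {x} {y} {z} e = begin
      z                      ≈⟨ F.+-identityʳ z ⟨
      z F.+ F.0#             ≈⟨ F.+-congˡ (F.-‿inverseʳ y) ⟨
      z F.+ (y F.- y)        ≈⟨ F.+-assoc z y _ ⟨
      z F.+ y F.- y          ≈⟨ F.+-congʳ (F.trans (F.+-comm z y) e) ⟩
      x F.- y                ∎

    ∑-linear : ∀ {n} (w : F.Carrier) (l m e : Fin n → F.Carrier) →
      ∑ (λ i → (l i F.+ w F.* m i) F.* e i) F.≈ ∑ (λ i → l i F.* e i) F.+ w F.* ∑ (λ i → m i F.* e i)
    ∑-linear w l m e = begin
      ∑ (λ i → (l i F.+ w F.* m i) F.* e i)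
        ≈⟨ ∑-cong (λ i → (l i F.+ w F.* m i) F.* e i) (λ i → l i F.* e i F.+ w F.* (m i F.* e i))
             (λ i → F.trans (F.distribʳ (e i) (l i) _) (F.+-congˡ (F.*-assoc w (m i) (e i)))) ⟩
      ∑ (λ i → l i F.* e i F.+ w F.* (m i F.* e i))
        ≈⟨ ∑-+ (λ i → l i F.* e i) (λ i → w F.* (m i F.* e i)) ⟩
      ∑ (λ i → l i F.* e i) F.+ ∑ (λ i → w F.* (m i F.* e i))
        ≈⟨ F.+-congˡ (∑-*ˡ w (λ i → m i F.* e i)) ⟨
      ∑ (λ i → l i F.* e i) F.+ w F.* ∑ (λ i → m i F.* e i) ∎

  Fixed : Pred F.Carrier a
  Fixed x = ∀ {σ} → S σ → fun σ x F.≈ x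

  fixed-zero : Fixed F.0#
  fixed-zero {σ} _ = 0#-homo σ

  cons : ∀ {n} → F.Carrier → (Fin n → F.Carrier) → Fin (suc n) → F.Carrier
  cons x f zero    = x
  cons x f (suc i) = f i

  cons-fixed : ∀ {n} x (f : Fin n → F.Carrier) → Fixed x → (∀ i → Fixed (f i)) → ∀ i → Fixed (cons x f i)
  cons-fixed x f p q zero    = p
  cons-fixed x f p q (suc i) = q i

  -- Applying γ to the relation indexed by γ⁻¹σ conjugates the coefficients while restoring the
  -- terms indexed by σ.
  conjugate-relation : ∀ {n} (l e : Fin n → F.Carrier) x →
    (∀ σ → S σ → ∑ (λ i → l i F.* fun σ (e i)) F.≈ fun σ x) →
    ∀ γ → S γ → ∀ σ → S σ → ∑ (λ i → fun γ (l i) F.* fun σ (e i)) F.≈ fun σ x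
  conjugate-relation l e x relation γ γ∈S σ σ∈S = begin
    ∑ (λ i → fun γ (l i) F.* fun σ (e i))
      ≈⟨ ∑-cong (λ i → fun γ (l i) F.* fun σ (e i)) (λ i → fun γ (l i) F.* fun γ (fun τ (e i)))
           (λ i → F.*-congˡ (F.sym (cancel (e i)))) ⟩
    ∑ (λ i → fun γ (l i) F.* fun γ (fun τ (e i)))
      ≈⟨ HomProperties.combination-homo (homᵃ γ) l (λ i → fun τ (e i)) ⟨
    fun γ (∑ (λ i → l i F.* fun τ (e i)))
      ≈⟨ ⟦⟧-cong γ (relation τ (∙-closed {γ Gal.⁻¹} {σ} (⁻¹-closed {γ} γ∈S) σ∈S)) ⟩
    fun γ (fun τ x)
      ≈⟨ cancel x ⟩
    fun σ x ∎
    where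
    τ : Automorphism
    τ = γ Gal.⁻¹ Gal.∙ σ
    cancel : ∀ y → fun γ (fun τ y) F.≈ fun σ y
    cancel y = Gal.inverseʳ γ (fun σ y)

  -- If the head coefficient is moved by γ, subtracting from the relation a
  -- multiple of its difference with its γ-conjugate kills that coefficient.
  descent : ∀ {n} (l e : Fin n → F.Carrier) x →
    (∀ σ → S σ → ∑ (λ i → l i F.* fun σ (e i)) F.≈ fun σ x) →
    Σ[ m ∈ (Fin n → F.Carrier) ] (∀ i → Fixed (m i)) × ∑ (λ i → m i F.* e i) F.≈ x
  descent {zero} l e x relation = (λ ()) , (λ ()) , relation Gal.ε ε-closed
  descent {suc n} l e x relation with dec {∃[ γ ] S γ × ¬ fun γ (l zero) F.≈ l zero}
  ... | no ¬moved =
    -- A head coefficient fixed by S is kept, and its term moves to the right-hand side, which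
    -- remains the conjugate of a single element because that coefficient is fixed.
    let m , m-fixed , m≈ = descent (l ∘ suc) (e ∘ suc) (x F.- l₀ F.* e zero) tail-relation
    in cons l₀ m , cons-fixed l₀ m l₀-fixed m-fixed , F.trans (F.+-congˡ m≈) (x-y+y x _)
    where
    l₀ : F.Carrier
    l₀ = l zero
    l₀-fixed : Fixed l₀
    l₀-fixed {σ} σ∈S with dec {fun σ l₀ F.≈ l₀}
    ... | yes e = e
    ... | no ¬e = ⊥-elim (¬moved (σ , σ∈S , ¬e))
    tail-relation : ∀ σ → S σ → ∑ (λ i → l (suc i) F.* fun σ (e (suc i))) F.≈ fun σ (x F.- l₀ F.* e zero)
    tail-relation σ σ∈S = begin
      ∑ (λ i → l (suc i) F.* fun σ (e (suc i)))
        ≈⟨ y+z≈x⇒z≈x-y (relation σ σ∈S) ⟩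
      fun σ x F.- l₀ F.* fun σ (e zero)
        ≈⟨ F.+-congˡ (F.-‿cong (F.trans (*-homo σ l₀ (e zero)) (F.*-congʳ (l₀-fixed {σ} σ∈S)))) ⟨
      fun σ x F.- fun σ (l₀ F.* e zero)
        ≈⟨ HomProperties.-‿-homo (homᵃ σ) x (l₀ F.* e zero) ⟨
      fun σ (x F.- l₀ F.* e zero) ∎
  ... | yes (γ , γ∈S , γl₀≉l₀)
    with w , δw≈1 ← IsField.invertible F-isField (γl₀≉l₀ ∘ GroupProperties.x∙y⁻¹≈ε⇒x≈y F.+-group (fun γ (l zero)) (l zero)) =
    let m , m-fixed , m≈ = descent (l″ ∘ suc) (e ∘ suc) x tail-relation
    in cons F.0# m , cons-fixed F.0# m (λ {σ} → fixed-zero {σ}) m-fixed ,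
       F.trans (F.+-congʳ (F.zeroˡ (e zero))) (F.trans (F.+-identityˡ _) m≈)
    where
    l′ l″ : Fin (suc n) → F.Carrier
    l′ i = fun γ (l i) F.+ F.- F.1# F.* l i
    -- Here `w` inverts γ(l₀) - l₀, so `u` solves l₀ + u (γ(l₀) - l₀) = 0. The combination with
    -- coefficients `l′` is zero for every σ, so adding its multiple does not disturb the right-hand
    -- side.
    u : F.Carrier
    u = F.- (l zero F.* w)
    l″ i = l i F.+ u F.* l′ i
    l″₀≈0 : l″ zero F.≈ F.0#
    l″₀≈0 = begin
      l zero F.+ u F.* l′ zero
        ≈⟨ F.+-congˡ (F.*-congˡ (F.+-congˡ (RingProperties.-1*x≈-x F.ring (l zero)))) ⟩
      l zero F.+ u F.* (fun γ (l zero) F.- l zero)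
        ≈⟨ F.+-congˡ (F.sym (-‿distribˡ-* _ _)) ⟩
      l zero F.- l zero F.* w F.* (fun γ (l zero) F.- l zero)
        ≈⟨ F.+-congˡ (F.-‿cong (F.trans (F.*-assoc _ _ _) (F.trans (F.*-congˡ (F.trans (F.*-comm w _) δw≈1)) (F.*-identityʳ _)))) ⟩
      l zero F.- l zero
        ≈⟨ F.-‿inverseʳ _ ⟩
      F.0# ∎
    l′-relation : ∀ σ → S σ → ∑ (λ i → l′ i F.* fun σ (e i)) F.≈ F.0#
    l′-relation σ σ∈S = begin
      ∑ (λ i → l′ i F.* fun σ (e i))
        ≈⟨ ∑-linear (F.- F.1#) (λ i → fun γ (l i)) l (λ i → fun σ (e i)) ⟩
      ∑ (λ i → fun γ (l i) F.* fun σ (e i)) F.+ F.- F.1# F.* ∑ (λ i → l i F.* fun σ (e i))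
        ≈⟨ F.+-cong (conjugate-relation l e x relation γ γ∈S σ σ∈S)
             (F.trans (RingProperties.-1*x≈-x F.ring _) (F.-‿cong (relation σ σ∈S))) ⟩
      fun σ x F.- fun σ x
        ≈⟨ F.-‿inverseʳ _ ⟩
      F.0# ∎
    tail-relation : ∀ σ → S σ → ∑ (λ i → l″ (suc i) F.* fun σ (e (suc i))) F.≈ fun σ x
    tail-relation σ σ∈S = begin
      ∑ (λ i → l″ (suc i) F.* fun σ (e (suc i)))
        ≈⟨ F.+-identityˡ _ ⟨
      F.0# F.+ ∑ (λ i → l″ (suc i) F.* fun σ (e (suc i)))
        ≈⟨ F.+-congʳ (F.trans (F.*-congʳ l″₀≈0) (F.zeroˡ _)) ⟨
      ∑ (λ i → l″ i F.* fun σ (e i))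
        ≈⟨ ∑-linear u l l′ (λ i → fun σ (e i)) ⟩
      ∑ (λ i → l i F.* fun σ (e i)) F.+ u F.* ∑ (λ i → l′ i F.* fun σ (e i))
        ≈⟨ F.+-cong (relation σ σ∈S) (F.trans (F.*-congˡ (l′-relation σ σ∈S)) (F.zeroʳ u)) ⟩
      fun σ x F.+ F.0#
        ≈⟨ F.+-identityʳ _ ⟩
      fun σ x ∎

  Independent : ∀ {n} → (Fin n → F.Carrier) → Set a
  Independent {n} e = ∀ (c : Fin n → F.Carrier) → (∀ i → Fixed (c i)) → ∑ (λ i → c i F.* e i) F.≈ F.0# → ∀ i → c i F.≈ F.0#

  -- A zero head coefficient is dropped. A nonzero one expresses every σ(e₀) through the other σ(eᵢ)
  -- with coefficients independent of σ; `descent` makes those coefficients fixed, contradicting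
  -- independence over the fixed elements.
  independent-conjugates : ∀ {n} (e : Fin n → F.Carrier) → Independent e →
    ∀ (l : Fin n → F.Carrier) → (∀ σ → S σ → ∑ (λ i → l i F.* fun σ (e i)) F.≈ F.0#) → ∀ i → l i F.≈ F.0#
  independent-conjugates {zero} e independent l relation ()
  independent-conjugates {suc n} e independent l relation with dec {l zero F.≈ F.0#}
  ... | yes l₀≈0 = λ { zero → l₀≈0 ; (suc i) → independent-conjugates (e ∘ suc) tail-independent (l ∘ suc) tail-relation i }
    where
    tail-independent : Independent (e ∘ suc)
    tail-independent c c-fixed e′ i = independent (cons F.0# c) (cons-fixed F.0# c (λ {σ} → fixed-zero {σ}) c-fixed)
      (F.trans (F.+-congʳ (F.zeroˡ _)) (F.trans (F.+-identityˡ _) e′)) (suc i)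
    tail-relation : ∀ σ → S σ → ∑ (λ i → l (suc i) F.* fun σ (e (suc i))) F.≈ F.0#
    tail-relation σ σ∈S = F.trans (F.sym (F.trans (F.+-congʳ (F.trans (F.*-congʳ l₀≈0) (F.zeroˡ _))) (F.+-identityˡ _)))
      (relation σ σ∈S)
  ... | no l₀≉0 with w , l₀w≈1 ← IsField.invertible F-isField l₀≉0 =
    let c , c-fixed , c≈ = descent (λ i → F.- w F.* l (suc i)) (e ∘ suc) (e zero) head-relation
    in ⊥-elim (IsField.nontrivial F-isField (begin
      F.1#               ≈⟨ GroupProperties.⁻¹-involutive F.+-group F.1# ⟨
      -- The relation is -e₀ + Σ cᵢ eᵢ = 0; independence would force its head coefficient -1 to
      -- vanish.
      F.- (F.- F.1#)     ≈⟨ F.-‿cong (independent (cons (F.- F.1#) c)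
                              (cons-fixed (F.- F.1#) c (λ {σ} _ → F.trans (-‿homo σ F.1#) (F.-‿cong (1#-homo σ))) c-fixed)
                              (F.trans (F.+-cong (RingProperties.-1*x≈-x F.ring (e zero)) c≈) (F.-‿inverseˡ (e zero))) zero) ⟩
      F.- F.0#           ≈⟨ -0#≈0# ⟩
      F.0#               ∎))
    where
    head-relation : ∀ σ → S σ → ∑ (λ i → F.- w F.* l (suc i) F.* fun σ (e (suc i))) F.≈ fun σ (e zero)
    head-relation σ σ∈S = begin
      ∑ (λ i → F.- w F.* l (suc i) F.* fun σ (e (suc i)))
        ≈⟨ ∑-cong (λ i → F.- w F.* l (suc i) F.* fun σ (e (suc i))) (λ i → F.- w F.* (l (suc i) F.* fun σ (e (suc i))))
             (λ i → F.*-assoc _ _ _) ⟩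
      ∑ (λ i → F.- w F.* (l (suc i) F.* fun σ (e (suc i))))
        ≈⟨ ∑-*ˡ (F.- w) (λ i → l (suc i) F.* fun σ (e (suc i))) ⟨
      F.- w F.* ∑ (λ i → l (suc i) F.* fun σ (e (suc i)))
        ≈⟨ F.*-congˡ (GroupProperties.inverseʳ-unique F.+-group _ _ (relation σ σ∈S)) ⟩
      F.- w F.* F.- (l zero F.* fun σ (e zero))
        ≈⟨ F.trans (F.sym (-‿distribˡ-* w _)) (F.trans (F.-‿cong (F.sym (RingProperties.-‿distribʳ-* F.ring w _))) (GroupProperties.⁻¹-involutive F.+-group _)) ⟩
      w F.* (l zero F.* fun σ (e zero))
        ≈⟨ F.*-assoc w _ _ ⟨
      w F.* l zero F.* fun σ (e zero)
        ≈⟨ F.trans (F.*-congʳ (F.trans (F.*-comm w _) l₀w≈1)) (F.*-identityˡ _) ⟩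
      fun σ (e zero) ∎

-- For a finite set of K-automorphisms of F pairwise distinct on E, arbitrary
-- values can be interpolated by F-linear combinations of the maps
-- σ ↦ σ (e i), where e is a basis of E/K: these combinations are stable under
-- multiplication by σ ↦ σ x for x in E.
module Interpolation {a} {K E F : CommutativeRing a a} (κ : Hom K E) (j : Hom E F) (φ : Hom K F)
  (jκ≈φ : ∀ c → CommutativeRing._≈_ F (Hom.⟦_⟧ j (Hom.⟦_⟧ κ c)) (Hom.⟦_⟧ φ c))
  (K-isField : IsField K) (F-isField : IsField F) (dec : ExcludedMiddle a)
  {d : ℕ} (degree : Extension.HasDegree κ d) where
  private
    module K = CommutativeRing K
    module E = CommutativeRing E
    module F = CommutativeRing F
    module κ = Hom κ
    module j = Hom j
    module φ = Hom φ
  open Extension φ using (Automorphism)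
  open Automorphism
  open Sums F
  open SetoidReasoning F.setoid

  homᵃ : Automorphism → Hom F F
  homᵃ σ = record { ⟦_⟧ = fun σ ; isRingHomomorphism = isRingHomomorphism σ }

  basis : Fin d → E.Carrier
  basis = proj₁ degree

  e : Fin d → F.Carrier
  e i = j.⟦ basis i ⟧

  coordinates : E.Carrier → Fin d → K.Carrier
  coordinates x = proj₁ (proj₁ (proj₂ degree) x)

  expand : ∀ x → j.⟦ x ⟧ F.≈ ∑ (λ i → φ.⟦ coordinates x i ⟧ F.* e i)
  expand x = begin
    j.⟦ x ⟧
      ≈⟨ j.⟦⟧-cong (proj₂ (proj₁ (proj₂ degree) x)) ⟨
    j.⟦ sum E.+-rawMonoid (λ i → κ.⟦ coordinates x i ⟧ E.* basis i) ⟧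
      ≈⟨ HomProperties.combination-homo j (λ i → κ.⟦ coordinates x i ⟧) basis ⟩
    ∑ (λ i → j.⟦ κ.⟦ coordinates x i ⟧ ⟧ F.* e i)
      ≈⟨ ∑-cong (λ i → j.⟦ κ.⟦ coordinates x i ⟧ ⟧ F.* e i) (λ i → φ.⟦ coordinates x i ⟧ F.* e i)
           (λ i → F.*-congʳ (jκ≈φ (coordinates x i))) ⟩
    ∑ (λ i → φ.⟦ coordinates x i ⟧ F.* e i) ∎

  expand-conjugate : ∀ σ x → fun σ j.⟦ x ⟧ F.≈ ∑ (λ i → φ.⟦ coordinates x i ⟧ F.* fun σ (e i))
  expand-conjugate σ x = begin
    fun σ j.⟦ x ⟧
      ≈⟨ ⟦⟧-cong σ (expand x) ⟩
    fun σ (∑ (λ i → φ.⟦ coordinates x i ⟧ F.* e i))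
      ≈⟨ HomProperties.combination-homo (homᵃ σ) (λ i → φ.⟦ coordinates x i ⟧) e ⟩
    ∑ (λ i → fun σ φ.⟦ coordinates x i ⟧ F.* fun σ (e i))
      ≈⟨ ∑-cong (λ i → fun σ φ.⟦ coordinates x i ⟧ F.* fun σ (e i)) (λ i → φ.⟦ coordinates x i ⟧ F.* fun σ (e i))
           (λ i → F.*-congʳ (fixes σ (coordinates x i))) ⟩
    ∑ (λ i → φ.⟦ coordinates x i ⟧ F.* fun σ (e i)) ∎

  Agree : Automorphism → Automorphism → Set a
  Agree σ τ = ∀ x → fun σ j.⟦ x ⟧ F.≈ fun τ j.⟦ x ⟧

  agree-on-basis : ∀ σ τ → (∀ i → fun σ (e i) F.≈ fun τ (e i)) → Agree σ τ
  agree-on-basis σ τ p x = F.trans (expand-conjugate σ x)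
    (F.trans (∑-cong (λ i → φ.⟦ coordinates x i ⟧ F.* fun σ (e i)) (λ i → φ.⟦ coordinates x i ⟧ F.* fun τ (e i))
      (λ i → F.*-congˡ (p i))) (F.sym (expand-conjugate τ x)))

  record Combination : Set a where
    constructor combination
    field
      coefficient : Fin d → F.Carrier
    value : Automorphism → F.Carrier
    value σ = ∑ (λ i → coefficient i F.* fun σ (e i))
  open Combination

  value-agree : ∀ f σ τ → Agree σ τ → value f σ F.≈ value f τ
  value-agree f σ τ p = ∑-cong (λ i → coefficient f i F.* fun σ (e i)) (λ i → coefficient f i F.* fun τ (e i))
    (λ i → F.*-congˡ (p (basis i)))

  oneᶜ : Combination
  oneᶜ = combination (λ i → φ.⟦ coordinates E.1# i ⟧)

  value-one : ∀ σ → value oneᶜ σ F.≈ F.1#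
  value-one σ = F.trans (F.sym (expand-conjugate σ E.1#)) (F.trans (⟦⟧-cong σ j.1#-homo) (1#-homo σ))

  _+ᶜ_ : Combination → Combination → Combination
  f +ᶜ g = combination (λ i → coefficient f i F.+ coefficient g i)

  value-+ : ∀ f g σ → value (f +ᶜ g) σ F.≈ value f σ F.+ value g σ
  value-+ f g σ = F.trans
    (∑-cong (λ i → (coefficient f i F.+ coefficient g i) F.* fun σ (e i))
      (λ i → coefficient f i F.* fun σ (e i) F.+ coefficient g i F.* fun σ (e i)) (λ i → F.distribʳ _ _ _))
    (∑-+ (λ i → coefficient f i F.* fun σ (e i)) (λ i → coefficient g i F.* fun σ (e i)))

  _·ᶜ_ : F.Carrier → Combination → Combination
  w ·ᶜ f = combination (λ i → w F.* coefficient f i)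

  value-· : ∀ w f σ → value (w ·ᶜ f) σ F.≈ w F.* value f σ
  value-· w f σ = F.trans
    (∑-cong (λ i → w F.* coefficient f i F.* fun σ (e i)) (λ i → w F.* (coefficient f i F.* fun σ (e i)))
      (λ i → F.*-assoc _ _ _))
    (F.sym (∑-*ˡ w (λ i → coefficient f i F.* fun σ (e i))))

  -- The row of coefficients times the matrix of multiplication by `x` in the basis of E/K.
  _×ᶜ_ : Combination → E.Carrier → Combination
  f ×ᶜ x = combination (λ k → ∑ (λ i → coefficient f i F.* φ.⟦ coordinates (basis i E.* x) k ⟧))

  value-× : ∀ f x σ → value (f ×ᶜ x) σ F.≈ value f σ F.* fun σ j.⟦ x ⟧
  value-× f x σ = begin
    ∑ (λ k → ∑ (λ i → l i F.* c i k) F.* fun σ (e k))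
      ≈⟨ ∑-cong (λ k → ∑ (λ i → l i F.* c i k) F.* fun σ (e k)) (λ k → ∑ (λ i → l i F.* c i k F.* fun σ (e k)))
           (λ k → ∑-*ʳ (fun σ (e k)) (λ i → l i F.* c i k)) ⟩
    ∑ (λ k → ∑ (λ i → l i F.* c i k F.* fun σ (e k)))
      ≈⟨ ∑-comm (λ k i → l i F.* c i k F.* fun σ (e k)) ⟩
    ∑ (λ i → ∑ (λ k → l i F.* c i k F.* fun σ (e k)))
      ≈⟨ ∑-cong (λ i → ∑ (λ k → l i F.* c i k F.* fun σ (e k))) (λ i → l i F.* fun σ (e i) F.* fun σ j.⟦ x ⟧) term ⟩
    ∑ (λ i → l i F.* fun σ (e i) F.* fun σ j.⟦ x ⟧)
      ≈⟨ ∑-*ʳ (fun σ j.⟦ x ⟧) (λ i → l i F.* fun σ (e i)) ⟨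
    ∑ (λ i → l i F.* fun σ (e i)) F.* fun σ j.⟦ x ⟧ ∎
    where
    l : Fin d → F.Carrier
    l = coefficient f
    c : Fin d → Fin d → F.Carrier
    c i k = φ.⟦ coordinates (basis i E.* x) k ⟧
    term : ∀ i → ∑ (λ k → l i F.* c i k F.* fun σ (e k)) F.≈ l i F.* fun σ (e i) F.* fun σ j.⟦ x ⟧
    term i = begin
      ∑ (λ k → l i F.* c i k F.* fun σ (e k))
        ≈⟨ ∑-cong (λ k → l i F.* c i k F.* fun σ (e k)) (λ k → l i F.* (c i k F.* fun σ (e k))) (λ k → F.*-assoc _ _ _) ⟩
      ∑ (λ k → l i F.* (c i k F.* fun σ (e k)))
        ≈⟨ ∑-*ˡ (l i) (λ k → c i k F.* fun σ (e k)) ⟨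
      l i F.* ∑ (λ k → c i k F.* fun σ (e k))
        ≈⟨ F.*-congˡ (expand-conjugate σ (basis i E.* x)) ⟨
      l i F.* fun σ j.⟦ basis i E.* x ⟧
        ≈⟨ F.*-congˡ (F.trans (⟦⟧-cong σ (j.*-homo (basis i) x)) (*-homo σ (e i) j.⟦ x ⟧)) ⟩
      l i F.* (fun σ (e i) F.* fun σ j.⟦ x ⟧)
        ≈⟨ F.*-assoc _ _ _ ⟨
      l i F.* fun σ (e i) F.* fun σ j.⟦ x ⟧ ∎

  -- A Lagrange product: each σ in the list contributes the factor ρ ↦ (ρ(x) - σ(x)) / (τ(x) -
  -- σ(x)), with x in E chosen so that σ and τ differ at it.
  separating : ∀ τ σs → All (λ σ → ∃[ x ] ¬ fun τ j.⟦ x ⟧ F.≈ fun σ j.⟦ x ⟧) σs →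
    ∃[ f ] value f τ F.≈ F.1# × All (λ σ → value f σ F.≈ F.0#) σs
  separating τ [] [] = oneᶜ , value-one τ , []
  separating τ (σ ∷ σs) ((x , τx≉σx) ∷ ps)
    with f , fτ≈1 , fσs≈0 ← separating τ σs ps
    with w , δw≈1 ← IsField.invertible F-isField
           (τx≉σx ∘ GroupProperties.x∙y⁻¹≈ε⇒x≈y F.+-group (fun τ j.⟦ x ⟧) (fun σ j.⟦ x ⟧)) =
    g , gτ≈1 , gσ≈0 ∷ All.map (λ {ρ} fρ≈0 → F.trans (value-g ρ) (F.trans (F.*-congˡ (F.trans (F.*-congʳ fρ≈0) (F.zeroˡ _))) (F.zeroʳ w))) fσs≈0
    where
    y : F.Carrier
    y = fun σ j.⟦ x ⟧
    g : Combination
    g = w ·ᶜ ((f ×ᶜ x) +ᶜ ((F.- y) ·ᶜ f))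
    value-g : ∀ ρ → value g ρ F.≈ w F.* (value f ρ F.* (fun ρ j.⟦ x ⟧ F.- y))
    value-g ρ = begin
      value g ρ
        ≈⟨ value-· w ((f ×ᶜ x) +ᶜ ((F.- y) ·ᶜ f)) ρ ⟩
      w F.* value ((f ×ᶜ x) +ᶜ ((F.- y) ·ᶜ f)) ρ
        ≈⟨ F.*-congˡ (F.trans (value-+ (f ×ᶜ x) ((F.- y) ·ᶜ f) ρ) (F.+-cong (value-× f x ρ) (value-· (F.- y) f ρ))) ⟩
      w F.* (value f ρ F.* fun ρ j.⟦ x ⟧ F.+ F.- y F.* value f ρ)
        ≈⟨ F.*-congˡ (F.+-congˡ (F.*-comm (F.- y) (value f ρ))) ⟩
      w F.* (value f ρ F.* fun ρ j.⟦ x ⟧ F.+ value f ρ F.* F.- y)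
        ≈⟨ F.*-congˡ (F.distribˡ (value f ρ) _ _) ⟨
      w F.* (value f ρ F.* (fun ρ j.⟦ x ⟧ F.- y)) ∎
    gτ≈1 : value g τ F.≈ F.1#
    gτ≈1 = F.trans (value-g τ) (F.trans (F.*-congˡ (F.trans (F.*-congʳ fτ≈1) (F.*-identityˡ _))) (F.trans (F.*-comm w _) δw≈1))
    gσ≈0 : value g σ F.≈ F.0#
    gσ≈0 = F.trans (value-g σ) (F.trans (F.*-congˡ (F.trans (F.*-congˡ (F.-‿inverseʳ y)) (F.zeroʳ _))) (F.zeroʳ w))

  distinguish : ∀ τ {σs} → ¬ Any (Agree τ) σs → All (λ σ → ∃[ x ] ¬ fun τ j.⟦ x ⟧ F.≈ fun σ j.⟦ x ⟧) σs
  distinguish τ {[]}     ¬any = []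
  distinguish τ {σ ∷ σs} ¬any with dec {∃[ x ] ¬ fun τ j.⟦ x ⟧ F.≈ fun σ j.⟦ x ⟧}
  ... | yes p = p ∷ distinguish τ (¬any ∘ there)
  ... | no ¬p = ⊥-elim (¬any (here agree))
    where
    agree : Agree τ σ
    agree x with dec {fun τ j.⟦ x ⟧ F.≈ fun σ j.⟦ x ⟧}
    ... | yes q = q
    ... | no ¬q = ⊥-elim (¬p (x , ¬q))

  module _ (S : Pred Automorphism a)
    (determined : ∀ {σ τ} → S σ → S τ → Agree σ τ → ∀ x → fun σ x F.≈ fun τ x) (x : F.Carrier) where

    -- Newton's scheme: a multiple of a combination vanishing on the earlier automorphisms corrects
    -- the value at the new one. If the new one agrees on E with an earlier one, the value is
    -- already right, since elements of S are determined by their action on E.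
    interpolate : ∀ σs → All S σs → ∃[ f ] All (λ σ → value f σ F.≈ fun σ x) σs
    interpolate [] [] = oneᶜ , []
    interpolate (τ ∷ σs) (τ∈S ∷ σs⊆S) with f , fσs≈ ← interpolate σs σs⊆S with dec {Any (Agree τ) σs}
    ... | yes agree = f , old agree σs⊆S fσs≈ ∷ fσs≈
      where
      old : ∀ {σs} → Any (Agree τ) σs → All S σs → All (λ σ → value f σ F.≈ fun σ x) σs → value f τ F.≈ fun τ x
      old {σ ∷ _} (here p) (σ∈S ∷ _) (fσ≈ ∷ _) =
        F.trans (value-agree f τ σ p) (F.trans fσ≈ (F.sym (determined {τ} {σ} τ∈S σ∈S p x)))
      old (there p) (_ ∷ σs⊆S) (_ ∷ fσs≈) = old p σs⊆S fσs≈
    ... | no ¬agree with g , gτ≈1 , gσs≈0 ← separating τ σs (distinguish τ ¬agree) =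
      h , hτ≈ ∷ All.zipWith (λ {σ} (fσ≈ , gσ≈0) → F.trans (value-h σ) (F.trans (F.+-congˡ (F.trans (F.*-congˡ gσ≈0) (F.zeroʳ w)))
            (F.trans (F.+-identityʳ _) fσ≈))) (fσs≈ , gσs≈0)
      where
      w : F.Carrier
      w = fun τ x F.- value f τ
      h : Combination
      h = f +ᶜ (w ·ᶜ g)
      value-h : ∀ σ → value h σ F.≈ value f σ F.+ w F.* value g σ
      value-h σ = F.trans (value-+ f (w ·ᶜ g) σ) (F.+-congˡ (value-· w g σ))
      hτ≈ : value h τ F.≈ fun τ x
      hτ≈ = begin
        value h τ                                   ≈⟨ value-h τ ⟩
        value f τ F.+ w F.* value g τ               ≈⟨ F.+-congˡ (F.trans (F.*-congˡ gτ≈1) (F.*-identityʳ w)) ⟩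
        value f τ F.+ (fun τ x F.- value f τ)       ≈⟨ F.+-comm _ _ ⟩
        fun τ x F.- value f τ F.+ value f τ         ≈⟨ F.+-assoc _ _ _ ⟩
        fun τ x F.+ (F.- value f τ F.+ value f τ)   ≈⟨ F.+-congˡ (F.-‿inverseˡ _) ⟩
        fun τ x F.+ F.0#                            ≈⟨ F.+-identityʳ _ ⟩
        fun τ x                                     ∎

  module _ (normal : Extension.IsNormal φ) where

    -- Each p(i) has finitely many possible images, the roots of its minimal polynomial, so finitely
    -- many elements of S realise all tuples of images. The recursion fixes the image of the first
    -- point and shrinks S accordingly.
    finite-cover : ∀ {n} (p : Fin n → F.Carrier) (S : Pred Automorphism a) →
      ∃[ σs ] All S σs × (∀ τ → S τ → Any (λ σ → ∀ i → fun τ (p i) F.≈ fun σ (p i)) σs)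
    finite-cover {zero} p S with dec {∃ S}
    ... | yes (σ , σ∈S) = σ ∷ [] , σ∈S ∷ [] , λ τ τ∈S → here λ ()
    ... | no ¬σ         = [] , [] , λ τ τ∈S → ⊥-elim (¬σ (τ , τ∈S))
    finite-cover {suc n} p S with cs , (root , _) , rs , splits ← normal (p zero) =
      let σs , σs⊆S , cover = over rs
      in σs , σs⊆S , λ τ τ∈S → cover τ τ∈S (root-among cs rs splits
           (hom-root (homᵃ τ) φ (fixes τ) {p zero} {Polynomial.monic K cs} root))
      where
      open FieldExtension φ K-isField F-isField dec using (root-among; hom-root)
      over : ∀ rs → ∃[ σs ] All S σs × (∀ τ → S τ → Any (fun τ (p zero) F.≈_) rs →
        Any (λ σ → ∀ i → fun τ (p i) F.≈ fun σ (p i)) σs)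
      over [] = [] , [] , λ τ τ∈S ()
      over (r ∷ rs) with over rs | finite-cover (p ∘ suc) (λ σ → S σ × fun σ (p zero) F.≈ r)
      ... | σs , σs⊆S , cover | ρs , ρs⊆S , cover′ =
        ρs ++ σs , All.++⁺ (All.map proj₁ ρs⊆S) σs⊆S , λ
          { τ τ∈S (here τp≈r) → Any.++⁺ˡ (both τ τp≈r ρs⊆S (cover′ τ (τ∈S , τp≈r)))
          ; τ τ∈S (there m)   → Any.++⁺ʳ ρs (cover τ τ∈S m)
          }
        where
        both : ∀ τ → fun τ (p zero) F.≈ r → ∀ {ρs} → All (λ σ → S σ × fun σ (p zero) F.≈ r) ρs →
          Any (λ σ → ∀ i → fun τ (p (suc i)) F.≈ fun σ (p (suc i))) ρs →
          Any (λ σ → ∀ i → fun τ (p i) F.≈ fun σ (p i)) ρs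
        both τ τp≈r ((_ , ρp≈r) ∷ _) (here q) = here λ { zero → F.trans τp≈r (F.sym ρp≈r) ; (suc i) → q i }
        both τ τp≈r (_ ∷ ρs⊆S) (there m) = there (both τ τp≈r ρs⊆S m)

    module _ {S : Pred Automorphism a} (S-isSubgroup : Subset.IsSubgroup (Extension.Gal φ) S)
      (determined : ∀ {σ τ} → S σ → S τ → Agree σ τ → ∀ x → fun σ x F.≈ fun τ x) where
      open Descent φ F-isField dec {S} S-isSubgroup

      spans-over-fixed : ∀ x → Σ[ m ∈ (Fin d → F.Carrier) ] (∀ i → Fixed (m i)) × ∑ (λ i → m i F.* e i) F.≈ x
      spans-over-fixed x with σs , σs⊆S , cover ← finite-cover e S
        with f , fσs≈ ← interpolate S (λ {σ} {τ} → determined {σ} {τ}) x σs σs⊆S =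
        -- Interpolation treats a finite list; any other element of S agrees on the basis with a
        -- listed one, hence satisfies the same relation.
        descent (coefficient f) e x λ τ τ∈S → transport τ τ∈S (cover τ τ∈S) σs⊆S fσs≈
        where
        transport : ∀ τ → S τ → ∀ {σs} → Any (λ σ → ∀ i → fun τ (e i) F.≈ fun σ (e i)) σs → All S σs →
          All (λ σ → value f σ F.≈ fun σ x) σs → value f τ F.≈ fun τ x
        transport τ τ∈S {σ ∷ _} (here p) (σ∈S ∷ _) (fσ≈ ∷ _) =
          let agree = agree-on-basis τ σ p
          in F.trans (value-agree f τ σ agree) (F.trans fσ≈ (F.sym (determined {τ} {σ} τ∈S σ∈S agree x)))
        transport τ τ∈S (there p) (_ ∷ σs⊆S) (_ ∷ fσs≈) = transport τ τ∈S p σs⊆S fσs≈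

-- Tensor products

module TensorProperties {a} {K A B : CommutativeRing a a} (φ : Hom K A) (ψ : Hom K B) where
  private
    module A = CommutativeRing A
    module B = CommutativeRing B
    module φ = Hom φ
    module ψ = Hom ψ
  open Tensor φ ψ
  private
    module T⊗ = CommutativeRing ring
    module R = Sums ring

  module _ {C : CommutativeRing a a} (f : Hom A C) (g : Hom B C)
    (fφ≈gψ : ∀ c → CommutativeRing._≈_ C (Hom.⟦_⟧ f φ.⟦ c ⟧) (Hom.⟦_⟧ g ψ.⟦ c ⟧)) where
    private
      module C = CommutativeRing C
      module f = Hom f
      module g = Hom g
      ⟪_⟫ : T → C.Carrier
      ⟪_⟫ = canonical f g
    open SetoidReasoning C.setoid
    open SemiringSolver C.commutativeSemiring using (solve; _:=_; _:*_)

    canonical-cong : ∀ {s t} → s ~ t → ⟪ s ⟫ C.≈ ⟪ t ⟫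
    canonical-cong ~refl           = C.refl
    canonical-cong (~sym p)        = C.sym (canonical-cong p)
    canonical-cong (~trans p q)    = C.trans (canonical-cong p) (canonical-cong q)
    canonical-cong (⊕-cong p q)    = C.+-cong (canonical-cong p) (canonical-cong q)
    canonical-cong (⊖-cong p)      = C.-‿cong (canonical-cong p)
    canonical-cong (⊕-assoc s t u) = C.+-assoc _ _ _
    canonical-cong (⊕-comm s t)    = C.+-comm _ _
    canonical-cong (⊕-idˡ s)       = C.+-identityˡ _
    canonical-cong (⊕-invˡ s)      = C.-‿inverseˡ _
    canonical-cong (⊗-cong p q)    = C.*-cong (f.⟦⟧-cong p) (g.⟦⟧-cong q)
    canonical-cong (⊗-distˡ x y z) = C.trans (C.*-congˡ (g.+-homo y z)) (C.distribˡ _ _ _)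
    canonical-cong (⊗-distʳ x y z) = C.trans (C.*-congʳ (f.+-homo x y)) (C.distribʳ _ _ _)
    canonical-cong (⊗-balance x c y) = begin
      f.⟦ x A.* φ.⟦ c ⟧ ⟧ C.* g.⟦ y ⟧         ≈⟨ C.*-congʳ (C.trans (f.*-homo x _) (C.*-congˡ (fφ≈gψ c))) ⟩
      f.⟦ x ⟧ C.* g.⟦ ψ.⟦ c ⟧ ⟧ C.* g.⟦ y ⟧   ≈⟨ C.*-assoc _ _ _ ⟩
      f.⟦ x ⟧ C.* (g.⟦ ψ.⟦ c ⟧ ⟧ C.* g.⟦ y ⟧) ≈⟨ C.*-congˡ (g.*-homo _ y) ⟨
      f.⟦ x ⟧ C.* g.⟦ ψ.⟦ c ⟧ B.* y ⟧         ∎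

    canonical-scale : ∀ x y t → ⟪ scale x y t ⟫ C.≈ f.⟦ x ⟧ C.* g.⟦ y ⟧ C.* ⟪ t ⟫
    canonical-scale x y 𝟘       = C.sym (C.zeroʳ _)
    canonical-scale x y (s ⊕ t) = C.trans (C.+-cong (canonical-scale x y s) (canonical-scale x y t)) (C.sym (C.distribˡ _ _ _))
    canonical-scale x y (⊖ t)   = C.trans (C.-‿cong (canonical-scale x y t)) (RingProperties.-‿distribʳ-* C.ring _ _)
    canonical-scale x y (z ⊗ w) = C.trans (C.*-cong (f.*-homo x z) (g.*-homo y w))
      (solve 4 (λ x z y w → x :* z :* (y :* w) := x :* y :* (z :* w)) C.refl f.⟦ x ⟧ f.⟦ z ⟧ g.⟦ y ⟧ g.⟦ w ⟧)

    canonical-* : ∀ s t → ⟪ s ⊙ t ⟫ C.≈ ⟪ s ⟫ C.* ⟪ t ⟫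
    canonical-* 𝟘        t = C.sym (C.zeroˡ _)
    canonical-* (s ⊕ s′) t = C.trans (C.+-cong (canonical-* s t) (canonical-* s′ t)) (C.sym (C.distribʳ _ _ _))
    canonical-* (⊖ s)    t = C.trans (C.-‿cong (canonical-* s t)) (RingProperties.-‿distribˡ-* C.ring _ _)
    canonical-* (x ⊗ y)  t = canonical-scale x y t

    canonicalʰ : Hom ring C
    canonicalʰ = record
      { ⟦_⟧ = ⟪_⟫
      ; isRingHomomorphism = mkIsRingHomomorphism ⟪_⟫ canonical-cong (λ _ _ → C.refl) canonical-* C.refl
          (C.trans (C.*-cong f.1#-homo g.1#-homo) (C.*-identityˡ C.1#)) (λ _ → C.refl)
      }

  homs-agree : ∀ {C : CommutativeRing a a} → let open CommutativeRing C using (_≈_) in (h h′ : Hom ring C) →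
    (∀ x y → Hom.⟦_⟧ h (x ⊗ y) ≈ Hom.⟦_⟧ h′ (x ⊗ y)) → ∀ t → Hom.⟦_⟧ h t ≈ Hom.⟦_⟧ h′ t
  homs-agree {C} h h′ pure = go
    where
    module C = CommutativeRing C
    go : ∀ t → Hom.⟦_⟧ h t C.≈ Hom.⟦_⟧ h′ t
    go 𝟘       = C.trans (Hom.0#-homo h) (C.sym (Hom.0#-homo h′))
    go (s ⊕ t) = C.trans (Hom.+-homo h s t) (C.trans (C.+-cong (go s) (go t)) (C.sym (Hom.+-homo h′ s t)))
    go (⊖ t)   = C.trans (Hom.-‿homo h t) (C.trans (C.-‿cong (go t)) (C.sym (Hom.-‿homo h′ t)))
    go (x ⊗ y) = pure x y

  ⊗-zeroˡ : ∀ y → A.0# ⊗ y ~ 𝟘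
  ⊗-zeroˡ y = RingProperties.x+x≈x⇒x≈0 T⊗.ring (A.0# ⊗ y)
    (~trans (~sym (⊗-distʳ _ _ y)) (⊗-cong (A.+-identityˡ A.0#) B.refl))

  ⊗-zeroʳ : ∀ x → x ⊗ B.0# ~ 𝟘
  ⊗-zeroʳ x = RingProperties.x+x≈x⇒x≈0 T⊗.ring (x ⊗ B.0#)
    (~trans (~sym (⊗-distˡ x _ _)) (⊗-cong A.refl (B.+-identityˡ B.0#)))

  ⊗-neg : ∀ x y → x ⊗ (B.- y) ~ ⊖ (x ⊗ y)
  ⊗-neg x y = GroupProperties.inverseˡ-unique T⊗.+-group _ _
    (~trans (~sym (⊗-distˡ x _ _)) (~trans (⊗-cong A.refl (B.-‿inverseˡ y)) (⊗-zeroʳ x)))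

  ⊗-sum : ∀ {n} (f : Fin n → A.Carrier) y → sum A.+-rawMonoid f ⊗ y ~ R.∑ (λ i → f i ⊗ y)
  ⊗-sum {zero}  f y = ⊗-zeroˡ y
  ⊗-sum {suc n} f y = ~trans (⊗-distʳ _ _ y) (⊕-cong ~refl (⊗-sum (f ∘ suc) y))

  inl : Hom A ring
  inl = record
    { ⟦_⟧ = _⊗ B.1#
    ; isRingHomomorphism = mkIsRingHomomorphism (_⊗ B.1#) (λ e → ⊗-cong e B.refl)
        (λ x y → ⊗-distʳ x y B.1#)
        (λ x y → ⊗-cong A.refl (B.sym (B.*-identityˡ B.1#)))
        (⊗-zeroˡ B.1#)
        ~refl
        (λ x → GroupProperties.inverseˡ-unique T⊗.+-group _ _
          (~trans (~sym (⊗-distʳ _ _ B.1#)) (~trans (⊗-cong (A.-‿inverseˡ x) B.refl) (⊗-zeroˡ B.1#))))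
    }

  module _ {d : ℕ} (degree : Extension.HasDegree φ d) where
    private
      b : Fin d → A.Carrier
      b = proj₁ degree

    tensor-coordinates : ∀ t → Σ[ l ∈ (Fin d → B.Carrier) ] t ~ R.∑ (λ i → b i ⊗ l i)
    tensor-coordinates 𝟘 = (λ _ → B.0#) , ~sym (R.∑-zero (λ i → b i ⊗ B.0#) (λ i → ⊗-zeroʳ (b i)))
    tensor-coordinates (s ⊕ t) =
      let l , p = tensor-coordinates s
          m , q = tensor-coordinates t
      in (λ i → l i B.+ m i) , ~trans (⊕-cong p q) (~trans (~sym (R.∑-+ (λ i → b i ⊗ l i) (λ i → b i ⊗ m i)))
           (R.∑-cong (λ i → b i ⊗ l i ⊕ b i ⊗ m i) (λ i → b i ⊗ (l i B.+ m i)) (λ i → ~sym (⊗-distˡ _ _ _))))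
    tensor-coordinates (⊖ t) =
      let l , p = tensor-coordinates t
      in (λ i → B.- l i) , ~trans (⊖-cong p) (~trans (~sym (RingProperties.-1*x≈-x T⊗.ring (R.∑ (λ i → b i ⊗ l i))))
           (~trans (R.∑-*ˡ (⊖ T⊗.1#) (λ i → b i ⊗ l i))
           (R.∑-cong (λ i → ⊖ T⊗.1# ⊙ b i ⊗ l i) (λ i → b i ⊗ (B.- l i))
             (λ i → ~trans (RingProperties.-1*x≈-x T⊗.ring (b i ⊗ l i)) (~sym (⊗-neg (b i) (l i)))))))
    tensor-coordinates (x ⊗ y) =
      let c , x≈ = proj₁ (proj₂ degree) x
      in (λ i → ψ.⟦ c i ⟧ B.* y) , ~trans (⊗-cong (A.sym x≈) B.refl) (~trans (⊗-sum (λ i → φ.⟦ c i ⟧ A.* b i) y)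
           (R.∑-cong (λ i → (φ.⟦ c i ⟧ A.* b i) ⊗ y) (λ i → b i ⊗ (ψ.⟦ c i ⟧ B.* y))
             (λ i → ~trans (⊗-cong (A.*-comm _ _) B.refl) (⊗-balance _ _ _))))

excluded-middle : ∀ {a} → ExcludedMiddle (lsuc a) → ExcludedMiddle a
excluded-middle {a} em {P} with em {Lift (lsuc a) P}
... | yes (lift p) = yes p
... | no ¬p        = no (¬p ∘ lift)

map-splits : ∀ {a} {K M N : CommutativeRing a a} (φ : Hom K M) (ι : Hom M N) (χ : Hom K N) →
  (∀ c → CommutativeRing._≈_ N (Hom.⟦_⟧ ι (Hom.⟦_⟧ φ c)) (Hom.⟦_⟧ χ c)) → ∀ f rs →
  Extension.SplitsInto φ f rs → Extension.SplitsInto χ f (List.map (Hom.⟦_⟧ ι) rs)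
map-splits {M = M} {N} φ ι χ ιφ≈χ f rs splits = N[X].at
  (N[X].trans (N[X].sym (map-map-≋ φ ι χ ιφ≈χ f))
  (N[X].trans (MapPolynomial.map-cong ι {List.map (Hom.⟦_⟧ φ) f} {PolynomialRing.linearFactors M rs} (PolynomialRing.pointwise splits))
  (MapPolynomial.map-linearFactors ι rs)))
  where
  module N[X] where
    open PolynomialRing N public
    open CommutativeRing polynomialRing public

module _ {a} (G : Group a a) where
  open Group G
  open Subset G

  -- Decompose g in W as u v with u in U. Since U ⊆ W, both g = u v and g = g · 1 are decompositions
  -- with respect to W, so g = u.
  comparable-complements : ∀ {V U W} → IsComplement V U → IsComplement V W → IsSubgroup V →
    (∀ {g} → U g → W g) → ∀ {g} → W g → U g
  comparable-complements (U-isSubgroup , U-unique) (_ , W-unique) V-isSubgroup U⊆W {g} g∈W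
    with u , v , u∈U , v∈V , g≈uv , _ ← U-unique g
    with u₀ , v₀ , _ , _ , _ , unique ← W-unique g =
    IsSubgroup.resp U-isSubgroup
      (trans (sym (proj₁ (unique (U⊆W u∈U) v∈V g≈uv)))
        (proj₁ (unique g∈W (IsSubgroup.ε-closed V-isSubgroup) (sym (identityʳ g))))) u∈U

-- Potentially Galois extensions

module GaloisClosure {a} (dec : ExcludedMiddle a) (Ω : CommutativeRing a a) (Ω-isField : IsField Ω)
  (k E Ê : Subfields.Subfield Ω) (k⊑E : Subfields._⊑_ Ω k E) (E⊑Ê : Subfields._⊑_ Ω E Ê)
  {d : ℕ} (degree : Subfields.HasDegree Ω k⊑E d) (closure : Subfields.IsGaloisClosure Ω k⊑E E⊑Ê) where
  open CommutativeRing Ω hiding (zero; ring)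
  open Subfields Ω
  open Setting Ω k E Ê k⊑E E⊑Ê
  open Subfield
  open SubfieldProperties Ω using (inclusion; subfield-isField; flatten; ∨-least)
  open Extension.Automorphism
  open Subset Γ
  private
    module Γ = Group Γ
    module Ê = CommutativeRing ⌊ Ê ⌋
  open Γ using () renaming (Carrier to |Γ|)

  φ : Hom ⌊ k ⌋ ⌊ Ê ⌋
  φ = incl k⊑Ê

  galois : Extension.IsGalois φ
  galois = proj₁ closure

  field⌊_⌋ : ∀ N → IsField ⌊ N ⌋
  field⌊_⌋ = subfield-isField Ω-isField

  open Interpolation (incl k⊑E) (incl E⊑Ê) φ (λ _ → refl) field⌊ k ⌋ field⌊ Ê ⌋ dec degree public
    using (basis; e; expand; coordinates)

  open NormalExtension φ field⌊ k ⌋ field⌊ Ê ⌋ dec (proj₂ galois) using (Generator; Generates; generator-mem)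
  open GeneratedSubfield φ field⌊ k ⌋ field⌊ Ê ⌋ dec galois using (conjugates; generatedBase; generated-galois)
  private module Ê′ = SubfieldProperties ⌊ Ê ⌋

  abstract
    conjugate-list : ∃[ rs ] GeneratedSubfield.ConjugateClosed φ field⌊ k ⌋ field⌊ Ê ⌋ dec galois rs ×
      (∀ i → Any (CommutativeRing._≈_ ⌊ Ê ⌋ (e i)) rs) ×
      All (λ r → ∃[ i ] ∃[ cs ] Extension.IsMinimalPolynomial φ (e i) cs ×
                 Extension._IsRootOf_ φ r (Polynomial.monic ⌊ k ⌋ cs)) rs
    conjugate-list = conjugates e

  rs : List (CommutativeRing.Carrier ⌊ Ê ⌋)
  rs = proj₁ conjugate-list

  private
    M : Subfields.Subfield ⌊ Ê ⌋
    M = Ê′.⟨ Generator rs ⟩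

    module M = Subfields.Subfield M

    -- The closure hypothesis ranges over subfields of Ω, whereas the generated field is a subfield
    -- of the ring `⌊ Ê ⌋`; hence the flattening.
    M′ : Subfield
    M′ = flatten Ê M

    E⊑M′ : E ⊑ M′
    E⊑M′ = mk⊑ λ {x} x∈E → mem E⊑Ê x∈E ,
      M.resp (sym (expand (x , x∈E))) (Ê′.sum-closed M (λ i → Hom.⟦_⟧ φ (coordinates (x , x∈E) i) *ₑ e i)
        (λ i → M.*-closed (Ê′.gen (inj₁ (coordinates (x , x∈E) i , refl)))
                          (Ê′.gen (inj₂ (proj₁ (proj₂ (proj₂ conjugate-list)) i)))))
      where open CommutativeRing ⌊ Ê ⌋ using () renaming (_*_ to _*ₑ_)

    M′-galois : IsGalois (⊑-trans k⊑E E⊑M′)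
    M′-galois = galois-reflect (incl (⊑-trans k⊑E E⊑M′)) ι (generatedBase rs (proj₁ (proj₂ conjugate-list))) (λ _ → refl) id
      (λ _ _ ss _ _ → All.universal (λ ((x , p) , q) → (x , p , q) , refl) ss)
      (generated-galois rs (proj₁ (proj₂ conjugate-list)))
      where
      ι : Hom ⌊ M′ ⌋ (Subfields.⌊_⌋ ⌊ Ê ⌋ M)
      ι = record
        { ⟦_⟧ = λ (x , p , q) → (x , p) , q
        ; isRingHomomorphism = mkIsRingHomomorphism (λ (x , p , q) → (x , p) , q) id
            (λ _ _ → refl) (λ _ _ → refl) refl refl (λ _ → refl)
        }

  -- `M′` contains E because it contains k and a basis, and it is Galois over k; minimality of Ê
  -- then forces Ê into it.
  generates : Generates rs
  generates (x , p) = let p′ , q = mem (proj₂ closure M′ E⊑M′ (mk⊑ proj₁) M′-galois) p in M.resp refl q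

  private
    module φ-normal = NormalExtension φ field⌊ k ⌋ field⌊ Ê ⌋ dec (proj₂ galois)

  abstract
    Γ-transitive : ∀ {x y cs} → Extension.IsMinimalPolynomial φ x cs →
      Extension._IsRootOf_ φ y (Polynomial.monic ⌊ k ⌋ cs) → Σ[ σ ∈ |Γ| ] proj₁ (fun σ x) ≈ proj₁ y
    Γ-transitive {x} {y} {cs} = φ-normal.transitive-on-roots rs generates {x} {y} {cs}

    Γ-fixed⇒k : ∀ x → (∀ (σ : |Γ|) → proj₁ (fun σ x) ≈ proj₁ x) → Mem k (proj₁ x)
    Γ-fixed⇒k x fixed with (c , p) , c≈x ← φ-normal.fixed⇒base rs generates (proj₁ galois) x fixed = resp k c≈x p

    among-members : ∀ (N : Subfield) {x} (ss : List (CommutativeRing.Carrier ⌊ N ⌋)) → Any (x ≈_) (List.map proj₁ ss) → Mem N x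
    among-members N ((s , p) ∷ ss) (here x≈s) = resp N (sym x≈s) p
    among-members N (s ∷ ss) (there m) = among-members N ss m

    -- The image of `x` is a root of the minimal polynomial of `x` over k, all of whose roots in Ω
    -- already lie in Ê.
    embedding-stays : (h : Hom ⌊ Ê ⌋ Ω) → (∀ c → Hom.⟦_⟧ h (Hom.⟦_⟧ φ c) ≈ proj₁ c) → ∀ x → Mem Ê (Hom.⟦_⟧ h x)
    embedding-stays h fixes x with cs , (root , _) , ss , splits ← proj₂ galois x =
      among-members Ê ss (FieldExtension.root-among (inclusion k) field⌊ k ⌋ Ω-isField dec {Hom.⟦_⟧ h x} cs (List.map proj₁ ss)
        (map-splits φ (inclusion Ê) (inclusion k) (λ _ → refl) (Polynomial.monic ⌊ k ⌋ cs) ss splits)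
        (FieldExtension.hom-root (inclusion k) field⌊ k ⌋ Ω-isField dec h φ fixes {x} {Polynomial.monic ⌊ k ⌋ cs} root))

  restrict : (h : Hom ⌊ Ê ⌋ Ω) → (∀ c → Hom.⟦_⟧ h (Hom.⟦_⟧ φ c) ≈ proj₁ c) → |Γ|
  restrict h fixes = FieldExtension.automorphism φ field⌊ k ⌋ field⌊ Ê ⌋ dec (proj₂ galois) (record
    { ⟦_⟧ = λ x → Hom.⟦_⟧ h x , embedding-stays h fixes x
    ; isRingHomomorphism = mkIsRingHomomorphism (λ x → Hom.⟦_⟧ h x , embedding-stays h fixes x)
        (Hom.⟦⟧-cong h) (Hom.+-homo h) (Hom.*-homo h) (Hom.0#-homo h) (Hom.1#-homo h) (Hom.-‿homo h)
    }) fixes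

  homΓ : |Γ| → Hom ⌊ Ê ⌋ Ω
  homΓ σ = inclusion Ê ∘ʰ record { ⟦_⟧ = fun σ ; isRingHomomorphism = isRingHomomorphism σ }

  -- Ê is generated over k by the list `rs`, and transitivity of Γ on roots writes every entry as
  -- γ(eᵢ).
  Ê-least : ∀ N → k ⊑ N → (∀ γ (x : CommutativeRing.Carrier ⌊ E ⌋) → Mem N (Hom.⟦_⟧ (homΓ γ ∘ʰ incl E⊑Ê) x)) → Ê ⊑ N
  Ê-least N k⊑N conjugate∈N = mk⊑ λ {x} x∈Ê → Ê′.⟨⟩-least N′
    (λ {y} → generator-mem N′ {rs} (λ (c , c∈k) → mem k⊑N c∈k) (All.map root∈N (proj₂ (proj₂ (proj₂ conjugate-list)))) {y}) (generates (x , x∈Ê))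
    where
    N′ : Subfields.Subfield ⌊ Ê ⌋
    N′ = record
      { Mem = Mem N ∘ proj₁ ; resp = resp N ; 0-closed = 0-closed N ; 1-closed = 1-closed N ; +-closed = +-closed N
      ; *-closed = *-closed N ; neg-closed = neg-closed N ; inv-closed = inv-closed N }
    root∈N : ∀ {r} → ∃[ i ] ∃[ cs ] Extension.IsMinimalPolynomial φ (e i) cs ×
      Extension._IsRootOf_ φ r (Polynomial.monic ⌊ k ⌋ cs) → Mem N (proj₁ r)
    root∈N {r} (i , cs , minimal , root) with γ , γe≈r ← Γ-transitive {e i} {r} {cs} minimal root =
      resp N γe≈r (conjugate∈N γ (basis i))

  module Potential (L : Subfield) (L∈𝓛 : 𝓛 L) where
    k⊑L : k ⊑ L
    k⊑L = proj₁ L∈𝓛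

    open E⊗ L k⊑L public
    private
      module T⊗ = CommutativeRing ring
      EL : Subfield
      EL = E ∨ L

    T-isField : IsField ring
    T-isField = proj₁ (proj₂ L∈𝓛)

    can : Hom ring Ω
    can = TensorProperties.canonicalʰ (incl k⊑E) (incl k⊑L) (inclusion E) (inclusion L) (λ _ → refl)

    can-injective : ∀ {s t} → Hom.⟦_⟧ can s ≈ Hom.⟦_⟧ can t → s ~ t
    can-injective = HomProperties.field-hom-injective can T-isField (IsField.nontrivial Ω-isField) dec

    can∈EL : ∀ t → Mem EL (Hom.⟦_⟧ can t)
    can∈EL 𝟘                   = 0-closed EL
    can∈EL (s ⊕ t)             = plus (can∈EL s) (can∈EL t)
    can∈EL (⊖ t)               = minus (can∈EL t)
    can∈EL ((x , p) ⊗ (y , q)) = times (left p) (right q)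

    -- The image is closed under inverses because T is a field: the inverse is taken in T, and its
    -- image is identified by cancellation in Ω.
    can-surjective : ∀ {x} → Mem EL x → ∃[ t ] Hom.⟦_⟧ can t ≈ x
    can-surjective (left p)    = (_ , p) ⊗ (1# , 1-closed L) , *-identityʳ _
    can-surjective (right q)   = (1# , 1-closed E) ⊗ (_ , q) , *-identityˡ _
    can-surjective (equal e p) = let t , t≈ = can-surjective p in t , trans t≈ e
    can-surjective (plus p q)  = let s , s≈ = can-surjective p ; t , t≈ = can-surjective q in s ⊕ t , +-cong s≈ t≈
    can-surjective (times p q) = let s , s≈ = can-surjective p ; t , t≈ = can-surjective q in
      s ⊙ t , trans (Hom.*-homo can s t) (*-cong s≈ t≈)
    can-surjective (minus p)   = let t , t≈ = can-surjective p in ⊖ t , -‿cong t≈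
    can-surjective (inv {x} {y} xy≈1 p) =
      let t , t≈ = can-surjective p
          s , ts≈1 = IsField.invertible T-isField {t} (λ t≈0 → FieldProperties.unit≉0 Ω-isField xy≈1 (trans (sym t≈) (Hom.⟦⟧-cong can t≈0)))
      in s , FieldProperties.cancelˡ Ω-isField (FieldProperties.unit≉0 Ω-isField xy≈1)
               (trans (trans (*-congʳ (sym t≈)) (trans (sym (Hom.*-homo can t s)) (trans (Hom.⟦⟧-cong can ts≈1) (Hom.1#-homo can)))) (sym xy≈1))

    canEL : Hom ring ⌊ EL ⌋
    canEL = record
      { ⟦_⟧ = λ t → Hom.⟦_⟧ can t , can∈EL t
      ; isRingHomomorphism = mkIsRingHomomorphism (λ t → Hom.⟦_⟧ can t , can∈EL t)
          (Hom.⟦⟧-cong can) (Hom.+-homo can) (Hom.*-homo can) (Hom.0#-homo can) (Hom.1#-homo can) (Hom.-‿homo can)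
      }

    preimage : CommutativeRing.Carrier ⌊ EL ⌋ → T
    preimage (_ , p) = proj₁ (can-surjective p)

    can-preimage : ∀ x → Hom.⟦_⟧ can (preimage x) ≈ proj₁ x
    can-preimage (_ , p) = proj₂ (can-surjective p)

    preimage-unique : ∀ x t → Hom.⟦_⟧ can t ≈ proj₁ x → preimage x ~ t
    preimage-unique x t e = can-injective (trans (can-preimage x) (sym e))

    preimageʰ : Hom ⌊ EL ⌋ ring
    preimageʰ = record
      { ⟦_⟧ = preimage
      ; isRingHomomorphism = mkIsRingHomomorphism preimage
          (λ {x} {y} e → preimage-unique x (preimage y) (trans (can-preimage y) (sym e)))
          (λ x y → preimage-unique (x EL.+ y) (preimage x ⊕ preimage y) (+-cong (can-preimage x) (can-preimage y)))
          (λ x y → preimage-unique (x EL.* y) (preimage x ⊙ preimage y)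
            (trans (Hom.*-homo can (preimage x) (preimage y)) (*-cong (can-preimage x) (can-preimage y))))
          (preimage-unique EL.0# 𝟘 refl)
          (preimage-unique EL.1# T⊗.1# (Hom.1#-homo can))
          (λ x → preimage-unique (EL.- x) (⊖ preimage x) (-‿cong (can-preimage x)))
      }
      where module EL = CommutativeRing ⌊ EL ⌋

    EL-galois : IsGalois (⊑∨ʳ E L)
    EL-galois = galois-reflect (incl (⊑∨ʳ E L)) preimageʰ inr
      (λ c → preimage-unique (Hom.⟦_⟧ (incl (⊑∨ʳ E L)) c) (Hom.⟦_⟧ inr c) (*-identityˡ (proj₁ c)))
      (λ {x} {y} e → trans (sym (can-preimage x)) (trans (Hom.⟦⟧-cong can e) (can-preimage y)))
      (λ _ _ ts _ _ → All.universal (λ t → (Hom.⟦_⟧ can t , can∈EL t) , preimage-unique (Hom.⟦_⟧ can t , can∈EL t) t refl) ts)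
      (proj₂ (proj₂ L∈𝓛))

    -- γ ⊗ id on E ⊗ L
    conjugate : |Γ| → Hom ring Ω
    conjugate γ = TensorProperties.canonicalʰ (incl k⊑E) (incl k⊑L) (homΓ γ ∘ʰ incl E⊑Ê) (inclusion L) (fixes γ)

    abstract
      conjugate∈EL : ∀ γ x → Mem EL (Hom.⟦_⟧ (homΓ γ ∘ʰ incl E⊑Ê) x)
      conjugate∈EL γ x with cs , (root , _) , ts , splits ← proj₂ (proj₂ (proj₂ L∈𝓛)) (x ⊗ (1# , 1-closed L)) =
        resp EL (*-identityʳ _) (among-can ts (FieldExtension.root-among (inclusion L) field⌊ L ⌋ Ω-isField dec
          {Hom.⟦_⟧ (conjugate γ) (x ⊗ (1# , 1-closed L))} cs (List.map (Hom.⟦_⟧ can) ts)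
          (map-splits inr can (inclusion L) (λ c → *-identityˡ _) (Polynomial.monic ⌊ L ⌋ cs) ts splits)
          (FieldExtension.hom-root (inclusion L) field⌊ L ⌋ Ω-isField dec (conjugate γ) inr
            (λ c → trans (*-congʳ (Hom.1#-homo (homΓ γ ∘ʰ incl E⊑Ê))) (*-identityˡ _)) {x ⊗ (1# , 1-closed L)} {Polynomial.monic ⌊ L ⌋ cs} root)))
        where
        among-can : ∀ {y} ts → Any (y ≈_) (List.map (Hom.⟦_⟧ can) ts) → Mem EL y
        among-can (t ∷ ts) (here e)  = resp EL (sym e) (can∈EL t)
        among-can (t ∷ ts) (there m) = among-can ts m

    Ê⊑EL : Ê ⊑ EL
    Ê⊑EL = Ê-least EL (⊑-trans k⊑L (⊑∨ʳ E L)) conjugate∈EL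

    conjugates∈EL : ∀ γ t → Mem EL (Hom.⟦_⟧ (conjugate γ) t)
    conjugates∈EL γ 𝟘             = 0-closed EL
    conjugates∈EL γ (s ⊕ t)       = plus (conjugates∈EL γ s) (conjugates∈EL γ t)
    conjugates∈EL γ (⊖ t)         = minus (conjugates∈EL γ t)
    conjugates∈EL γ (x ⊗ (y , q)) = times (conjugate∈EL γ x) (right q)

    |Gal[EL/L]| : Set a
    |Gal[EL/L]| = Group.Carrier Gal[EL/ L ]

    -- Moves an L-linear map from T to EL across T ≅ EL. It serves both for the maps γ ⊗ id and for
    -- the automorphisms of T over L.
    endomorphism : (h : Hom ring Ω) → (∀ t → Mem EL (Hom.⟦_⟧ h t)) → (∀ c → Hom.⟦_⟧ h (Hom.⟦_⟧ inr c) ≈ proj₁ c) → |Gal[EL/L]|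
    endomorphism h h∈EL h-fixes = FieldExtension.automorphism (incl (⊑∨ʳ E L)) field⌊ L ⌋ field⌊ EL ⌋ dec (proj₂ EL-galois)
      (record
        { ⟦_⟧ = λ x → Hom.⟦_⟧ h (preimage x) , h∈EL (preimage x)
        ; isRingHomomorphism = mkIsRingHomomorphism (λ x → Hom.⟦_⟧ h (preimage x) , h∈EL (preimage x))
            (λ {x} {y} → hp.⟦⟧-cong {x} {y}) hp.+-homo hp.*-homo hp.0#-homo hp.1#-homo hp.-‿homo
        })
      (λ c → trans (Hom.⟦⟧-cong h (preimage-unique (Hom.⟦_⟧ (incl (⊑∨ʳ E L)) c) (Hom.⟦_⟧ inr c) (*-identityˡ (proj₁ c)))) (h-fixes c))
      where module hp = Hom (h ∘ʰ preimageʰ)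

    extendΓ : |Γ| → |Gal[EL/L]|
    extendΓ γ = endomorphism (conjugate γ) (conjugates∈EL γ) (λ c → trans (*-congʳ (Hom.1#-homo (homΓ γ ∘ʰ incl E⊑Ê))) (*-identityˡ _))

    extendΓ-on-E : ∀ γ {x} (x∈E : Mem E x) p → proj₁ (fun (extendΓ γ) (x , p)) ≈ proj₁ (fun γ (x , mem E⊑Ê x∈E))
    extendΓ-on-E γ {x} x∈E p = trans (Hom.⟦⟧-cong (conjugate γ) (preimage-unique (x , p) ((x , x∈E) ⊗ (1# , 1-closed L)) (*-identityʳ x)))
      (*-identityʳ _)

    homEL : |Gal[EL/L]| → Hom ⌊ EL ⌋ Ω
    homEL σ = inclusion EL ∘ʰ record { ⟦_⟧ = fun σ ; isRingHomomorphism = isRingHomomorphism σ }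

    fixes-L : ∀ (σ : |Gal[EL/L]|) {x} (p : Mem EL x) → Mem L x → proj₁ (fun σ (x , p)) ≈ x
    fixes-L σ {x} p x∈L = trans (⟦⟧-cong σ {x , p} {x , right x∈L} refl) (fixes σ (x , x∈L))

    restriction : |Gal[EL/L]| → |Γ|
    restriction σ = restrict (homEL σ ∘ʰ incl Ê⊑EL) (λ (c , c∈k) → fixes-L σ {c} (mem Ê⊑EL (mem k⊑Ê c∈k)) (mem k⊑L c∈k))

    restricts : ∀ σ → Restricts L σ (restriction σ)
    restricts σ = Ê⊑EL , λ p → refl

    determined-on-E : ∀ (σ σ′ : |Gal[EL/L]|) → (∀ {x} → Mem E x → ∀ p → proj₁ (fun σ (x , p)) ≈ proj₁ (fun σ′ (x , p))) →
      ∀ x → proj₁ (fun σ x) ≈ proj₁ (fun σ′ x)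
    determined-on-E σ σ′ agree x = trans (⟦⟧-cong σ {x} {y} (sym (can-preimage x)))
      (trans (TensorProperties.homs-agree (incl k⊑E) (incl k⊑L) (h σ) (h σ′) pure (preimage x))
      (⟦⟧-cong σ′ {y} {x} (can-preimage x)))
      where
      y : CommutativeRing.Carrier ⌊ EL ⌋
      y = Hom.⟦_⟧ canEL (preimage x)
      h : |Gal[EL/L]| → Hom ring Ω
      h σ = homEL σ ∘ʰ canEL
      pure : ∀ u v → Hom.⟦_⟧ (h σ) (u ⊗ v) ≈ Hom.⟦_⟧ (h σ′) (u ⊗ v)
      pure (u , u∈E) (v , v∈L) = trans (*-homo σ (u , left u∈E) (v , right v∈L))
        (trans (*-cong (agree u∈E (left u∈E)) (trans (fixes σ (v , v∈L)) (sym (fixes σ′ (v , v∈L)))))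
        (sym (*-homo σ′ (u , left u∈E) (v , right v∈L))))

    𝔾-agree : ∀ {τ τ′} → 𝔾 L τ → 𝔾 L τ′ → (∀ {x} (x∈E : Mem E x) → proj₁ (fun τ (x , mem E⊑Ê x∈E)) ≈ proj₁ (fun τ′ (x , mem E⊑Ê x∈E))) →
      ∀ x → proj₁ (fun τ x) ≈ proj₁ (fun τ′ x)
    𝔾-agree {τ} {τ′} (σ , inc , σ≈τ) (σ′ , inc′ , σ′≈τ′) agree (x , p) =
      trans (sym (σ≈τ p)) (trans (determined-on-E σ σ′ on-E (x , mem inc p)) (trans (⟦⟧-cong σ′ {x , mem inc p} {x , mem inc′ p} refl) (σ′≈τ′ p)))
      where
      on-E : ∀ {x} → Mem E x → ∀ p → proj₁ (fun σ (x , p)) ≈ proj₁ (fun σ′ (x , p))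
      on-E {x} x∈E p = trans (⟦⟧-cong σ {x , p} {x , mem inc (mem E⊑Ê x∈E)} refl) (trans (σ≈τ (mem E⊑Ê x∈E))
        (trans (agree x∈E) (trans (sym (σ′≈τ′ (mem E⊑Ê x∈E))) (⟦⟧-cong σ′ {x , mem inc′ (mem E⊑Ê x∈E)} {x , p} refl))))

  Gal[Ê/]-isSubgroup : ∀ L → IsSubgroup Gal[Ê/ L ]
  Gal[Ê/]-isSubgroup L = record
    { resp      = λ σ≈τ fixed p x∈L → trans (sym (σ≈τ (_ , p))) (fixed p x∈L)
    ; ε-closed  = λ p x∈L → refl
    ; ∙-closed  = λ {σ} {τ} σ-fixes τ-fixes {x} p x∈L → trans (⟦⟧-cong σ {fun τ (x , p)} {x , p} (τ-fixes p x∈L)) (σ-fixes p x∈L)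
    ; ⁻¹-closed = λ {σ} σ-fixes {x} p x∈L → trans (⟦⟧-cong (σ Γ.⁻¹) {x , p} {fun σ (x , p)} (sym (σ-fixes p x∈L))) (Γ.inverseˡ σ (x , p))
    }

  -- The complement attached to a field of 𝓛

  module _ (L : Subfield) (L∈𝓛 : 𝓛 L) where
    open Potential L L∈𝓛
    private
      EL : Subfield
      EL = E ∨ L
      module GalEL = Group Gal[EL/ L ]

    𝔾-isSubgroup : IsSubgroup (𝔾 L)
    𝔾-isSubgroup = record
      { resp      = λ τ≈τ′ (σ , inc , σ≈τ) → σ , inc , λ {x} p → trans (σ≈τ p) (τ≈τ′ (x , p))
      ; ε-closed  = GalEL.ε , Ê⊑EL , λ p → refl
      ; ∙-closed  = λ {τ} {τ′} (σ , inc , σ≈τ) (σ′ , inc′ , σ′≈τ′) → σ GalEL.∙ σ′ , inc , λ {x} p →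
          trans (⟦⟧-cong σ {fun σ′ (x , mem inc p)} {_ , mem inc (proj₂ (fun τ′ (x , p)))}
            (trans (⟦⟧-cong σ′ {x , mem inc p} {x , mem inc′ p} refl) (σ′≈τ′ p)))
          (σ≈τ (proj₂ (fun τ′ (x , p))))
      ; ⁻¹-closed = λ {τ} (σ , inc , σ≈τ) → σ GalEL.⁻¹ , inc , λ {x} p →
          injective σ {fun (σ GalEL.⁻¹) (x , mem inc p)} {_ , mem inc (proj₂ (fun (τ Γ.⁻¹) (x , p)))}
            (trans (GalEL.inverseʳ σ (x , mem inc p))
            (trans (sym (Γ.inverseʳ τ (x , p))) (sym (σ≈τ (proj₂ (fun (τ Γ.⁻¹) (x , p)))))))
      }

    𝔾-complement : 𝓖 (𝔾 L)
    𝔾-complement = 𝔾-isSubgroup , decompose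
      where
      decompose : ∀ g → ∃[ u ] ∃[ v ] 𝔾 L u × Gal[Ê/ E ] v × g Γ.≈ u Γ.∙ v ×
        (∀ {u₁ v₁} → 𝔾 L u₁ → Gal[Ê/ E ] v₁ → g Γ.≈ u₁ Γ.∙ v₁ → u Γ.≈ u₁ × v Γ.≈ v₁)
      decompose g = u , v , u∈𝔾 , v∈ , g≈uv , λ {u₁} {v₁} → unique {u₁} {v₁}
        where
        u v : |Γ|
        -- The element of 𝔾(L) agreeing with g on E, so that u⁻¹ g fixes E.
        u = restriction (extendΓ g)
        v = u Γ.⁻¹ Γ.∙ g
        u∈𝔾 : 𝔾 L u
        u∈𝔾 = extendΓ g , restricts (extendΓ g)
        u-on-E : ∀ {x} (x∈E : Mem E x) p → proj₁ (fun u (x , p)) ≈ proj₁ (fun g (x , p))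
        u-on-E {x} x∈E p = trans (extendΓ-on-E g x∈E (mem Ê⊑EL p)) (⟦⟧-cong g {x , mem E⊑Ê x∈E} {x , p} refl)
        v∈ : Gal[Ê/ E ] v
        v∈ {x} p x∈E = trans (⟦⟧-cong (u Γ.⁻¹) {fun g (x , p)} {fun u (x , p)} (sym (u-on-E x∈E p))) (Γ.inverseˡ u (x , p))
        g≈uv : g Γ.≈ u Γ.∙ v
        g≈uv x = sym (Γ.inverseʳ u (fun g x))
        unique : ∀ {u₁ v₁} → 𝔾 L u₁ → Gal[Ê/ E ] v₁ → g Γ.≈ u₁ Γ.∙ v₁ → u Γ.≈ u₁ × v Γ.≈ v₁
        unique {u₁} {v₁} u₁∈𝔾 v₁∈ g≈u₁v₁ = u≈u₁ , GroupProperties.∙-cancelˡ Γ u v v₁ λ x →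
            trans (sym (g≈uv x)) (trans (g≈u₁v₁ x) (sym (u≈u₁ (fun v₁ x))))
          where
          u≈u₁ : u Γ.≈ u₁
          u≈u₁ = 𝔾-agree {u} {u₁} u∈𝔾 u₁∈𝔾 λ {x} x∈E → trans (u-on-E x∈E (mem E⊑Ê x∈E))
            (trans (g≈u₁v₁ (x , mem E⊑Ê x∈E)) (⟦⟧-cong u₁ {fun v₁ (x , mem E⊑Ê x∈E)} {x , mem E⊑Ê x∈E} (v₁∈ (mem E⊑Ê x∈E) x∈E)))

    -- A basis of E/k generates EL over L, since its k-coefficients lie in L; this supplies the
    -- finite list required by `fixed⇒base`.
    Gal[EL/L]-fixed⇒L : ∀ x → (∀ (σ : |Gal[EL/L]|) → proj₁ (fun σ x) ≈ proj₁ x) → Mem L (proj₁ x)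
    Gal[EL/L]-fixed⇒L x fixed =
      let (c , p) , c≈x = EL/L.fixed⇒base generators generated (proj₁ EL-galois) x fixed in resp L c≈x p
      where
      module EL/L = NormalExtension (incl (⊑∨ʳ E L)) field⌊ L ⌋ field⌊ EL ⌋ dec (proj₂ EL-galois)
      open SubfieldProperties ⌊ EL ⌋ using (⟨_⟩; gen)
      E⊑EL : E ⊑ EL
      E⊑EL = mk⊑ left
      generators : List (CommutativeRing.Carrier ⌊ EL ⌋)
      generators = List.tabulate (Hom.⟦_⟧ (incl E⊑EL) ∘ basis)
      N : Subfields.Subfield ⌊ EL ⌋
      N = ⟨ EL/L.Generator generators ⟩
      module N = Subfields.Subfield N
      k⊑EL : k ⊑ EL
      k⊑EL = ⊑-trans k⊑E E⊑EL
      module I = Interpolation (incl k⊑E) (incl E⊑EL) (incl k⊑EL) (λ _ → refl) field⌊ k ⌋ field⌊ EL ⌋ dec degree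
      L⊑N : L ⊑ flatten EL N
      L⊑N = mk⊑ λ {x} x∈L → right x∈L , gen (inj₁ ((x , x∈L) , refl))
      E⊑N : E ⊑ flatten EL N
      E⊑N = mk⊑ λ {x} x∈E → left x∈E , N.resp (sym (I.expand (x , x∈E)))
        (SubfieldProperties.sum-closed ⌊ EL ⌋ N (λ i → Hom.⟦_⟧ (incl k⊑EL) (I.coordinates (x , x∈E) i) EL⌊⌋.* I.e i)
          (λ i → N.*-closed (gen (inj₁ (Hom.⟦_⟧ (incl k⊑L) (I.coordinates (x , x∈E) i) , refl)))
                            (gen (inj₂ (Any.tabulate⁺ i refl)))))
        where module EL⌊⌋ = CommutativeRing ⌊ EL ⌋
      generated : EL/L.Generates generators
      generated (x , p) with p′ , q ← mem (∨-least E⊑N L⊑N) p = N.resp refl q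

    -- Each automorphism of EL/L restricts into 𝔾(L), so an element of Ê fixed by 𝔾(L) is fixed by
    -- all of Gal(EL/L).
    𝕃𝔾⊑L : 𝕃 (𝔾 L) ⊑ L
    𝕃𝔾⊑L = mk⊑ λ {x} (p , fixed) → Gal[EL/L]-fixed⇒L (x , mem Ê⊑EL p) (λ σ → fixed {restriction σ} (σ , restricts σ))

    𝔾⊆Gal[Ê/] : ∀ {τ} → 𝔾 L τ → ∀ {x} (p : Mem Ê x) → Mem L x → proj₁ (fun τ (x , p)) ≈ x
    𝔾⊆Gal[Ê/] {τ} (σ , inc , σ≈τ) p x∈L = trans (sym (σ≈τ p)) (fixes-L σ (mem inc p) x∈L)

    -- When L ⊆ Ê, τ is defined on all of EL. If it also fixes L, it agrees with τ ⊗ id on pure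
    -- tensors, so `extendΓ τ` restricts to τ itself.
    Gal[Ê/]⊆𝔾 : L ⊑ Ê → ∀ {τ} → Gal[Ê/ L ] τ → 𝔾 L τ
    Gal[Ê/]⊆𝔾 L⊑Ê {τ} τ-fixes = extendΓ τ , Ê⊑EL , λ {x} p →
      trans (TensorProperties.homs-agree (incl k⊑E) (incl k⊑L) (conjugate τ) (homΓ τ ∘ʰ canÊ) pure (preimage (x , mem Ê⊑EL p)))
        (⟦⟧-cong τ {Hom.⟦_⟧ canÊ (preimage (x , mem Ê⊑EL p))} {x , p} (can-preimage (x , mem Ê⊑EL p)))
      where
      EL⊑Ê : EL ⊑ Ê
      EL⊑Ê = ∨-least E⊑Ê L⊑Ê
      canÊ : Hom ring ⌊ Ê ⌋
      canÊ = record
        { ⟦_⟧ = λ t → Hom.⟦_⟧ can t , mem EL⊑Ê (can∈EL t)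
        ; isRingHomomorphism = mkIsRingHomomorphism (λ t → Hom.⟦_⟧ can t , mem EL⊑Ê (can∈EL t))
            (Hom.⟦⟧-cong can) (Hom.+-homo can) (Hom.*-homo can) (Hom.0#-homo can) (Hom.1#-homo can) (Hom.-‿homo can)
        }
      pure : ∀ u v → Hom.⟦_⟧ (conjugate τ) (u ⊗ v) ≈ Hom.⟦_⟧ (homΓ τ ∘ʰ canÊ) (u ⊗ v)
      pure (u , u∈E) (v , v∈L) = trans (*-congˡ (sym (τ-fixes (mem L⊑Ê v∈L) v∈L)))
        (sym (*-homo τ (u , mem E⊑Ê u∈E) (v , mem L⊑Ê v∈L)))

  open Sums ⌊ Ê ⌋

  private
    Everything : Pred |Γ| a
    Everything _ = ⊤

    Γ-isSubgroup : IsSubgroup Everything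
    Γ-isSubgroup = record { resp = λ _ _ → tt ; ε-closed = tt ; ∙-closed = λ _ _ → tt ; ⁻¹-closed = λ _ → tt }

  open Descent φ field⌊ Ê ⌋ dec {Everything} Γ-isSubgroup using (Independent; independent-conjugates)

  -- Coefficients fixed by Γ lie in k, where independence of a basis of E/k applies.
  basis-independent : Independent e
  basis-independent c c-fixed ∑≈0 = proj₂ (proj₂ degree) c′ (begin
    proj₁ (sum (CommutativeRing.+-rawMonoid ⌊ E ⌋) (λ i → Hom.⟦_⟧ (incl k⊑E) (c′ i) E.* basis i))
      ≈⟨ HomProperties.combination-homo (incl E⊑Ê) (λ i → Hom.⟦_⟧ (incl k⊑E) (c′ i)) basis ⟩
    proj₁ (∑ (λ i → Hom.⟦_⟧ φ (c′ i) Ê.* e i))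
      ≈⟨ ∑-cong (λ i → Hom.⟦_⟧ φ (c′ i) Ê.* e i) (λ i → c i Ê.* e i) (λ i → refl) ⟩
    proj₁ (∑ (λ i → c i Ê.* e i))
      ≈⟨ ∑≈0 ⟩
    0# ∎)
    where
    open SetoidReasoning setoid
    module E = CommutativeRing ⌊ E ⌋
    c′ : Fin d → CommutativeRing.Carrier ⌊ k ⌋
    c′ i = proj₁ (c i) , Γ-fixed⇒k (c i) (λ σ → c-fixed i {σ} tt)

  -- The fixed field of a complement

  module _ {G : Pred |Γ| a} (G∈𝓖 : 𝓖 G) where
    private
      L : Subfield
      L = 𝕃 G
      G-isSubgroup : IsSubgroup G
      G-isSubgroup = proj₁ G∈𝓖

    k⊑𝕃 : k ⊑ 𝕃 G
    k⊑𝕃 = mk⊑ λ c∈k → mem k⊑Ê c∈k , λ {σ} _ → fixes σ (_ , c∈k)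

    𝕃⊑Ê : 𝕃 G ⊑ Ê
    𝕃⊑Ê = mk⊑ proj₁

    open E⊗ (𝕃 G) k⊑𝕃
    private
      module T⊗ = CommutativeRing ring

    canÊ : Hom ring ⌊ Ê ⌋
    canÊ = TensorProperties.canonicalʰ (incl k⊑E) (incl k⊑𝕃) (incl E⊑Ê) (incl 𝕃⊑Ê) (λ _ → refl)

    private
      tensor : (Fin d → CommutativeRing.Carrier ⌊ 𝕃 G ⌋) → T
      tensor l = sum T⊗.+-rawMonoid (λ i → basis i ⊗ l i)

      canÊ-tensor : ∀ l → Hom.⟦_⟧ canÊ (tensor l) Ê.≈ ∑ (λ i → Hom.⟦_⟧ (incl 𝕃⊑Ê) (l i) Ê.* e i)
      canÊ-tensor l = trans (HomProperties.sum-homo canÊ (λ i → basis i ⊗ l i))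
        (∑-cong (λ i → e i Ê.* Hom.⟦_⟧ (incl 𝕃⊑Ê) (l i)) (λ i → Hom.⟦_⟧ (incl 𝕃⊑Ê) (l i) Ê.* e i) (λ i → *-comm _ _))

    -- Write σ = u v with u in G and v in H: v fixes the eᵢ and u fixes the coefficients, so the
    -- relation for σ is the image under u of the given one. Existence in the complement property
    -- thus extends the relation from one element to all of Γ.
    relation-conjugates : ∀ (l : Fin d → CommutativeRing.Carrier ⌊ 𝕃 G ⌋) →
      ∑ (λ i → Hom.⟦_⟧ (incl 𝕃⊑Ê) (l i) Ê.* e i) Ê.≈ Ê.0# →
      ∀ (σ : |Γ|) → ∑ (λ i → Hom.⟦_⟧ (incl 𝕃⊑Ê) (l i) Ê.* fun σ (e i)) Ê.≈ Ê.0#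
    relation-conjugates l relation σ with u , v , u∈G , v∈ , σ≈uv , _ ← proj₂ G∈𝓖 σ = begin
      ∑ (λ i → l′ i Ê.* fun σ (e i))
        ≈⟨ ∑-cong (λ i → l′ i Ê.* fun σ (e i)) (λ i → fun u (l′ i) Ê.* fun u (e i)) (λ i → *-cong
             (sym (proj₂ (proj₂ (l i)) {u} u∈G))
             (trans (σ≈uv (e i)) (⟦⟧-cong u {fun v (e i)} {e i} (v∈ (proj₂ (e i)) (proj₂ (basis i)))))) ⟩
      ∑ (λ i → fun u (l′ i) Ê.* fun u (e i))
        ≈⟨ HomProperties.combination-homo uʰ l′ e ⟨
      fun u (∑ (λ i → l′ i Ê.* e i))
        ≈⟨ ⟦⟧-cong u {∑ (λ i → l′ i Ê.* e i)} {Ê.0#} relation ⟩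
      fun u Ê.0#
        ≈⟨ 0#-homo u ⟩
      Ê.0# ∎
      where
      open SetoidReasoning Ê.setoid
      uʰ : Hom ⌊ Ê ⌋ ⌊ Ê ⌋
      uʰ = record { ⟦_⟧ = fun u ; isRingHomomorphism = isRingHomomorphism u }
      l′ : Fin d → Ê.Carrier
      l′ i = Hom.⟦_⟧ (incl 𝕃⊑Ê) (l i)

    canÊ-kernel : ∀ {t} → Hom.⟦_⟧ canÊ t Ê.≈ Ê.0# → t ~ 𝟘
    canÊ-kernel {t} can-t≈0 with l , t≈ ← TensorProperties.tensor-coordinates (incl k⊑E) (incl k⊑𝕃) degree t =
      ~trans t≈ (Sums.∑-zero ring (λ i → basis i ⊗ l i) (λ i →
        ~trans (⊗-cong refl (l≈0 i)) (TensorProperties.⊗-zeroʳ (incl k⊑E) (incl k⊑𝕃) (basis i))))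
      where
      l≈0 : ∀ i → proj₁ (l i) ≈ 0#
      l≈0 = independent-conjugates e basis-independent (λ i → Hom.⟦_⟧ (incl 𝕃⊑Ê) (l i))
        (λ σ _ → relation-conjugates l (trans (sym (canÊ-tensor l)) (trans (Hom.⟦⟧-cong canÊ (~sym t≈)) can-t≈0)) σ)

    canÊ-injective : ∀ {s t} → Hom.⟦_⟧ canÊ s Ê.≈ Hom.⟦_⟧ canÊ t → s ~ t
    canÊ-injective = HomProperties.injective-from-kernel canÊ canÊ-kernel

    open Interpolation (incl k⊑E) (incl E⊑Ê) φ (λ _ → refl) field⌊ k ⌋ field⌊ Ê ⌋ dec degree using (Agree; spans-over-fixed)

    -- If σ and τ agree on E, then σ⁻¹τ lies in H, and τ = σ (σ⁻¹τ) = τ · 1 are two decompositions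
    -- of τ; uniqueness gives σ = τ.
    determined : ∀ {σ τ} → G σ → G τ → Agree σ τ → ∀ x → fun σ x Ê.≈ fun τ x
    determined {σ} {τ} σ∈G τ∈G agree with u , v , _ , _ , _ , unique ← proj₂ G∈𝓖 τ = λ x →
      trans (sym (proj₁ (unique {σ} {σ Γ.⁻¹ Γ.∙ τ} σ∈G fixes-E (λ x → sym (Γ.inverseʳ σ (fun τ x)))) x))
        (proj₁ (unique {τ} {Γ.ε} τ∈G (λ _ _ → refl) (λ x → refl)) x)
      where
      fixes-E : Gal[Ê/ E ] (σ Γ.⁻¹ Γ.∙ τ)
      fixes-E {x} p x∈E = trans (⟦⟧-cong (σ Γ.⁻¹) {fun τ (x , p)} {fun σ (x , p)}
        (trans (⟦⟧-cong τ {x , p} {x , mem E⊑Ê x∈E} refl) (trans (sym (agree (x , x∈E))) (⟦⟧-cong σ {x , mem E⊑Ê x∈E} {x , p} refl))))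
        (Γ.inverseˡ σ (x , p))

    canÊ-surjective : ∀ x → ∃[ t ] Hom.⟦_⟧ canÊ t Ê.≈ x
    canÊ-surjective x with m , m-fixed , m≈x ← spans-over-fixed (proj₂ galois) {G} G-isSubgroup (λ {σ} {τ} → determined {σ} {τ}) x =
      tensor l , trans (canÊ-tensor l) m≈x
      where
      l : Fin d → CommutativeRing.Carrier ⌊ 𝕃 G ⌋
      l i = proj₁ (m i) , proj₂ (m i) , λ {σ} → m-fixed i {σ}

    -- `canÊ` is an isomorphism of E ⊗ Ê^G with Ê, so the field structure and the Galois property
    -- are carried over from Ê, which is Galois over any field between it and k.
    𝕃∈𝓛 : 𝓛 (𝕃 G)
    𝕃∈𝓛 = k⊑𝕃 , isField , galois-reflect inr canÊ (incl 𝕃⊑Ê) (λ _ → *-identityˡ _) canÊ-injective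
      (λ _ _ ss _ _ → All.universal canÊ-surjective ss)
      (galois-over-intermediate (incl k⊑𝕃) (incl 𝕃⊑Ê) φ (λ _ → refl) field⌊ 𝕃 G ⌋ field⌊ Ê ⌋ dec galois)
      where
      isField : IsField ring
      isField = record
        { nontrivial = λ 1~0 → IsField.nontrivial field⌊ Ê ⌋ (trans (sym (Hom.1#-homo canÊ)) (Hom.⟦⟧-cong canÊ 1~0))
        ; invertible = λ {t} t≁0 →
            let y , ty≈1 = IsField.invertible field⌊ Ê ⌋ {Hom.⟦_⟧ canÊ t} (t≁0 ∘ canÊ-kernel)
                s , s≈y = canÊ-surjective y
            in s , canÊ-injective (trans (Hom.*-homo canÊ t s) (trans (*-congˡ s≈y) (trans ty≈1 (sym (Hom.1#-homo canÊ)))))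
        }

    -- Stated for all M of 𝓛 below Ê^G: M = Ê^G yields the inverse of 𝕃, and smaller M yield
    -- minimality.
    G⊆𝔾 : ∀ M → 𝓛 M → M ⊑ 𝕃 G → ∀ {τ} → G τ → 𝔾 M τ
    G⊆𝔾 M M∈𝓛 M⊑𝕃 {τ} τ∈G = Gal[Ê/]⊆𝔾 M M∈𝓛 (⊑-trans M⊑𝕃 𝕃⊑Ê) {τ} λ {x} p x∈M →
      let p′ , fixed = mem M⊑𝕃 x∈M in trans (⟦⟧-cong τ {x , p} {x , p′} refl) (fixed {τ} τ∈G)

    𝔾⊆G : ∀ M → 𝓛 M → M ⊑ 𝕃 G → ∀ {τ} → 𝔾 M τ → G τ
    𝔾⊆G M M∈𝓛 M⊑𝕃 {τ} = comparable-complements Γ G∈𝓖 (𝔾-complement M M∈𝓛) (Gal[Ê/]-isSubgroup E)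
      (λ {τ} → G⊆𝔾 M M∈𝓛 M⊑𝕃 {τ}) {τ}

    𝔾𝕃≐G : 𝔾 (𝕃 G) ≐ G
    𝔾𝕃≐G = (λ {τ} → 𝔾⊆G (𝕃 G) 𝕃∈𝓛 (mk⊑ id) {τ}) , (λ {τ} → G⊆𝔾 (𝕃 G) 𝕃∈𝓛 (mk⊑ id) {τ})

    -- From 𝔾(M) = G follows Ê^G = Ê^𝔾(M), and the latter is contained in M.
    𝕃∈𝓛ₘ : 𝓛ₘ (𝕃 G)
    𝕃∈𝓛ₘ = 𝕃∈𝓛 , λ M M∈𝓛 M⊑𝕃 → ⊑-trans
      (mk⊑ λ (p , fixed) → p , λ {τ} τ∈𝔾 → fixed {τ} (𝔾⊆G M M∈𝓛 M⊑𝕃 {τ} τ∈𝔾))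
      (𝕃𝔾⊑L M M∈𝓛)

  𝕃-antitone : ∀ {G G′ : Pred |Γ| a} → (∀ {τ} → G τ → G′ τ) → 𝕃 G′ ⊑ 𝕃 G
  𝕃-antitone G⊆G′ = mk⊑ λ (p , fixed) → p , λ {τ} τ∈G → fixed {τ} (G⊆G′ {τ} τ∈G)

  𝔾-isComplement : ∀ {L} → 𝓛 L → 𝓖 (𝔾 L)
  𝔾-isComplement {L} = 𝔾-complement L

  -- Minimal fields and the fields above them

  abstract
    -- The fixed field of 𝔾(L) belongs to 𝓛 and lies inside L, so minimality leaves no room between
    -- them.
    minimal≋𝕃𝔾 : ∀ {L} → 𝓛ₘ L → L ≋ 𝕃 (𝔾 L)
    minimal≋𝕃𝔾 {L} (L∈𝓛 , minimal) = minimal (𝕃 (𝔾 L)) (𝕃∈𝓛 (𝔾-isComplement L∈𝓛)) (𝕃𝔾⊑L L L∈𝓛) , 𝕃𝔾⊑L L L∈𝓛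

    minimal⊑Ê : ∀ {L} → 𝓛ₘ L → L ⊑ Ê
    minimal⊑Ê L∈𝓛ₘ = ⊑-trans (proj₁ (minimal≋𝕃𝔾 L∈𝓛ₘ)) (mk⊑ proj₁)

    minimal-compositum : ∀ {L} → 𝓛ₘ L → E ∨ L ≋ Ê
    minimal-compositum {L} L∈𝓛ₘ = ∨-least E⊑Ê (minimal⊑Ê L∈𝓛ₘ) , Potential.Ê⊑EL L (proj₁ L∈𝓛ₘ)

    minimal-𝔾 : ∀ {L} → 𝓛ₘ L → 𝔾 L ≐ Gal[Ê/ L ]
    minimal-𝔾 {L} L∈𝓛ₘ = (λ {τ} → 𝔾⊆Gal[Ê/] L (proj₁ L∈𝓛ₘ) {τ}) , (λ {τ} → Gal[Ê/]⊆𝔾 L (proj₁ L∈𝓛ₘ) (minimal⊑Ê L∈𝓛ₘ) {τ})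

    -- Elements of 𝔾(L) fix L ∩ Ê, hence L₀, and for a minimal field 𝔾(L₀) is all of Gal(Ê/L₀).
    𝔾-monotone : ∀ {L L₀} → 𝓛 L → 𝓛ₘ L₀ → L₀ ⊑ L → ∀ {τ} → 𝔾 L τ → 𝔾 L₀ τ
    𝔾-monotone {L} {L₀} L∈𝓛 L₀∈𝓛ₘ L₀⊑L {τ} τ∈𝔾 =
      proj₂ (minimal-𝔾 L₀∈𝓛ₘ) {τ} λ p x∈L₀ → 𝔾⊆Gal[Ê/] L L∈𝓛 {τ} τ∈𝔾 p (mem L₀⊑L x∈L₀)

    𝔾-minimal : ∀ {L L₀} → 𝓛 L → 𝓛ₘ L₀ → L₀ ⊑ L → 𝔾 L ≐ 𝔾 L₀
    𝔾-minimal {L} {L₀} L∈𝓛 L₀∈𝓛ₘ L₀⊑L =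
        (λ {τ} → 𝔾-monotone L∈𝓛 L₀∈𝓛ₘ L₀⊑L {τ})
      , (λ {τ} → comparable-complements Γ (𝔾-isComplement L∈𝓛) (𝔾-isComplement (proj₁ L₀∈𝓛ₘ)) (Gal[Ê/]-isSubgroup E)
          (λ {τ} → 𝔾-monotone L∈𝓛 L₀∈𝓛ₘ L₀⊑L {τ}) {τ})

    minimal-below : ∀ {L L₀} → 𝓛 L → 𝓛ₘ L₀ → L₀ ⊑ L → L₀ ≋ 𝕃 (𝔾 L)
    minimal-below {L} {L₀} L∈𝓛 L₀∈𝓛ₘ L₀⊑L =
        ⊑-trans (proj₁ (minimal≋𝕃𝔾 L₀∈𝓛ₘ)) (𝕃-antitone (λ {τ} → proj₁ (𝔾-minimal L∈𝓛 L₀∈𝓛ₘ L₀⊑L) {τ}))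
      , ⊑-trans (𝕃-antitone (λ {τ} → proj₂ (𝔾-minimal L∈𝓛 L₀∈𝓛ₘ L₀⊑L) {τ})) (proj₂ (minimal≋𝕃𝔾 L₀∈𝓛ₘ))

  -- The Galois group of the tensor product as the group 𝔾(L)

  module _ (L : Subfield) (L∈𝓛 : 𝓛 L) where
    open Potential L L∈𝓛
    private
      H : Group a a
      H = subgroup (𝔾-isSubgroup L L∈𝓛)
      module H = Group H
      module T⊗ = CommutativeRing ring
      module Aut = Group (Extension.Gal inr)

      aut : Aut.Carrier → Hom ring ring
      aut α = record { ⟦_⟧ = fun α ; isRingHomomorphism = isRingHomomorphism α }

      toEL : Aut.Carrier → |Gal[EL/L]|
      toEL α = endomorphism (can ∘ʰ aut α) (λ t → can∈EL (fun α t))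
        (λ c → trans (Hom.⟦⟧-cong can (fixes α c)) (*-identityˡ _))

      f : Aut.Carrier → H.Carrier
      f α = restriction (toEL α) , toEL α , restricts (toEL α)

      -- Allows any representative in T for an element of Ê, not merely the chosen preimage; the
      -- homomorphism law and injectivity both rest on this freedom.
      f-value : ∀ α {x t} (p : Mem Ê x) → Hom.⟦_⟧ can t ≈ x → proj₁ (fun (proj₁ (f α)) (x , p)) ≈ Hom.⟦_⟧ can (fun α t)
      f-value α {x} {t} p t≈x = Hom.⟦⟧-cong (can ∘ʰ aut α) (preimage-unique (x , mem Ê⊑EL p) t t≈x)

      f-cong : ∀ {α β} → α Aut.≈ β → f α H.≈ f β
      f-cong α≈β (x , p) = Hom.⟦⟧-cong can (α≈β (preimage (x , mem Ê⊑EL p)))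

      f-homo : ∀ α β → f (α Aut.∙ β) H.≈ f α H.∙ f β
      f-homo α β (x , p) = sym (f-value α {t = fun β (preimage (x , mem Ê⊑EL p))} (proj₂ (fun (proj₁ (f β)) (x , p))) refl)

      f-ε : f Aut.ε H.≈ H.ε
      f-ε (x , p) = can-preimage (x , mem Ê⊑EL p)

      f-⁻¹ : ∀ α → f (α Aut.⁻¹) H.≈ f α H.⁻¹
      f-⁻¹ α = GroupProperties.inverseˡ-unique H (f (α Aut.⁻¹)) (f α)
        (H.trans {f (α Aut.⁻¹) H.∙ f α} {f (α Aut.⁻¹ Aut.∙ α)} {H.ε}
          (H.sym {f (α Aut.⁻¹ Aut.∙ α)} {f (α Aut.⁻¹) H.∙ f α} (f-homo (α Aut.⁻¹) α))
          (H.trans {f (α Aut.⁻¹ Aut.∙ α)} {f Aut.ε} {H.ε} (f-cong {α Aut.⁻¹ Aut.∙ α} {Aut.ε} (Aut.inverseˡ α)) f-ε))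

      f-injective : ∀ {α β} → f α H.≈ f β → α Aut.≈ β
      -- An automorphism over L is determined by its values on u ⊗ 1 with u in E, and restriction to
      -- Ê still sees those values.
      f-injective {α} {β} fα≈fβ = TensorProperties.homs-agree (incl k⊑E) (incl k⊑L) (aut α) (aut β) λ u v →
        T⊗.trans (decompose α u v) (T⊗.trans (T⊗.*-cong (on-E u) (T⊗.trans (fixes α v) (T⊗.sym (fixes β v)))) (T⊗.sym (decompose β u v)))
        where
        one : CommutativeRing.Carrier ⌊ L ⌋
        one = 1# , 1-closed L
        decompose : ∀ α u v → fun α (u ⊗ v) ~ fun α (u ⊗ one) ⊙ fun α (Hom.⟦_⟧ inr v)
        decompose α u v = T⊗.trans (⟦⟧-cong α (⊗-cong (sym (*-identityʳ _)) (sym (*-identityˡ _)))) (*-homo α (u ⊗ one) (Hom.⟦_⟧ inr v))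
        on-E : ∀ u → fun α (u ⊗ one) ~ fun β (u ⊗ one)
        on-E (u , u∈E) = can-injective (trans (sym (f-value α (mem E⊑Ê u∈E) (*-identityʳ u)))
          (trans (fα≈fβ (u , mem E⊑Ê u∈E)) (f-value β (mem E⊑Ê u∈E) (*-identityʳ u))))

      f-surjective : ∀ (y : H.Carrier) → ∃[ α ] (∀ {β} → β Aut.≈ α → f β H.≈ y)
      f-surjective (τ , σ , inc , σ≈τ) = α , λ {β} β≈α → H.trans {f β} {f α} {τ , σ , inc , σ≈τ} (f-cong {β} {α} β≈α) fα≈τ
        where
        h : Hom ring ring
        h = preimageʰ ∘ʰ record { ⟦_⟧ = fun σ ; isRingHomomorphism = isRingHomomorphism σ } ∘ʰ canEL
        α : Aut.Carrier
        α = FieldExtension.automorphism inr field⌊ L ⌋ T-isField dec (proj₂ (proj₂ (proj₂ L∈𝓛))) h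
          (λ c → preimage-unique (fun σ (Hom.⟦_⟧ canEL (Hom.⟦_⟧ inr c))) (Hom.⟦_⟧ inr c)
            (trans (*-identityˡ _) (sym (trans (⟦⟧-cong σ {Hom.⟦_⟧ canEL (Hom.⟦_⟧ inr c)} {Hom.⟦_⟧ (incl (⊑∨ʳ E L)) c} (*-identityˡ _)) (fixes σ c)))))
        fα≈τ : f α H.≈ (τ , σ , inc , σ≈τ)
        fα≈τ (x , p) = trans (can-preimage (fun σ (Hom.⟦_⟧ canEL (preimage (x , mem Ê⊑EL p)))))
          (trans (⟦⟧-cong σ {Hom.⟦_⟧ canEL (preimage (x , mem Ê⊑EL p))} {x , mem inc p} (can-preimage (x , mem Ê⊑EL p))) (σ≈τ p))

    potentiallyGaloisWith𝔾 : PotentiallyGaloisWithGroup L H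
    potentiallyGaloisWith𝔾 = L∈𝓛 , f , record
      { isGroupMonomorphism = record
        { isGroupHomomorphism = record
          { isMonoidHomomorphism = record
            { isMagmaHomomorphism = record
              { isRelHomomorphism = record { cong = λ {α} {β} → f-cong {α} {β} }
              ; homo = f-homo
              }
            ; ε-homo = f-ε
            }
          ; ⁻¹-homo = f-⁻¹
          }
        ; injective = λ {α} {β} → f-injective {α} {β}
        }
      ; surjective = f-surjective
      }

  -- Base change from EL₀/L₀ to EL/L

  module _ {L L₀ : Subfield} (L∈𝓛 : 𝓛 L) (L₀∈𝓛 : 𝓛 L₀) (L₀⊑L : L₀ ⊑ L) where
    private
      module P = Potential L L∈𝓛
      module P₀ = Potential L₀ L₀∈𝓛
      EL EL₀ : Subfield
      EL = E ∨ L
      EL₀ = E ∨ L₀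
      open Tensor (incl (⊑∨ʳ E L₀)) (incl L₀⊑L)
      module B = CommutativeRing ring
      inlᴮ : Hom ⌊ EL₀ ⌋ ring
      inlᴮ = TensorProperties.inl (incl (⊑∨ʳ E L₀)) (incl L₀⊑L)
      E⊑EL₀ : E ⊑ EL₀
      E⊑EL₀ = mk⊑ left

      toEL : Hom ring ⌊ EL ⌋
      toEL = TensorProperties.canonicalʰ (incl (⊑∨ʳ E L₀)) (incl L₀⊑L) (incl (∨-monoʳ E L₀⊑L)) (incl (⊑∨ʳ E L)) (λ _ → refl)

      -- The natural map from E ⊗ L over k to EL₀ ⊗ L over L₀. Its composite with `toEL` is the
      -- injection `P.can`; so once `J` is surjective, `toEL` is injective.
      J : Hom P.ring ring
      J = TensorProperties.canonicalʰ (incl k⊑E) (incl P.k⊑L) (inlᴮ ∘ʰ incl E⊑EL₀) inr balance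
        where
        balance : ∀ c → Hom.⟦_⟧ inlᴮ (Hom.⟦_⟧ (incl E⊑EL₀) (Hom.⟦_⟧ (incl k⊑E) c)) ~ Hom.⟦_⟧ inr (Hom.⟦_⟧ (incl P.k⊑L) c)
        balance (c , c∈k) = ~trans (⊗-cong (sym (*-identityˡ c)) refl)
          (~trans (⊗-balance (CommutativeRing.1# ⌊ EL₀ ⌋) (c , mem P₀.k⊑L c∈k) (1# , 1-closed L)) (⊗-cong refl (*-identityʳ c)))

      -- The inclusion L₀ ⊆ L tensored with E. The square `J-R` shows that `J` reaches x ⊗ 1 for
      -- every x in EL₀, since such x come from E ⊗ L₀.
      R : Hom P₀.ring P.ring
      R = TensorProperties.canonicalʰ (incl k⊑E) (incl P₀.k⊑L) (TensorProperties.inl (incl k⊑E) (incl P.k⊑L)) (P.inr ∘ʰ incl L₀⊑L)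
        (λ (c , c∈k) → P.~trans (P.⊗-cong (sym (*-identityˡ c)) refl)
          (P.~trans (P.⊗-balance (CommutativeRing.1# ⌊ E ⌋) (c , c∈k) (1# , 1-closed L)) (P.⊗-cong refl (*-identityʳ c))))

      toEL-J : ∀ t → proj₁ (Hom.⟦_⟧ toEL (Hom.⟦_⟧ J t)) ≈ Hom.⟦_⟧ P.can t
      toEL-J = TensorProperties.homs-agree (incl k⊑E) (incl P.k⊑L) (inclusion EL ∘ʰ toEL ∘ʰ J) P.can
        λ (x , _) (y , _) → *-cong (*-identityʳ x) (*-identityˡ y)

      J-R : ∀ t → Hom.⟦_⟧ J (Hom.⟦_⟧ R t) ~ Hom.⟦_⟧ inlᴮ (Hom.⟦_⟧ P₀.canEL t)
      J-R = TensorProperties.homs-agree (incl k⊑E) (incl P₀.k⊑L) (J ∘ʰ R) (inlᴮ ∘ʰ P₀.canEL) pure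
        where
        pure : ∀ u v → Hom.⟦_⟧ (J ∘ʰ R) (u P₀.⊗ v) ~ Hom.⟦_⟧ (inlᴮ ∘ʰ P₀.canEL) (u P₀.⊗ v)
        pure (u , u∈E) (v , v∈L₀) =
          ~trans {y = (u , left u∈E) ⊗ (v , mem L₀⊑L v∈L₀)} (⊗-cong (trans (*-identityʳ _) (*-identityʳ u)) (trans (*-identityˡ _) (*-identityˡ v)))
          (~sym (~trans (⊗-balance (u , left u∈E) (v , v∈L₀) (1# , 1-closed L)) (⊗-cong refl (*-identityʳ v))))

      J-surjective : ∀ t → ∃[ s ] Hom.⟦_⟧ J s ~ t
      J-surjective 𝟘       = P.𝟘 , ~refl
      J-surjective (s ⊕ t) = let s′ , p = J-surjective s ; t′ , q = J-surjective t in s′ P.⊕ t′ , ⊕-cong p q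
      J-surjective (⊖ t)   = let t′ , q = J-surjective t in P.⊖ t′ , ⊖-cong q
      J-surjective (x ⊗ y) = Hom.⟦_⟧ R s P.⊙ Hom.⟦_⟧ P.inr y , ~trans (Hom.*-homo J (Hom.⟦_⟧ R s) (Hom.⟦_⟧ P.inr y))
        (~trans {y = Hom.⟦_⟧ inlᴮ x ⊙ Hom.⟦_⟧ inr y} (B.*-cong (~trans (J-R s) (⊗-cong (P₀.can-preimage x) refl)) J-inr)
        (⊗-cong (*-identityʳ _) (*-identityˡ _)))
        where
        s : P₀.T
        s = P₀.preimage x
        J-inr : Hom.⟦_⟧ J (Hom.⟦_⟧ P.inr y) ~ Hom.⟦_⟧ inr y
        J-inr = ⊗-cong (*-identityˡ 1#) (*-identityˡ _)

    baseChange : Tensor.IsBaseChange (incl (⊑∨ʳ E L₀)) (incl L₀⊑L) (incl (∨-monoʳ E L₀⊑L)) (incl (⊑∨ʳ E L))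
    baseChange = record
      { isRingMonomorphism = record
        { isRingHomomorphism = Hom.isRingHomomorphism toEL
        ; injective = HomProperties.injective-from-kernel toEL kernel
        }
      ; surjective = λ y → Hom.⟦_⟧ J (P.preimage y) , λ {t} t~ →
          trans (Hom.⟦⟧-cong toEL t~) (trans (toEL-J (P.preimage y)) (P.can-preimage y))
      }
      where
      kernel : ∀ {t} → proj₁ (Hom.⟦_⟧ toEL t) ≈ 0# → t ~ 𝟘
      kernel {t} e with s , Js~t ← J-surjective t = ~trans (~sym Js~t) (~trans (Hom.⟦⟧-cong J {s} {P.𝟘}
        (P.can-injective {s} {P.𝟘} (trans (sym (toEL-J s)) (trans (Hom.⟦⟧-cong toEL Js~t) e)))) (Hom.0#-homo J))

  -- Conjugates over k and the case of a Galois field L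

  private
    Root : Carrier → List (CommutativeRing.Carrier ⌊ k ⌋) → Set a
    Root = Extension._IsRootOf_ (inclusion k)

  -- The hypothesis on s says that k[x] → k[s], x ↦ s is well defined.
  normal⇒conjugate∈ : ∀ N (k⊑N : k ⊑ N) → Extension.IsNormal (incl k⊑N) → ∀ {x} → Mem N x →
    ∀ s → (∀ f → Root x f → Root s f) → Mem N s
  normal⇒conjugate∈ N k⊑N normal {x} x∈N s conj with cs , (root , _) , ss , splits ← normal (x , x∈N) =
    among-members N ss (FieldExtension.root-among (inclusion k) field⌊ k ⌋ Ω-isField dec {s} cs (List.map proj₁ ss)
      (map-splits (incl k⊑N) (inclusion N) (inclusion k) (λ _ → refl) (Polynomial.monic ⌊ k ⌋ cs) ss splits)
      (conj (Polynomial.monic ⌊ k ⌋ cs) (FieldExtension.hom-root (inclusion k) field⌊ k ⌋ Ω-isField dec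
        (inclusion N) (incl k⊑N) (λ _ → refl) {x , x∈N} {Polynomial.monic ⌊ k ⌋ cs} root)))

  normal-invariant : ∀ N (k⊑N : k ⊑ N) → Extension.IsNormal (incl k⊑N) → ∀ (γ : |Γ|) {x} (p : Mem Ê x) →
    Mem N x → Mem N (proj₁ (fun γ (x , p)))
  normal-invariant N k⊑N normal γ {x} p x∈N = normal⇒conjugate∈ N k⊑N normal x∈N (proj₁ (fun γ (x , p))) λ f root →
    FieldExtension.hom-root (inclusion k) field⌊ k ⌋ Ω-isField dec (homΓ γ) φ (fixes γ) {x , p} {f}
      (trans (evalAt-∘ (inclusion Ê) φ (inclusion k) (λ _ → refl) (x , p) f) root)

  minimal⇒specialisation : ∀ x cs → Extension.IsMinimalPolynomial φ x cs → ∀ s →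
    Extension._IsRootOf_ φ s (Polynomial.monic ⌊ k ⌋ cs) → ∀ f → Root (proj₁ x) f → Root (proj₁ s) f
  minimal⇒specialisation x cs minimal s s-root f root =
    let q , e = MinimalPolynomial.minimal-divides φ field⌊ k ⌋ field⌊ Ê ⌋ dec {x} {cs} minimal f
          (trans (evalAt-∘ (inclusion Ê) φ (inclusion k) (λ _ → refl) x f) root)
    in trans (ev.⟦⟧-cong {f} {Polynomial._*ₚ_ ⌊ k ⌋ (Polynomial.monic ⌊ k ⌋ cs) q} e)
         (trans (ev.*-homo (Polynomial.monic ⌊ k ⌋ cs) q) (trans (*-congʳ s-root′) (zeroˡ _)))
    where
    module ev = Hom (evalAt (inclusion k) (proj₁ s))
    s-root′ : Root (proj₁ s) (Polynomial.monic ⌊ k ⌋ cs)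
    s-root′ = FieldExtension.hom-root (inclusion k) field⌊ k ⌋ Ω-isField dec (inclusion Ê) φ (λ _ → refl)
      {s} {Polynomial.monic ⌊ k ⌋ cs} s-root

  module _ {L L₀ : Subfield} (L∈𝓛 : 𝓛 L) (L₀∈𝓛ₘ : 𝓛ₘ L₀) (L₀⊑L : L₀ ⊑ L) (k⊑L : k ⊑ L) (k⊑L₀ : k ⊑ L₀)
    (L-galois : IsGalois k⊑L) where

    -- Elements of L ∩ Ê are fixed by 𝔾(L), whose fixed field in Ê is L₀.
    L∩Ê⊑L₀ : ∀ {x} → Mem L x → Mem Ê x → Mem L₀ x
    L∩Ê⊑L₀ x∈L p = mem (proj₂ (minimal-below L∈𝓛 L₀∈𝓛ₘ L₀⊑L)) (p , λ {τ} τ∈𝔾 → 𝔾⊆Gal[Ê/] L L∈𝓛 {τ} τ∈𝔾 p x∈L)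

    -- The conjugates of an element of L₀ lie in Ê and, L/k being normal, in L; hence they lie in
    -- L₀.
    minimal-galois : IsGalois k⊑L₀
    minimal-galois = galois-reflect (incl k⊑L₀) (incl (minimal⊑Ê L₀∈𝓛ₘ)) φ (λ _ → refl) id roots-in-L₀ galois
      where
      L₀⊑Ê : L₀ ⊑ Ê
      L₀⊑Ê = minimal⊑Ê L₀∈𝓛ₘ
      in-L₀ : ∀ x cs → Extension.IsMinimalPolynomial φ (Hom.⟦_⟧ (incl L₀⊑Ê) x) cs → ∀ {s} →
        Extension._IsRootOf_ φ s (Polynomial.monic ⌊ k ⌋ cs) → ∃[ t ] CommutativeRing._≈_ ⌊ Ê ⌋ (Hom.⟦_⟧ (incl L₀⊑Ê) t) s
      in-L₀ x cs minimal {s} s-root = (proj₁ s , L∩Ê⊑L₀ s∈L (proj₂ s)) , refl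
        where
        s∈L : Mem L (proj₁ s)
        s∈L = normal⇒conjugate∈ L k⊑L (proj₂ L-galois) (mem L₀⊑L (proj₂ x)) (proj₁ s)
          (minimal⇒specialisation (Hom.⟦_⟧ (incl L₀⊑Ê) x) cs minimal s s-root)
      roots-in-L₀ : ∀ x cs ss → Extension.IsMinimalPolynomial φ (Hom.⟦_⟧ (incl L₀⊑Ê) x) cs →
        Extension.SplitsInto φ (Polynomial.monic ⌊ k ⌋ cs) ss →
        All (λ s → ∃[ t ] CommutativeRing._≈_ ⌊ Ê ⌋ (Hom.⟦_⟧ (incl L₀⊑Ê) t) s) ss
      roots-in-L₀ x cs ss minimal splits = All.map (λ {s} → in-L₀ x cs minimal {s})
        (FieldExtension.among-roots φ field⌊ k ⌋ field⌊ Ê ⌋ dec cs ss splits)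

    -- Since L₀/k is normal, g⁻¹ maps L₀ into itself, where u acts trivially; so g u g⁻¹ fixes L₀
    -- and lies in Gal(Ê/L₀) = 𝔾(L₀) = 𝔾(L).
    𝔾-normal : IsNormalSubset (𝔾 L)
    𝔾-normal g {u} u∈𝔾 = proj₂ (𝔾-minimal L∈𝓛 L₀∈𝓛ₘ L₀⊑L) {g Γ.∙ u Γ.∙ g Γ.⁻¹}
      (proj₂ (minimal-𝔾 L₀∈𝓛ₘ) {g Γ.∙ u Γ.∙ g Γ.⁻¹} λ {x} p x∈L₀ →
        let y = fun (g Γ.⁻¹) (x , p)
            y∈L₀ = normal-invariant L₀ k⊑L₀ (proj₂ minimal-galois) (g Γ.⁻¹) p x∈L₀
        in trans (⟦⟧-cong g {fun u y} {y} (𝔾⊆Gal[Ê/] L L∈𝓛 {u} u∈𝔾 (proj₂ y) (mem L₀⊑L y∈L₀))) (Γ.inverseʳ g (x , p)))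

theorem2p5 :
  ∀ {a} → ExcludedMiddle (lsuc a) →
  (Ω : CommutativeRing a a) → IsField Ω →
  let open Subfields Ω in
  (k E Ê : Subfield) (k⊑E : k ⊑ E) (E⊑Ê : E ⊑ Ê) (d : ℕ) →
  HasDegree k⊑E d → IsSeparable k⊑E → IsGaloisClosure k⊑E E⊑Ê →
  let open Setting Ω k E Ê k⊑E E⊑Ê in
  -- res : Gal(EL/L) → Gal(Ê/k) is defined for L ∈ 𝓛, and 𝔾 maps 𝓛 to 𝓖
  (∀ L → 𝓛 L → ∀ σ → ∃[ τ ] Restricts L σ τ) ×
  Σ[ 𝔾∈𝓖 ∈ (∀ {L} → 𝓛 L → 𝓖 (𝔾 L)) ]
  -- (a)
  (Σ[ 𝕃∈𝓛ₘ ∈ (∀ {G} → 𝓖 G → 𝓛ₘ (𝕃 G)) ]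
    IsInverse (_≋_ on proj₁) (_≐_ on proj₁)
      (map 𝔾 (λ {L} (h : 𝓛ₘ L) → 𝔾∈𝓖 (proj₁ h)))
      (map 𝕃 (λ {G} (h : 𝓖 G) → 𝕃∈𝓛ₘ h))) ×
  -- (b)
  (∀ L → 𝓛ₘ L →
    L ⊑ Ê ×
    E ∨ L ≋ Ê ×
    (Σ[ H ∈ Subset.IsSubgroup Γ (𝔾 L) ] PotentiallyGaloisWithGroup L (Subset.subgroup Γ H)) ×
    𝔾 L ≐ Gal[Ê/ L ]) ×
  -- (c)
  (∀ L (L∈𝓛 : 𝓛 L) →
    ∃! _≋_ (λ L₀ → 𝓛ₘ L₀ × L₀ ⊑ L) ×
    (∀ L₀ (L₀∈𝓛ₘ : 𝓛ₘ L₀) (L₀⊑L : L₀ ⊑ L) →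
      L₀ ≋ 𝕃 (𝔾 L) ×
      Tensor.IsBaseChange (incl (⊑∨ʳ E L₀)) (incl L₀⊑L) (incl (∨-monoʳ E L₀⊑L)) (incl (⊑∨ʳ E L)) ×
      𝔾 L ≐ 𝔾 L₀ ×
      (IsGalois (proj₁ L∈𝓛) →
        IsGalois (proj₁ (proj₁ L₀∈𝓛ₘ)) × Subset.IsNormalSubset Γ (𝔾 L))))
theorem2p5 {a} em Ω Ω-isField k E Ê k⊑E E⊑Ê d degree _ closure =
    (λ L L∈𝓛 σ → Potential.restriction L L∈𝓛 σ , Potential.restricts L L∈𝓛 σ)
  , (λ {L} → 𝔾-complement L)
  , ((λ {G} G∈𝓖 → 𝕃∈𝓛ₘ {G} G∈𝓖) , bijection)
  , (λ L L∈𝓛ₘ → minimal⊑Ê L∈𝓛ₘ , minimal-compositum L∈𝓛ₘ ,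
      (𝔾-isSubgroup L (proj₁ L∈𝓛ₘ) , potentiallyGaloisWith𝔾 L (proj₁ L∈𝓛ₘ)) , minimal-𝔾 L∈𝓛ₘ)
  , λ L L∈𝓛 →
      (𝕃 (𝔾 L) , (𝕃∈𝓛ₘ (𝔾-complement L L∈𝓛) , 𝕃𝔾⊑L L L∈𝓛) ,
        λ (L₀∈𝓛ₘ , L₀⊑L) → swap (minimal-below L∈𝓛 L₀∈𝓛ₘ L₀⊑L))
    , λ L₀ L₀∈𝓛ₘ L₀⊑L →
        minimal-below L∈𝓛 L₀∈𝓛ₘ L₀⊑L , baseChange L∈𝓛 (proj₁ L₀∈𝓛ₘ) L₀⊑L , 𝔾-minimal L∈𝓛 L₀∈𝓛ₘ L₀⊑L ,
        λ L-galois → minimal-galois L∈𝓛 L₀∈𝓛ₘ L₀⊑L (proj₁ L∈𝓛) (proj₁ (proj₁ L₀∈𝓛ₘ)) L-galois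
                   , (λ g {u} → 𝔾-normal L∈𝓛 L₀∈𝓛ₘ L₀⊑L (proj₁ L∈𝓛) (proj₁ (proj₁ L₀∈𝓛ₘ)) L-galois g {u})
  where
  open Subfields Ω
  open Setting Ω k E Ê k⊑E E⊑Ê
  dec : ExcludedMiddle a
  dec = excluded-middle em
  open GaloisClosure dec Ω Ω-isField k E Ê k⊑E E⊑Ê degree closure

  ≋-refl : ∀ {L} → L ≋ L
  ≋-refl = mk⊑ id , mk⊑ id

  ≋-trans : ∀ {L M N} → L ≋ M → M ≋ N → L ≋ N
  ≋-trans (p , q) (p′ , q′) = ⊑-trans p p′ , ⊑-trans q′ q

  Gal[Ê/]-antitone : ∀ {L L′} → L′ ⊑ L → ∀ {τ} → Gal[Ê/ L ] τ → Gal[Ê/ L′ ] τ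
  Gal[Ê/]-antitone L′⊑L fixed p x∈L′ = fixed p (mem L′⊑L x∈L′)

  -- For equal but not identical L and L′ the groups Gal(EL/L) and Gal(EL′/L′) act on different
  -- carriers; comparing through Gal(Ê/L) avoids transporting automorphisms.
  𝔾-cong : ∀ {L L′} → 𝓛ₘ L → 𝓛ₘ L′ → L ≋ L′ → 𝔾 L ≐ 𝔾 L′
  𝔾-cong {L} {L′} L∈ L′∈ (L⊑L′ , L′⊑L) =
      (λ {τ} τ∈ → proj₂ (minimal-𝔾 L′∈) {τ} (Gal[Ê/]-antitone {L} {L′} L′⊑L {τ} (proj₁ (minimal-𝔾 L∈) {τ} τ∈)))
    , (λ {τ} τ∈ → proj₂ (minimal-𝔾 L∈) {τ} (Gal[Ê/]-antitone {L′} {L} L⊑L′ {τ} (proj₁ (minimal-𝔾 L′∈) {τ} τ∈)))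

  𝕃-cong : ∀ {G G′} → G ≐ G′ → 𝕃 G ≋ 𝕃 G′
  𝕃-cong (G⊆G′ , G′⊆G) = 𝕃-antitone (λ {τ} → G′⊆G {τ}) , 𝕃-antitone (λ {τ} → G⊆G′ {τ})

  bijection : IsInverse (_≋_ on proj₁) (_≐_ on proj₁)
    (map 𝔾 (λ {L} (h : 𝓛ₘ L) → 𝔾-complement L (proj₁ h))) (map 𝕃 (λ {G} (h : 𝓖 G) → 𝕃∈𝓛ₘ h))
  bijection = record
    { isLeftInverse = record
      { isCongruent = record
        { cong = λ { {_ , L∈} {_ , L′∈} → 𝔾-cong L∈ L′∈ }
        ; isEquivalence₁ = record { refl = ≋-refl ; sym = swap ; trans = ≋-trans }
        ; isEquivalence₂ = record { refl = id , id ; sym = swap ; trans = λ (p , q) (p′ , q′) → (λ {τ} → p′ {τ} ∘ p {τ}) , (λ {τ} → q {τ} ∘ q′ {τ}) }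
        }
      ; from-cong = λ G≐G′ → 𝕃-cong G≐G′
      ; inverseˡ = λ { {G , G∈} {L , L∈} L≋𝕃G →
          let p , q = 𝔾-cong L∈ (𝕃∈𝓛ₘ G∈) L≋𝕃G
              p′ , q′ = 𝔾𝕃≐G G∈
          in (λ {τ} → p′ {τ} ∘ p {τ}) , (λ {τ} → q {τ} ∘ q′ {τ}) }
      }
    ; inverseʳ = λ { {L , L∈} {G , G∈} G≐𝔾L → ≋-trans (𝕃-cong G≐𝔾L) (swap (minimal≋𝕃𝔾 L∈)) }
    }
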